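{- The real number $\zeta(3)=\sum_{n=1}^{\infty}\frac{1}{n^3}$ is irrational.
   Context: $\zeta(s)=\sum_{n=1}^{\infty} n^{ -s}$ denotes the Riemann zeta function (for real $s>1$). -}

module Defs where

open import Data.Nat.Base as ℕ using (ℕ; zero; suc; NonTrivial)
import Data.Nat.Properties as ℕ
open import Data.Integer.Base as ℤ using (+_; +[1+_])
import Data.Integer.Properties as ℤ
open import Data.Rational.Base
open import Data.Rational.Properties
import Data.Rational.Solver as ℚ-Solver
import Data.Rational.Unnormalised.Base as ℚᵘ
import Data.Rational.Unnormalised.Properties as ℚᵘ
open import Data.Product using (∃-syntax; _,_)
open import Data.Sum using (inj₁; inj₂)
open import Relation.Nullary using (¬_)
open import Relation.Binary.PropositionalEquality

-- Real numbers are Cauchy sequences of rationals. Their equality is _≈_, not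
-- propositional equality: two sequences are equal reals when their difference
-- tends to 0.

IsCauchy : (ℕ → ℚ) → Set
IsCauchy x = ∀ ε → 0ℚ < ε →
  ∃[ N ] (∀ m n → N ℕ.≤ m → N ℕ.≤ n → ∣ x m - x n ∣ < ε)

record ℝ : Set where
  constructor mkℝ
  field
    seq    : ℕ → ℚ
    cauchy : IsCauchy seq

open ℝ public

infix 4 _≈_

_≈_ : ℝ → ℝ → Set
x ≈ y = ∀ ε → 0ℚ < ε →
  ∃[ N ] (∀ n → N ℕ.≤ n → ∣ seq x n - seq y n ∣ < ε)

fromℚ : ℚ → ℝ
fromℚ q = mkℝ (λ _ → q) λ ε 0<ε →
  0 , λ _ _ _ _ → subst (_< ε) (sym (cong ∣_∣ (+-inverseʳ q))) 0<ε

Irrational : ℝ → Set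
Irrational x = ¬ (∃[ q ] x ≈ fromℚ q)

partialSum : (ℕ → ℚ) → ℕ → ℚ
partialSum a zero    = 0ℚ
partialSum a (suc n) = partialSum a n + a n

-- The summation index is shifted by one: the n-th term is 1 / (n + 1)^s.
ζ-term : ℕ → ℕ → ℚ
ζ-term s n = (+ 1 / (suc n ℕ.^ s)) {{ℕ.m^n≢0 (suc n) s}}

private

  toℚᵘ-1/ : ∀ a → toℚᵘ (+ 1 / suc a) ℚᵘ.≃ ℚᵘ.mkℚᵘ (+ 1) a
  toℚᵘ-1/ a = toℚᵘ-fromℚᵘ (ℚᵘ.mkℚᵘ (+ 1) a)

  1/-add-≤ : ∀ a b c .{{_ : ℕ.NonZero a}} .{{_ : ℕ.NonZero b}} .{{_ : ℕ.NonZero c}} →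
             (b ℕ.+ a) ℕ.* c ℕ.≤ a ℕ.* b → + 1 / a + + 1 / b ≤ + 1 / c
  1/-add-≤ (suc a) (suc b) (suc c) h = toℚᵘ-cancel-≤ (begin
    toℚᵘ (+ 1 / suc a + + 1 / suc b)
      ≃⟨ toℚᵘ-homo-+ (+ 1 / suc a) (+ 1 / suc b) ⟩
    toℚᵘ (+ 1 / suc a) ℚᵘ.+ toℚᵘ (+ 1 / suc b)
      ≃⟨ ℚᵘ.+-cong (toℚᵘ-1/ a) (toℚᵘ-1/ b) ⟩
    ℚᵘ.mkℚᵘ (+ 1) a ℚᵘ.+ ℚᵘ.mkℚᵘ (+ 1) b
      ≤⟨ ℚᵘ.*≤* (subst₂ ℤ._≤_ lhs (sym (ℤ.*-identityˡ (+ (suc a ℕ.* suc b)))) (ℤ.+≤+ h)) ⟩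
    ℚᵘ.mkℚᵘ (+ 1) c
      ≃⟨ toℚᵘ-1/ c ⟨
    toℚᵘ (+ 1 / suc c) ∎)
    where
    open ℚᵘ.≤-Reasoning
    lhs : + ((suc b ℕ.+ suc a) ℕ.* suc c) ≡
          (+ 1 ℤ.* + suc b ℤ.+ + 1 ℤ.* + suc a) ℤ.* + suc c
    lhs = trans (ℤ.pos-* (suc b ℕ.+ suc a) (suc c))
      (sym (cong (ℤ._* + suc c)
        (cong₂ ℤ._+_ (ℤ.*-identityˡ (+ suc b)) (ℤ.*-identityˡ (+ suc a)))))

  0<1/ : ∀ a .{{_ : ℕ.NonZero a}} → 0ℚ < + 1 / a
  0<1/ a = positive⁻¹ (+ 1 / a) {{normalize-pos 1 a}}

  module _ (s : ℕ) .{{_ : NonTrivial s}} where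

    S U : ℕ → ℚ
    S = partialSum (ζ-term s)
    U n = S (suc n) + + 1 / suc n

    k²≤kˢ : ∀ c → suc (suc c) ℕ.* suc c ℕ.≤ suc (suc c) ℕ.^ s
    k²≤kˢ c = begin
      suc (suc c) ℕ.* suc c               ≤⟨ ℕ.*-monoʳ-≤ (suc (suc c)) (ℕ.n≤1+n (suc c)) ⟩
      suc (suc c) ℕ.* suc (suc c)         ≡⟨ cong (suc (suc c) ℕ.*_) (ℕ.*-identityʳ (suc (suc c))) ⟨
      suc (suc c) ℕ.^ 2                   ≤⟨ ℕ.^-monoʳ-≤ (suc (suc c)) (ℕ.nonTrivial⇒n>1 s) ⟩
      suc (suc c) ℕ.^ s                   ∎
      where open ℕ.≤-Reasoning

    term-≤ : ∀ n → ζ-term s (suc n) + + 1 / suc (suc n) ≤ + 1 / suc n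
    term-≤ n = 1/-add-≤ a b c {{ℕ.m^n≢0 b s}} (begin
      (b ℕ.+ a) ℕ.* c       ≡⟨ ℕ.*-distribʳ-+ c b a ⟩
      b ℕ.* c ℕ.+ a ℕ.* c   ≤⟨ ℕ.+-monoˡ-≤ (a ℕ.* c) (k²≤kˢ n) ⟩
      a ℕ.+ a ℕ.* c         ≡⟨ ℕ.*-suc a c ⟨
      a ℕ.* b               ∎)
      where
      open ℕ.≤-Reasoning
      c = suc n
      b = suc c
      a = b ℕ.^ s

    S-step : ∀ n → S n ≤ S (suc n)
    S-step n = begin
      S n            ≡⟨ +-identityʳ (S n) ⟨
      S n + 0ℚ       ≤⟨ +-monoʳ-≤ (S n) (<⇒≤ (0<1/ (suc n ℕ.^ s) {{ℕ.m^n≢0 (suc n) s}})) ⟩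
      S (suc n)      ∎
      where open ≤-Reasoning

    U-step : ∀ n → U (suc n) ≤ U n
    U-step n = begin
      S (suc n) + ζ-term s (suc n) + + 1 / suc (suc n)
        ≡⟨ +-assoc (S (suc n)) (ζ-term s (suc n)) (+ 1 / suc (suc n)) ⟩
      S (suc n) + (ζ-term s (suc n) + + 1 / suc (suc n))
        ≤⟨ +-monoʳ-≤ (S (suc n)) (term-≤ n) ⟩
      U n ∎
      where open ≤-Reasoning

    S-mono′ : ∀ {m n} → m ℕ.≤′ n → S m ≤ S n
    S-mono′ (ℕ.≤′-reflexive refl) = ≤-refl
    S-mono′ (ℕ.≤′-step {n} p)     = ≤-trans (S-mono′ p) (S-step n)

    U-anti′ : ∀ {m n} → m ℕ.≤′ n → U n ≤ U m
    U-anti′ (ℕ.≤′-reflexive refl) = ≤-refl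
    U-anti′ (ℕ.≤′-step {n} p)     = ≤-trans (U-step n) (U-anti′ p)

    S≤U : ∀ n → S (suc n) ≤ U n
    S≤U n = begin
      S (suc n)            ≡⟨ +-identityʳ (S (suc n)) ⟨
      S (suc n) + 0ℚ       ≤⟨ +-monoʳ-≤ (S (suc n)) (<⇒≤ (0<1/ (suc n))) ⟩
      U n                  ∎
      where open ≤-Reasoning

    tail-≤ : ∀ {m n} → suc m ℕ.≤ n → S n - S (suc m) ≤ + 1 / suc m
    tail-≤ {m} {suc n} (ℕ.s≤s m≤n) = begin
      S (suc n) - S (suc m)
        ≤⟨ +-monoˡ-≤ (- S (suc m)) (≤-trans (S≤U n) (U-anti′ (ℕ.≤⇒≤′ m≤n))) ⟩
      S (suc m) + + 1 / suc m - S (suc m)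
        ≡⟨ solve 2 (λ x y → x :+ y :- x := y) refl (S (suc m)) (+ 1 / suc m) ⟩
      + 1 / suc m ∎
      where
      open ≤-Reasoning
      open ℚ-Solver.+-*-Solver

    p≤q⇒0≤q-p : ∀ {p q} → p ≤ q → 0ℚ ≤ q - p
    p≤q⇒0≤q-p {p} {q} p≤q = subst (_≤ q - p) (+-inverseʳ p) (+-monoˡ-≤ (- p) p≤q)

    dist-≤ : ∀ {N m n} → suc N ℕ.≤ m → m ℕ.≤ n → ∣ S n - S m ∣ ≤ + 1 / suc N
    dist-≤ {N} {m} {n} N<m m≤n = begin
      ∣ S n - S m ∣     ≡⟨ 0≤p⇒∣p∣≡p (p≤q⇒0≤q-p (S-mono′ (ℕ.≤⇒≤′ m≤n))) ⟩
      S n - S m         ≤⟨ +-monoʳ-≤ (S n) (neg-antimono-≤ (S-mono′ (ℕ.≤⇒≤′ N<m))) ⟩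
      S n - S (suc N)   ≤⟨ tail-≤ (ℕ.≤-trans N<m m≤n) ⟩
      + 1 / suc N       ∎
      where open ≤-Reasoning

    1/-< : ∀ ε → 0ℚ < ε → + 1 / suc (↧ₙ ε) < ε
    1/-< ε@(mkℚ (+ zero)   d _) (*<* (ℤ.+<+ ()))
    1/-< ε@(mkℚ +[1+ n ]   d _) _ = toℚᵘ-cancel-< (ℚᵘ.<-respˡ-≃
      (ℚᵘ.≃-sym (toℚᵘ-1/ (suc d)))
      (ℚᵘ.*<* (subst (ℤ._< +[1+ n ] ℤ.* + suc (suc d)) (sym (ℤ.*-identityˡ (+ suc d)))
        (ℤ.+<+ (ℕ.≤-trans (ℕ.n<1+n (suc d)) (ℕ.m≤n*m (suc (suc d)) (suc n)))))))
    1/-< ε@(mkℚ ℤ.-[1+ n ] d _) (*<* ())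

    S-cauchy : IsCauchy S
    S-cauchy ε 0<ε = suc (↧ₙ ε) , close
      where
      close : ∀ m n → suc (↧ₙ ε) ℕ.≤ m → suc (↧ₙ ε) ℕ.≤ n → ∣ S m - S n ∣ < ε
      close m n N<m N<n with ℕ.≤-total m n
      ... | inj₂ n≤m = ≤-<-trans (dist-≤ N<n n≤m) (1/-< ε 0<ε)
      ... | inj₁ m≤n = subst (_< ε) (d-comm (S n) (S m))
                         (≤-<-trans (dist-≤ N<m m≤n) (1/-< ε 0<ε))
        where
        open ℚ-Solver.+-*-Solver
        d-comm : ∀ p q → ∣ p - q ∣ ≡ ∣ q - p ∣
        d-comm p q = trans (sym (∣-p∣≡∣p∣ (p - q)))
          (cong ∣_∣ (solve 2 (λ p q → :- (p :- q) := q :- p) refl p q))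

-- Only integer arguments s > 1, as required by NonTrivial s. The value is the
-- limit of the partial sums, i.e. the real represented by that sequence.
ζ : (s : ℕ) → .{{_ : NonTrivial s}} → ℝ
ζ s = mkℝ (partialSum (ζ-term s)) (S-cauchy s)

-- Apéry's proof. With t n k = C(n,k) C(n+k,k), the numbers a n = Σₖ (t n k)² and
-- b n = Σₖ (t n k)² · ζ-approx n k satisfy the same three-term recurrence, which
-- creative telescoping verifies term by term. Their Casoratian is therefore
-- 6 / n³, so b n / a n increases to ζ(3) and 0 < a n · ζ(3) - b n ≤ 6 / a n, while
-- the recurrence gives a (n + 1) ≥ 29 · a n for n ≥ 11. If D is a common multiple
-- of 1, …, n, then 2 D³ · b n is an integer. For n = 42^j, Chebyshev's argument
-- with the multinomials (42m)! / ((21m)! (14m)! (6m)! m!) yields such a D with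
-- D³ = o(29ⁿ); for rational ζ(3) of denominator Q, the integer
-- 2 D³ Q (a n · ζ(3) - b n) would then lie strictly between 0 and 1.

module Submission where

-- The denominators decide everything. As a n grows like (1 + √2)^(4n), about 33.97^n, the common
-- multiple D of 1, ..., n has to grow more slowly than 3.23^n. The true rate of the least common
-- multiple is e^n, by the prime number theorem; the elementary bound 4^n is too weak, since 4³ =
-- 64. The start 2, 3, 7 of Sylvester's sequence, with 1/2 + 1/3 + 1/7 = 1 - 1/42, gives about
-- 3.02^n, and the cube of that rate is about 27.6. The number 29 lies between 27.6 and 33.97, with
-- room on both sides. A multinomial coefficient is visibly an integer and is bounded by single
-- terms of the binomial theorem. One such coefficient turns a common multiple for m into one for 42
-- m, and powers of 42 let these passages be chained without rounding.
--
-- The assumption that ζ(3) is a rational q enters only through bounds of q by the rationals b n / a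
-- n, so the whole contradiction takes place in ℚ and ℕ.

-- Absorption rules for binomial coefficients and the products C(n,k) C(n+k,k).

module Binomial where

  open import Data.Nat.Base
  open import Data.Nat.Properties
  open import Data.Nat.Combinatorics
  open import Data.Nat.Solver using (module +-*-Solver)
  open import Relation.Binary.PropositionalEquality
  open +-*-Solver using (solve; _:+_; _:*_; _:=_; con)

  [1+k]*[1+n]C[1+k]≡[1+n]*nCk : ∀ n k → suc k * (suc n C suc k) ≡ suc n * (n C k)
  [1+k]*[1+n]C[1+k]≡[1+n]*nCk zero zero = refl
  [1+k]*[1+n]C[1+k]≡[1+n]*nCk zero (suc k)
    rewrite k>n⇒nCk≡0 {1} {suc (suc k)} (s≤s (s≤s z≤n))
          | k>n⇒nCk≡0 {0} {suc k} (s≤s z≤n) = *-zeroʳ (suc (suc k))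
  [1+k]*[1+n]C[1+k]≡[1+n]*nCk (suc n) zero = begin
    1 * (suc (suc n) C 1)  ≡⟨ cong (1 *_) (nC1≡n (suc (suc n))) ⟩
    1 * suc (suc n)        ≡⟨ *-comm 1 (suc (suc n)) ⟩
    suc (suc n) * 1        ∎
    where open ≡-Reasoning
  [1+k]*[1+n]C[1+k]≡[1+n]*nCk (suc n) (suc k) = begin
    suc (suc k) * (suc (suc n) C suc (suc k))
      ≡⟨ cong (suc (suc k) *_) (nCk+nC[k+1]≡[n+1]C[k+1] (suc n) (suc k)) ⟨
    suc (suc k) * (X + Y)
      ≡⟨ solve 3 (λ k x y → (con 2 :+ k) :* (x :+ y) := x :+ (con 1 :+ k) :* x :+ (con 2 :+ k) :* y) refl k X Y ⟩
    X + suc k * X + suc (suc k) * Y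
      ≡⟨ cong₂ (λ u v → X + u + v) ([1+k]*[1+n]C[1+k]≡[1+n]*nCk n k) ([1+k]*[1+n]C[1+k]≡[1+n]*nCk n (suc k)) ⟩
    X + suc n * (n C k) + suc n * (n C suc k)
      ≡⟨ solve 4 (λ n x u v → x :+ (con 1 :+ n) :* u :+ (con 1 :+ n) :* v := x :+ (con 1 :+ n) :* (u :+ v))
           refl n X (n C k) (n C suc k) ⟩
    X + suc n * (n C k + n C suc k)
      ≡⟨ cong (λ u → X + suc n * u) (nCk+nC[k+1]≡[n+1]C[k+1] n k) ⟩
    suc (suc n) * X ∎
    where
    open ≡-Reasoning
    X = suc n C suc k
    Y = suc n C suc (suc k)

  [1+k]*nC[1+k]+k*nCk≡n*nCk : ∀ n k → suc k * (n C suc k) + k * (n C k) ≡ n * (n C k)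
  [1+k]*nC[1+k]+k*nCk≡n*nCk n k = +-cancelˡ-≡ (n C k) _ _ (begin
    n C k + (suc k * (n C suc k) + k * (n C k))
      ≡⟨ solve 3 (λ k x y → x :+ ((con 1 :+ k) :* y :+ k :* x) := (con 1 :+ k) :* (x :+ y)) refl k (n C k) (n C suc k) ⟩
    suc k * (n C k + n C suc k)
      ≡⟨ cong (suc k *_) (nCk+nC[k+1]≡[n+1]C[k+1] n k) ⟩
    suc k * (suc n C suc k)
      ≡⟨ [1+k]*[1+n]C[1+k]≡[1+n]*nCk n k ⟩
    suc n * (n C k) ∎)
    where open ≡-Reasoning

  -- This is (n + 1 - k) C(n+1,k) = (n + 1) C(n,k) with the negative term moved across, because
  -- subtraction in ℕ truncates.
  [1+n]*nCk+k*[1+n]Ck≡[1+n]*[1+n]Ck : ∀ n k → suc n * (n C k) + k * (suc n C k) ≡ suc n * (suc n C k)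
  [1+n]*nCk+k*[1+n]Ck≡[1+n]*[1+n]Ck n zero = +-identityʳ _
  [1+n]*nCk+k*[1+n]Ck≡[1+n]*[1+n]Ck n (suc k) = begin
    suc n * (n C suc k) + suc k * (suc n C suc k)
      ≡⟨ cong (suc n * (n C suc k) +_) ([1+k]*[1+n]C[1+k]≡[1+n]*nCk n k) ⟩
    suc n * (n C suc k) + suc n * (n C k)
      ≡⟨ solve 3 (λ n x y → n :* y :+ n :* x := n :* (x :+ y)) refl (suc n) (n C k) (n C suc k) ⟩
    suc n * (n C k + n C suc k)
      ≡⟨ cong (suc n *_) (nCk+nC[k+1]≡[n+1]C[k+1] n k) ⟩
    suc n * (suc n C suc k) ∎
    where open ≡-Reasoning

  k≤n⇒nCk>0 : ∀ {n k} → k ≤ n → 0 < n C k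
  k≤n⇒nCk>0 {n} {zero} _ = s≤s z≤n
  k≤n⇒nCk>0 {suc n} {suc k} (s≤s k≤n) = <-≤-trans (k≤n⇒nCk>0 k≤n)
    (≤-trans (m≤m+n (n C k) (n C suc k)) (≤-reflexive (nCk+nC[k+1]≡[n+1]C[k+1] n k)))

  -- By absorption k C(n,k) = n C(n-1,k-1), and the last factor is at least 1.
  n≤k*nCk : ∀ {n k} → 0 < k → k ≤ n → n ≤ k * (n C k)
  n≤k*nCk {suc n} {suc k} _ (s≤s k≤n) = begin
    suc n                    ≡⟨ *-identityʳ (suc n) ⟨
    suc n * 1                ≤⟨ *-monoʳ-≤ (suc n) (k≤n⇒nCk>0 k≤n) ⟩
    suc n * (n C k)          ≡⟨ [1+k]*[1+n]C[1+k]≡[1+n]*nCk n k ⟨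
    suc k * (suc n C suc k)  ∎
    where open ≤-Reasoning

  t : ℕ → ℕ → ℕ
  t n k = (n C k) * ((n + k) C k)

  k>n⇒t≡0 : ∀ {n k} → n < k → t n k ≡ 0
  k>n⇒t≡0 {n} {k} n<k rewrite k>n⇒nCk≡0 n<k = refl

  k≤n⇒t>0 : ∀ {n k} → k ≤ n → 0 < t n k
  k≤n⇒t>0 {n} {k} k≤n = *-mono-≤ (k≤n⇒nCk>0 k≤n) (k≤n⇒nCk>0 (m≤n+m k n))

  -- The quotients (n - k)/(k + 1) of C(n,k) and (n + k + 1)/(k + 1) of C(n+k,k) multiply to (n + k
  -- + 1)(n - k)/(k + 1)²; the term with -k is moved to the other side.
  t-stepʳ : ∀ n k → suc k * suc k * t n (suc k) + suc (n + k) * k * t n k ≡ suc (n + k) * n * t n k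
  t-stepʳ n k rewrite +-suc n k = begin
    suc k * suc k * (X * Z) + N * k * (U * V)
      ≡⟨ solve 7 (λ j x z n k u v → j :* j :* (x :* z) :+ n :* k :* (u :* v) :=
           (j :* x) :* (j :* z) :+ (k :* u) :* (n :* v))
           refl (suc k) X Z N k U V ⟩
    (suc k * X) * (suc k * Z) + (k * U) * (N * V)
      ≡⟨ cong (λ w → (suc k * X) * w + (k * U) * (N * V)) ([1+k]*[1+n]C[1+k]≡[1+n]*nCk (n + k) k) ⟩
    (suc k * X) * (N * V) + (k * U) * (N * V)
      ≡⟨ *-distribʳ-+ (N * V) (suc k * X) (k * U) ⟨
    (suc k * X + k * U) * (N * V)
      ≡⟨ cong (_* (N * V)) ([1+k]*nC[1+k]+k*nCk≡n*nCk n k) ⟩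
    (n * U) * (N * V)
      ≡⟨ solve 4 (λ n u m v → (n :* u) :* (m :* v) := m :* n :* (u :* v)) refl n U N V ⟩
    N * n * (U * V) ∎
    where
    open ≡-Reasoning
    N = suc (n + k)
    X = n C suc k
    Z = N C suc k
    U = n C k
    V = (n + k) C k

  -- Passing to n + 1 multiplies C(n,k) by (n + 1)/(n + 1 - k) and C(n+k,k) by (n + 1 + k)/(n + 1),
  -- so n + 1 cancels.
  t-stepˡ : ∀ n k → suc (n + k) * t n k + k * t (suc n) k ≡ suc n * t (suc n) k
  t-stepˡ n k = begin
    N * (U * V) + k * (X * Y)
      ≡⟨ cong (_+ k * (X * Y)) (solve 3 (λ n u v → n :* (u :* v) := u :* (n :* v)) refl N U V) ⟩
    U * (N * V) + k * (X * Y)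
      ≡⟨ cong (λ w → U * w + k * (X * Y)) NV≡[1+n]Y ⟩
    U * (suc n * Y) + k * (X * Y)
      ≡⟨ solve 5 (λ u n y k x → u :* (n :* y) :+ k :* (x :* y) := (n :* u :+ k :* x) :* y) refl U (suc n) Y k X ⟩
    (suc n * U + k * X) * Y
      ≡⟨ cong (_* Y) ([1+n]*nCk+k*[1+n]Ck≡[1+n]*[1+n]Ck n k) ⟩
    suc n * X * Y
      ≡⟨ *-assoc (suc n) X Y ⟩
    suc n * (X * Y) ∎
    where
    open ≡-Reasoning
    N = suc (n + k)
    U = n C k
    V = (n + k) C k
    X = suc n C k
    Y = N C k
    NV≡[1+n]Y : N * V ≡ suc n * Y
    NV≡[1+n]Y = +-cancelʳ-≡ (k * Y) _ _ (begin
      N * V + k * Y     ≡⟨ [1+n]*nCk+k*[1+n]Ck≡[1+n]*[1+n]Ck (n + k) k ⟩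
      (suc n + k) * Y   ≡⟨ *-distribʳ-+ Y (suc n) k ⟩
      suc n * Y + k * Y ∎)

  -- Both k C(n,k) and k C(n+k,k) are at least n. This makes every correction term in `ζ-approx n k`
  -- at most 1/n², so that n of them still tend to 0.
  n²≤k²t : ∀ {n k} → 0 < k → k ≤ n → n * n ≤ k * k * t n k
  n²≤k²t {n} {k} 0<k k≤n = begin
    n * n                            ≤⟨ *-mono-≤ (n≤k*nCk 0<k k≤n) (≤-trans (m≤m+n n k) (n≤k*nCk 0<k (m≤n+m k n))) ⟩
    k * (n C k) * (k * ((n + k) C k)) ≡⟨ solve 3 (λ k x y → k :* x :* (k :* y) := k :* k :* (x :* y))
         refl k (n C k) ((n + k) C k) ⟩
    k * k * t n k                    ∎
    where open ≤-Reasoning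

-- Embedding of ℕ and ℤ into ℚ, and reciprocals of natural numbers.

module Rationals where

  open import Data.Nat.Base as ℕ using (ℕ; zero; suc)
  import Data.Nat.Properties as ℕ
  import Data.Nat.Coprimality as ℕ
  open import Data.Integer.Base as ℤ using (+_; +[1+_]; -[1+_])
  import Data.Integer.Properties as ℤ
  open import Data.Rational.Base
  open import Data.Rational.Properties
  open import Data.Rational.Literals using (fromℤ)
  import Data.Rational.Unnormalised.Base as ℚᵘ
  import Data.Rational.Unnormalised.Properties as ℚᵘ
  open import Data.Maybe.Base using (Maybe; map)
  open import Relation.Nullary.Decidable using (dec⇒maybe)
  open import Relation.Binary.PropositionalEquality
  open import Algebra.Solver.Ring.AlmostCommutativeRing using (AlmostCommutativeRing; fromCommutativeRing; _-Raw-AlmostCommutative⟶_)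
  import Algebra.Solver.Ring

  fromℕ : ℕ → ℚ
  fromℕ n = fromℤ (+ n)

  fromℤ-homo-+ : ∀ x y → fromℤ (x ℤ.+ y) ≡ fromℤ x + fromℤ y
  fromℤ-homo-+ x y = toℚᵘ-injective (ℚᵘ.≃-trans
    (ℚᵘ.*≡* (cong (ℤ._* + 1) (sym (cong₂ ℤ._+_ (ℤ.*-identityʳ x) (ℤ.*-identityʳ y)))))
    (ℚᵘ.≃-sym (toℚᵘ-homo-+ (fromℤ x) (fromℤ y))))

  fromℤ-homo-* : ∀ x y → fromℤ (x ℤ.* y) ≡ fromℤ x * fromℤ y
  fromℤ-homo-* x y = toℚᵘ-injective (ℚᵘ.≃-trans (ℚᵘ.*≡* refl)
    (ℚᵘ.≃-sym (toℚᵘ-homo-* (fromℤ x) (fromℤ y))))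

  fromℤ-homo-neg : ∀ x → fromℤ (ℤ.- x) ≡ - fromℤ x
  fromℤ-homo-neg (+ zero)  = refl
  fromℤ-homo-neg +[1+ n ]  = refl
  fromℤ-homo-neg -[1+ n ]  = refl

  fromℕ-homo-+ : ∀ m n → fromℕ (m ℕ.+ n) ≡ fromℕ m + fromℕ n
  fromℕ-homo-+ m n = fromℤ-homo-+ (+ m) (+ n)

  fromℕ-homo-* : ∀ m n → fromℕ (m ℕ.* n) ≡ fromℕ m * fromℕ n
  fromℕ-homo-* m n = trans (cong fromℤ (ℤ.pos-* m n)) (fromℤ-homo-* (+ m) (+ n))

  fromℕ-suc : ∀ n → fromℕ (suc n) ≡ 1ℚ + fromℕ n
  fromℕ-suc n = fromℕ-homo-+ 1 n

  ℚ-ring : AlmostCommutativeRing _ _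
  ℚ-ring = fromCommutativeRing +-*-commutativeRing

  fromℤ-morphism : ℤ.+-*-rawRing -Raw-AlmostCommutative⟶ ℚ-ring
  fromℤ-morphism = record
    { ⟦_⟧    = fromℤ
    ; +-homo = fromℤ-homo-+
    ; *-homo = fromℤ-homo-*
    ; -‿homo = fromℤ-homo-neg
    ; 0-homo = refl
    ; 1-homo = refl
    }

  fromℤ-≟ : ∀ x y → Maybe (fromℤ x ≡ fromℤ y)
  fromℤ-≟ x y = map (cong fromℤ) (dec⇒maybe (x ℤ.≟ y))

  -- Integer coefficients normalise much faster than the rational ones of Data.Rational.Solver.
  module ℚ-Solver = Algebra.Solver.Ring ℤ.+-*-rawRing ℚ-ring fromℤ-morphism fromℤ-≟

  open ℚ-Solver using (Polynomial; solve; _:*_; _:=_)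

  κ : ∀ {m} → ℕ → Polynomial m
  κ n = ℚ-Solver.con (+ n)

  fromℤ-mono-≤ : ∀ {x y} → x ℤ.≤ y → fromℤ x ≤ fromℤ y
  fromℤ-mono-≤ {x} {y} x≤y = *≤* (subst₂ ℤ._≤_ (sym (ℤ.*-identityʳ x)) (sym (ℤ.*-identityʳ y)) x≤y)

  fromℕ-mono-≤ : ∀ {m n} → m ℕ.≤ n → fromℕ m ≤ fromℕ n
  fromℕ-mono-≤ m≤n = fromℤ-mono-≤ (ℤ.+≤+ m≤n)

  fromℕ-mono-< : ∀ {m n} → m ℕ.< n → fromℕ m < fromℕ n
  fromℕ-mono-< {m} {n} m<n = *<* (subst₂ ℤ._<_ (sym (ℤ.*-identityʳ (+ m))) (sym (ℤ.*-identityʳ (+ n))) (ℤ.+<+ m<n))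

  0≤fromℕ : ∀ n → 0ℚ ≤ fromℕ n
  0≤fromℕ n = fromℕ-mono-≤ {0} {n} ℕ.z≤n

  -- inv 0 = 0, which makes inv multiplicative without side conditions.
  inv : ℕ → ℚ
  inv zero    = 0ℚ
  inv (suc n) = mkℚ (+ 1) n (ℕ.1-coprimeTo (suc n))

  n*inv[n]≡1 : ∀ {n} → 0 ℕ.< n → fromℕ n * inv n ≡ 1ℚ
  n*inv[n]≡1 {suc n} _ = toℚᵘ-injective (ℚᵘ.≃-trans (toℚᵘ-homo-* (fromℕ (suc n)) (inv (suc n)))
    (ℚᵘ.*≡* (trans (cong (ℤ._* + 1) (ℤ.*-identityʳ (+ suc n))) (trans (ℤ.*-identityʳ (+ suc n)) (trans (cong (λ m → + suc m) (sym (ℕ.+-identityʳ n))) (sym (ℤ.*-identityˡ _)))))))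

  0<inv : ∀ {n} → 0 ℕ.< n → 0ℚ < inv n
  0<inv {suc n} _ = *<* (ℤ.+<+ (ℕ.s≤s ℕ.z≤n))

  inverse-unique : ∀ {x u v} → x * u ≡ 1ℚ → x * v ≡ 1ℚ → u ≡ v
  inverse-unique {x} {u} {v} xu≡1 xv≡1 = begin
    u            ≡⟨ *-identityʳ u ⟨
    u * 1ℚ       ≡⟨ cong (u *_) xv≡1 ⟨
    u * (x * v)  ≡⟨ solve 3 (λ x u v → u :* (x :* v) := x :* u :* v) refl x u v ⟩
    x * u * v    ≡⟨ cong (_* v) xu≡1 ⟩
    1ℚ * v       ≡⟨ *-identityˡ v ⟩
    v            ∎
    where open ≡-Reasoning

  inv-homo-* : ∀ m n → inv (m ℕ.* n) ≡ inv m * inv n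
  inv-homo-* zero n = sym (*-zeroˡ (inv n))
  inv-homo-* m@(suc _) zero = trans (cong inv (ℕ.*-zeroʳ m)) (sym (*-zeroʳ (inv m)))
  inv-homo-* m@(suc _) n@(suc _) = inverse-unique {fromℕ (m ℕ.* n)} (n*inv[n]≡1 {m ℕ.* n} ℕ.z<s) (begin
    fromℕ (m ℕ.* n) * (inv m * inv n)
      ≡⟨ cong (_* (inv m * inv n)) (fromℕ-homo-* m n) ⟩
    fromℕ m * fromℕ n * (inv m * inv n)
      ≡⟨ solve 4 (λ m n u v → m :* n :* (u :* v) := (m :* u) :* (n :* v)) refl (fromℕ m) (fromℕ n) (inv m) (inv n) ⟩
    (fromℕ m * inv m) * (fromℕ n * inv n)
      ≡⟨ cong₂ _*_ (n*inv[n]≡1 {m} ℕ.z<s) (n*inv[n]≡1 {n} ℕ.z<s) ⟩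
    1ℚ ∎)
    where open ≡-Reasoning

  -- The form n² · (1/n) survives n = 0. It is applied to n = t n k, which is 0 for k beyond the
  -- range of summation.
  n*n*inv[n]≡n : ∀ n → fromℕ n * fromℕ n * inv n ≡ fromℕ n
  n*n*inv[n]≡n zero    = refl
  n*n*inv[n]≡n n@(suc _) = trans (*-assoc (fromℕ n) (fromℕ n) (inv n))
    (trans (cong (fromℕ n *_) (n*inv[n]≡1 {n} ℕ.z<s)) (*-identityʳ (fromℕ n)))

  1/n≡inv[n] : ∀ n .{{_ : ℕ.NonZero n}} → + 1 / n ≡ inv n
  1/n≡inv[n] (suc n) = toℚᵘ-injective (toℚᵘ-fromℚᵘ (ℚᵘ.mkℚᵘ (+ 1) n))

-- Apéry's double sequence of approximations to ζ(3) and its change in n.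

module Approximation where

  open import Data.Nat.Base as ℕ using (ℕ; zero; suc)
  import Data.Nat.Properties as ℕ
  open import Data.Rational.Base
  open import Data.Rational.Properties
  open import Relation.Binary.PropositionalEquality
  open import Defs using (partialSum; ζ-term)
  open Binomial
  open Rationals
  open ℚ-Solver using (solve; _:+_; _:*_; _:-_; :-_; _:=_)

  τ : ℕ → ℕ → ℚ
  τ n k = fromℕ (t n k)

  private
    homo₃ : ∀ a b d → fromℕ (a ℕ.* b ℕ.* d) ≡ fromℕ a * fromℕ b * fromℕ d
    homo₃ a b d = trans (fromℕ-homo-* (a ℕ.* b) d) (cong (_* fromℕ d) (fromℕ-homo-* a b))

    k*k[τ]₀ : ∀ n j → let x = fromℕ n ; y = fromℕ j in
      fromℕ (suc j) * fromℕ (suc j) * τ n (suc j) ≡ (x + fromℕ (suc j)) * (x - y) * τ n j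
    k*k[τ]₀ n j = begin
      K * K * τ n (suc j)
        ≡⟨ solve 3 (λ u v w → u := u :+ v :* w :- v :* w) refl (K * K * τ n (suc j)) (N * y) (τ n j) ⟩
      K * K * τ n (suc j) + N * y * τ n j - N * y * τ n j
        ≡⟨ cong (_- N * y * τ n j) step ⟩
      N * x * τ n j - N * y * τ n j
        ≡⟨ solve 4 (λ m x y t → m :* x :* t :- m :* y :* t := m :* (x :- y) :* t) refl N x y (τ n j) ⟩
      N * (x - y) * τ n j
        ≡⟨ cong (λ u → u * (x - y) * τ n j) (trans (cong fromℕ (sym (ℕ.+-suc n j))) (fromℕ-homo-+ n (suc j))) ⟩
      (x + K) * (x - y) * τ n j ∎
      where
      open ≡-Reasoning
      x = fromℕ n
      y = fromℕ j
      K = fromℕ (suc j)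
      N = fromℕ (suc (n ℕ.+ j))
      step : K * K * τ n (suc j) + N * y * τ n j ≡ N * x * τ n j
      step = begin
        K * K * τ n (suc j) + N * y * τ n j
          ≡⟨ cong₂ _+_ (homo₃ (suc j) (suc j) (t n (suc j))) (homo₃ (suc (n ℕ.+ j)) j (t n j)) ⟨
        fromℕ (suc j ℕ.* suc j ℕ.* t n (suc j)) + fromℕ (suc (n ℕ.+ j) ℕ.* j ℕ.* t n j)
          ≡⟨ fromℕ-homo-+ (suc j ℕ.* suc j ℕ.* t n (suc j)) (suc (n ℕ.+ j) ℕ.* j ℕ.* t n j) ⟨
        fromℕ (suc j ℕ.* suc j ℕ.* t n (suc j) ℕ.+ suc (n ℕ.+ j) ℕ.* j ℕ.* t n j)
          ≡⟨ cong fromℕ (t-stepʳ n j) ⟩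
        fromℕ (suc (n ℕ.+ j) ℕ.* n ℕ.* t n j)
          ≡⟨ homo₃ (suc (n ℕ.+ j)) n (t n j) ⟩
        N * x * τ n j ∎

    τ-stepˡ : ∀ n k → let x = fromℕ n ; y = fromℕ k in
      (x + 1ℚ - y) * τ (suc n) k ≡ (x + 1ℚ + y) * τ n k
    τ-stepˡ n k = begin
      (x + 1ℚ - y) * τ (suc n) k
        ≡⟨ solve 3 (λ x y t → (x :+ κ 1 :- y) :* t := (κ 1 :+ x) :* t :- y :* t) refl x y (τ (suc n) k) ⟩
      (1ℚ + x) * τ (suc n) k - y * τ (suc n) k
        ≡⟨ cong (λ u → u * τ (suc n) k - y * τ (suc n) k) (fromℕ-suc n) ⟨
      fromℕ (suc n) * τ (suc n) k - y * τ (suc n) k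
        ≡⟨ cong (_- y * τ (suc n) k) step ⟨
      fromℕ (suc (n ℕ.+ k)) * τ n k + y * τ (suc n) k - y * τ (suc n) k
        ≡⟨ cong (λ u → u * τ n k + y * τ (suc n) k - y * τ (suc n) k)
                (trans (fromℕ-suc (n ℕ.+ k)) (cong (1ℚ +_) (fromℕ-homo-+ n k))) ⟩
      (1ℚ + (x + y)) * τ n k + y * τ (suc n) k - y * τ (suc n) k
        ≡⟨ solve 4 (λ x y t s → (κ 1 :+ (x :+ y)) :* t :+ y :* s :- y :* s := (x :+ κ 1 :+ y) :* t)
             refl x y (τ n k) (τ (suc n) k) ⟩
      (x + 1ℚ + y) * τ n k ∎
      where
      open ≡-Reasoning
      x = fromℕ n
      y = fromℕ k
      step : fromℕ (suc (n ℕ.+ k)) * τ n k + y * τ (suc n) k ≡ fromℕ (suc n) * τ (suc n) k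
      step = begin
        fromℕ (suc (n ℕ.+ k)) * τ n k + y * τ (suc n) k
          ≡⟨ cong₂ _+_ (fromℕ-homo-* (suc (n ℕ.+ k)) (t n k)) (fromℕ-homo-* k (t (suc n) k)) ⟨
        fromℕ (suc (n ℕ.+ k) ℕ.* t n k) + fromℕ (k ℕ.* t (suc n) k)
          ≡⟨ fromℕ-homo-+ (suc (n ℕ.+ k) ℕ.* t n k) (k ℕ.* t (suc n) k) ⟨
        fromℕ (suc (n ℕ.+ k) ℕ.* t n k ℕ.+ k ℕ.* t (suc n) k)
          ≡⟨ cong fromℕ (t-stepˡ n k) ⟩
        fromℕ (suc n ℕ.* t (suc n) k)
          ≡⟨ fromℕ-homo-* (suc n) (t (suc n) k) ⟩
        fromℕ (suc n) * τ (suc n) k ∎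

    clear-k² : ∀ j {u v} → fromℕ (suc j) * fromℕ (suc j) * u ≡ v → u ≡ v * (inv (suc j) * inv (suc j))
    clear-k² j {u} {v} K²u≡v = begin
      u                     ≡⟨ solve 1 (λ u → u := u :* (κ 1 :* κ 1)) refl u ⟩
      u * (1ℚ * 1ℚ)         ≡⟨ cong (λ e → u * (e * e)) (n*inv[n]≡1 {suc j} ℕ.z<s) ⟨
      u * ((K * i) * (K * i)) ≡⟨ solve 3 (λ u k i → u :* ((k :* i) :* (k :* i)) := k :* k :* u :* (i :* i)) refl u K i ⟩
      K * K * u * (i * i)   ≡⟨ cong (_* (i * i)) K²u≡v ⟩
      v * (i * i)           ∎
      where
      open ≡-Reasoning
      K = fromℕ (suc j)
      i = inv (suc j)

  -- Three neighbouring values of τ as polynomial multiples of τ n j / (j + 1)²;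
  -- no division by n - j is involved, so they also hold on the boundary.
  τ[n,1+j] : ∀ n j → τ n (suc j) ≡ (fromℕ n + fromℕ (suc j)) * (fromℕ n - fromℕ j) * τ n j * (inv (suc j) * inv (suc j))
  τ[n,1+j] n j = clear-k² j (k*k[τ]₀ n j)

  τ[1+n,1+j] : ∀ n j → let x = fromℕ n ; k = fromℕ (suc j) in
    τ (suc n) (suc j) ≡ (x + k + 1ℚ) * (x + k) * τ n j * (inv (suc j) * inv (suc j))
  τ[1+n,1+j] n j = clear-k² j (begin
    k * k * τ (suc n) (suc j)
      ≡⟨ k*k[τ]₀ (suc n) j ⟩
    (fromℕ (suc n) + k) * (fromℕ (suc n) - y) * τ (suc n) j
      ≡⟨ cong (λ u → (u + k) * (u - y) * τ (suc n) j) (fromℕ-suc n) ⟩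
    (1ℚ + x + k) * (1ℚ + x - y) * τ (suc n) j
      ≡⟨ solve 4 (λ x k y t → (κ 1 :+ x :+ k) :* (κ 1 :+ x :- y) :* t := (x :+ k :+ κ 1) :* ((x :+ κ 1 :- y) :* t))
           refl x k y (τ (suc n) j) ⟩
    (x + k + 1ℚ) * ((x + 1ℚ - y) * τ (suc n) j)
      ≡⟨ cong ((x + k + 1ℚ) *_) (τ-stepˡ n j) ⟩
    (x + k + 1ℚ) * ((x + 1ℚ + y) * τ n j)
      ≡⟨ cong (λ u → (x + k + 1ℚ) * (u * τ n j)) (trans (+-assoc x 1ℚ y) (cong (_+_ x) (sym (fromℕ-suc j)))) ⟩
    (x + k + 1ℚ) * ((x + k) * τ n j)
      ≡⟨ *-assoc (x + k + 1ℚ) (x + k) (τ n j) ⟨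
    (x + k + 1ℚ) * (x + k) * τ n j ∎)
    where
    open ≡-Reasoning
    x = fromℕ n
    y = fromℕ j
    k = fromℕ (suc j)

  τ[n-1,1+j] : ∀ n j → let x = fromℕ (suc n) ; k = fromℕ (suc j) in
    τ n (suc j) ≡ (x - k) * (x - fromℕ j) * τ (suc n) j * (inv (suc j) * inv (suc j))
  τ[n-1,1+j] n j = clear-k² j (begin
    k * k * τ n (suc j)
      ≡⟨ k*k[τ]₀ n j ⟩
    (x + k) * (x - y) * τ n j
      ≡⟨ cong (λ u → (x + u) * (x - y) * τ n j) (fromℕ-suc j) ⟩
    (x + (1ℚ + y)) * (x - y) * τ n j
      ≡⟨ solve 3 (λ x y t → (x :+ (κ 1 :+ y)) :* (x :- y) :* t := (x :- y) :* ((x :+ κ 1 :+ y) :* t)) refl x y (τ n j) ⟩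
    (x - y) * ((x + 1ℚ + y) * τ n j)
      ≡⟨ cong ((x - y) *_) (τ-stepˡ n j) ⟨
    (x - y) * ((x + 1ℚ - y) * τ (suc n) j)
      ≡⟨ solve 3 (λ x y t → (x :- y) :* ((x :+ κ 1 :- y) :* t) := (κ 1 :+ x :- (κ 1 :+ y)) :* (κ 1 :+ x :- y) :* t)
           refl x y (τ (suc n) j) ⟩
    (1ℚ + x - (1ℚ + y)) * (1ℚ + x - y) * τ (suc n) j
      ≡⟨ cong₂ (λ u v → (u - v) * (u - y) * τ (suc n) j) (fromℕ-suc n) (fromℕ-suc j) ⟨
    (fromℕ (suc n) - k) * (fromℕ (suc n) - y) * τ (suc n) j ∎)
    where
    open ≡-Reasoning
    x = fromℕ n
    y = fromℕ j
    k = fromℕ (suc j)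

  sign : ℕ → ℚ
  sign zero    = 1ℚ
  sign (suc k) = - sign k

  ζ₃ : ℕ → ℚ
  ζ₃ = partialSum (ζ-term 3)

  -- ζ-approx n k is Apéry's c n k = Σ_{m ≤ n} 1/m³ + Σ_{m ≤ k} (-1)^(m-1) / (2 m³ t n m);
  -- the index of correction is shifted by one.
  correction : ℕ → ℕ → ℚ
  correction n j = sign j * (inv 2 * inv (suc j) * inv (suc j) * inv (suc j) * inv (t n (suc j)))

  ζ-approx : ℕ → ℕ → ℚ
  ζ-approx n k = ζ₃ n + partialSum (correction n) k

  ζ-term₃ : ∀ n → ζ-term 3 n ≡ inv (suc n) * inv (suc n) * inv (suc n)
  ζ-term₃ n = begin
    ζ-term 3 n                      ≡⟨ 1/n≡inv[n] (m ℕ.^ 3) {{ℕ.m^n≢0 m 3}} ⟩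
    inv (m ℕ.* (m ℕ.* (m ℕ.* 1)))   ≡⟨ cong (λ u → inv (m ℕ.* (m ℕ.* u))) (ℕ.*-identityʳ m) ⟩
    inv (m ℕ.* (m ℕ.* m))           ≡⟨ inv-homo-* m (m ℕ.* m) ⟩
    inv m * inv (m ℕ.* m)           ≡⟨ cong (inv m *_) (inv-homo-* m m) ⟩
    inv m * (inv m * inv m)         ≡⟨ *-assoc (inv m) (inv m) (inv m) ⟨
    inv m * inv m * inv m           ∎
    where
    open ≡-Reasoning
    m = suc n

  private
    -- Since (1/2k)(1/(n+k) - 1/(n-k)) = -1/(n² - k²), the left side is 1/n² - 1/(n² - k²) = -k²/(n²
    -- (n² - k²)). It is the induction step of `ζ-approx-stepˡ`.
    reciprocals : ∀ n k n⁻¹ k⁻¹ s⁻¹ r⁻¹ h → n * n⁻¹ ≡ 1ℚ → k * k⁻¹ ≡ 1ℚ →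
      (n + k) * s⁻¹ ≡ 1ℚ → (n - k) * r⁻¹ ≡ 1ℚ → fromℕ 2 * h ≡ 1ℚ →
      n⁻¹ * n⁻¹ + h * k⁻¹ * (s⁻¹ - r⁻¹) ≡ - (n⁻¹ * n⁻¹ * s⁻¹ * (k * k * r⁻¹))
    reciprocals n k n⁻¹ k⁻¹ s⁻¹ r⁻¹ h nn⁻¹ kk⁻¹ ss⁻¹ rr⁻¹ 2h = begin
      n⁻¹ * n⁻¹ + h * k⁻¹ * (s⁻¹ - r⁻¹)
        ≡⟨ solve 5 (λ n⁻¹ k⁻¹ s⁻¹ r⁻¹ h → n⁻¹ :* n⁻¹ :+ h :* k⁻¹ :* (s⁻¹ :- r⁻¹) :=
             n⁻¹ :* n⁻¹ :* (κ 1 :* κ 1) :+ h :* k⁻¹ :* (s⁻¹ :* κ 1 :- r⁻¹ :* κ 1)) refl n⁻¹ k⁻¹ s⁻¹ r⁻¹ h ⟩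
      n⁻¹ * n⁻¹ * (1ℚ * 1ℚ) + h * k⁻¹ * (s⁻¹ * 1ℚ - r⁻¹ * 1ℚ)
        ≡⟨ cong₂ (λ e f → n⁻¹ * n⁻¹ * (e * f) + h * k⁻¹ * (s⁻¹ * f - r⁻¹ * e)) ss⁻¹ rr⁻¹ ⟨
      n⁻¹ * n⁻¹ * ((n + k) * s⁻¹ * ((n - k) * r⁻¹)) + h * k⁻¹ * (s⁻¹ * ((n - k) * r⁻¹) - r⁻¹ * ((n + k) * s⁻¹))
        ≡⟨ solve 7 (λ n k n⁻¹ k⁻¹ s⁻¹ r⁻¹ h →
             n⁻¹ :* n⁻¹ :* ((n :+ k) :* s⁻¹ :* ((n :- k) :* r⁻¹)) :+ h :* k⁻¹ :* (s⁻¹ :* ((n :- k) :* r⁻¹) :- r⁻¹ :* ((n :+ k) :* s⁻¹)) :=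
             s⁻¹ :* r⁻¹ :* ((n :* n⁻¹) :* (n :* n⁻¹) :- (κ 2 :* h) :* (k :* k⁻¹)) :- n⁻¹ :* n⁻¹ :* s⁻¹ :* (k :* k :* r⁻¹))
             refl n k n⁻¹ k⁻¹ s⁻¹ r⁻¹ h ⟩
      s⁻¹ * r⁻¹ * ((n * n⁻¹) * (n * n⁻¹) - (fromℕ 2 * h) * (k * k⁻¹)) - n⁻¹ * n⁻¹ * s⁻¹ * (k * k * r⁻¹)
        ≡⟨ cong₂ (λ e f → s⁻¹ * r⁻¹ * (e * e - f) - n⁻¹ * n⁻¹ * s⁻¹ * (k * k * r⁻¹)) nn⁻¹ (cong₂ _*_ 2h kk⁻¹) ⟩
      s⁻¹ * r⁻¹ * (1ℚ * 1ℚ - 1ℚ * 1ℚ) - n⁻¹ * n⁻¹ * s⁻¹ * (k * k * r⁻¹)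
        ≡⟨ solve 4 (λ n⁻¹ k s⁻¹ r⁻¹ → s⁻¹ :* r⁻¹ :* (κ 1 :* κ 1 :- κ 1 :* κ 1) :- n⁻¹ :* n⁻¹ :* s⁻¹ :* (k :* k :* r⁻¹) :=
             :- (n⁻¹ :* n⁻¹ :* s⁻¹ :* (k :* k :* r⁻¹))) refl n⁻¹ k s⁻¹ r⁻¹ ⟩
      - (n⁻¹ * n⁻¹ * s⁻¹ * (k * k * r⁻¹)) ∎
      where open ≡-Reasoning

  -- The right side is Apéry's (-1)^k k!² (n-k)! / ((n+1)² (n+1+k)!). By induction on k: for k = 0
  -- only the new summand 1/(n+1)³ remains, and each further k adds a difference of two corrections,
  -- which `reciprocals` evaluates. The closed form allows values at neighbouring n to be replaced
  -- by one common value.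
  ζ-approx-stepˡ : ∀ n k → k ℕ.≤ n → ζ-approx (suc n) k - ζ-approx n k ≡
    sign k * (inv (suc n) * inv (suc n) * inv (suc n ℕ.+ k) * inv (t n k))
  ζ-approx-stepˡ n zero _ = begin
    ζ₃ n + ζ-term 3 n + 0ℚ - (ζ₃ n + 0ℚ)
      ≡⟨ solve 2 (λ z u → z :+ u :+ κ 0 :- (z :+ κ 0) := u) refl (ζ₃ n) (ζ-term 3 n) ⟩
    ζ-term 3 n
      ≡⟨ ζ-term₃ n ⟩
    i * i * i
      ≡⟨ solve 1 (λ u → u := κ 1 :* (u :* κ 1)) refl (i * i * i) ⟩
    1ℚ * (i * i * i * 1ℚ)
      ≡⟨ cong (λ m → 1ℚ * (i * i * inv m * 1ℚ)) (sym (ℕ.+-identityʳ (suc n))) ⟩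
    1ℚ * (i * i * inv (suc n ℕ.+ 0) * 1ℚ) ∎
    where
    open ≡-Reasoning
    i = inv (suc n)
  ζ-approx-stepˡ n (suc j) j<n = begin
    ζ₃ N + (partialSum (correction N) j + correction N j) - (ζ₃ n + (partialSum (correction n) j + correction n j))
      ≡⟨ solve 6 (λ z u v z' u' v' → z :+ (u :+ v) :- (z' :+ (u' :+ v')) := z :+ u :- (z' :+ u') :+ (v :- v')) refl
           (ζ₃ N) (partialSum (correction N) j) (correction N j) (ζ₃ n) (partialSum (correction n) j) (correction n j) ⟩
    ζ-approx N j - ζ-approx n j + (correction N j - correction n j)
      ≡⟨ cong₂ (λ u v → u + v) (ζ-approx-stepˡ n j (ℕ.<⇒≤ j<n))
           (cong₂ (λ u v → sign j * (h * k⁻¹ * k⁻¹ * k⁻¹ * u) - sign j * (h * k⁻¹ * k⁻¹ * k⁻¹ * v)) invN inv-n) ⟩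
    sign j * (N⁻¹ * N⁻¹ * p⁻¹ * g⁻¹) +
      (sign j * (h * k⁻¹ * k⁻¹ * k⁻¹ * (k * k * g⁻¹ * p⁻¹ * s⁻¹)) - sign j * (h * k⁻¹ * k⁻¹ * k⁻¹ * (k * k * g⁻¹ * p⁻¹ * r⁻¹)))
      ≡⟨ solve 9 (λ σ N⁻¹ p⁻¹ g⁻¹ h k⁻¹ k s⁻¹ r⁻¹ →
           σ :* (N⁻¹ :* N⁻¹ :* p⁻¹ :* g⁻¹) :+
             (σ :* (h :* k⁻¹ :* k⁻¹ :* k⁻¹ :* (k :* k :* g⁻¹ :* p⁻¹ :* s⁻¹)) :- σ :* (h :* k⁻¹ :* k⁻¹ :* k⁻¹ :* (k :* k :* g⁻¹ :* p⁻¹ :* r⁻¹))) :=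
           σ :* (p⁻¹ :* g⁻¹) :* (N⁻¹ :* N⁻¹ :+ (k :* k⁻¹) :* (k :* k⁻¹) :* (h :* k⁻¹ :* (s⁻¹ :- r⁻¹)))) refl
           (sign j) N⁻¹ p⁻¹ g⁻¹ h k⁻¹ k s⁻¹ r⁻¹ ⟩
    sign j * (p⁻¹ * g⁻¹) * (N⁻¹ * N⁻¹ + (k * k⁻¹) * (k * k⁻¹) * (h * k⁻¹ * (s⁻¹ - r⁻¹)))
      ≡⟨ cong (λ e → sign j * (p⁻¹ * g⁻¹) * (N⁻¹ * N⁻¹ + e * e * (h * k⁻¹ * (s⁻¹ - r⁻¹)))) kk⁻¹ ⟩
    sign j * (p⁻¹ * g⁻¹) * (N⁻¹ * N⁻¹ + 1ℚ * 1ℚ * (h * k⁻¹ * (s⁻¹ - r⁻¹)))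
      ≡⟨ cong (λ e → sign j * (p⁻¹ * g⁻¹) * (N⁻¹ * N⁻¹ + e)) (*-identityˡ _) ⟩
    sign j * (p⁻¹ * g⁻¹) * (N⁻¹ * N⁻¹ + h * k⁻¹ * (s⁻¹ - r⁻¹))
      ≡⟨ cong (sign j * (p⁻¹ * g⁻¹) *_) (reciprocals x k N⁻¹ k⁻¹ s⁻¹ r⁻¹ h
           (n*inv[n]≡1 {N} ℕ.z<s) kk⁻¹ ss⁻¹ rr⁻¹ (n*inv[n]≡1 {2} ℕ.z<s)) ⟩
    sign j * (p⁻¹ * g⁻¹) * (- (N⁻¹ * N⁻¹ * s⁻¹ * (k * k * r⁻¹)))
      ≡⟨ solve 7 (λ σ N⁻¹ p⁻¹ g⁻¹ k s⁻¹ r⁻¹ → σ :* (p⁻¹ :* g⁻¹) :* (:- (N⁻¹ :* N⁻¹ :* s⁻¹ :* (k :* k :* r⁻¹))) :=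
           :- σ :* (N⁻¹ :* N⁻¹ :* s⁻¹ :* (k :* k :* g⁻¹ :* p⁻¹ :* r⁻¹))) refl (sign j) N⁻¹ p⁻¹ g⁻¹ k s⁻¹ r⁻¹ ⟩
    - sign j * (N⁻¹ * N⁻¹ * s⁻¹ * (k * k * g⁻¹ * p⁻¹ * r⁻¹))
      ≡⟨ cong (λ u → - sign j * (N⁻¹ * N⁻¹ * s⁻¹ * u)) inv-n ⟨
    - sign j * (N⁻¹ * N⁻¹ * s⁻¹ * inv (t n (suc j))) ∎
    where
    open ≡-Reasoning
    N = suc n
    d = n ℕ.∸ suc j
    x = fromℕ N
    y = fromℕ j
    k = fromℕ (suc j)
    k⁻¹ = inv (suc j)
    h = inv 2
    N⁻¹ = inv N
    g⁻¹ = inv (t n j)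
    p⁻¹ = inv (N ℕ.+ j)
    s⁻¹ = inv (N ℕ.+ suc j)
    r⁻¹ = inv (suc d)
    kk⁻¹ : k * k⁻¹ ≡ 1ℚ
    kk⁻¹ = n*inv[n]≡1 {suc j} ℕ.z<s
    gg⁻¹ : τ n j * g⁻¹ ≡ 1ℚ
    gg⁻¹ = n*inv[n]≡1 (k≤n⇒t>0 (ℕ.<⇒≤ j<n))
    ss⁻¹ : (x + k) * s⁻¹ ≡ 1ℚ
    ss⁻¹ = trans (cong (_* s⁻¹) (sym (fromℕ-homo-+ N (suc j)))) (n*inv[n]≡1 {N ℕ.+ suc j} ℕ.z<s)
    n≡ : fromℕ n ≡ k + fromℕ d
    n≡ = trans (cong fromℕ (sym (ℕ.m+[n∸m]≡n j<n))) (fromℕ-homo-+ (suc j) d)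
    x-k≡ : x - k ≡ fromℕ (suc d)
    x-k≡ = begin
      x - k                      ≡⟨ cong (_- k) (fromℕ-suc n) ⟩
      1ℚ + fromℕ n - k           ≡⟨ cong (λ u → 1ℚ + u - k) n≡ ⟩
      1ℚ + (k + fromℕ d) - k     ≡⟨ solve 2 (λ k d → κ 1 :+ (k :+ d) :- k := κ 1 :+ d) refl k (fromℕ d) ⟩
      1ℚ + fromℕ d               ≡⟨ fromℕ-suc d ⟨
      fromℕ (suc d)              ∎
    rr⁻¹ : (x - k) * r⁻¹ ≡ 1ℚ
    rr⁻¹ = trans (cong (_* r⁻¹) x-k≡) (n*inv[n]≡1 {suc d} ℕ.z<s)
    pp⁻¹ : (fromℕ n + k) * p⁻¹ ≡ 1ℚ
    pp⁻¹ = begin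
      (fromℕ n + k) * p⁻¹      ≡⟨ cong (_* p⁻¹) (fromℕ-homo-+ n (suc j)) ⟨
      fromℕ (n ℕ.+ suc j) * p⁻¹ ≡⟨ cong (λ m → fromℕ m * p⁻¹) (ℕ.+-suc n j) ⟩
      fromℕ (N ℕ.+ j) * p⁻¹    ≡⟨ n*inv[n]≡1 {N ℕ.+ j} ℕ.z<s ⟩
      1ℚ                       ∎
    -- Both neighbours of `t n j` have the form u · v · t n j / k² with the same v = n + k. Only u
    -- differs: it is n + 1 + k in `invN` and n + 1 - k in `inv-n`.
    inverse : ∀ {m u v w} → 0 ℕ.< m → fromℕ m ≡ u * v * τ n j * (k⁻¹ * k⁻¹) → u * w ≡ 1ℚ → v * p⁻¹ ≡ 1ℚ →
      inv m ≡ k * k * g⁻¹ * p⁻¹ * w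
    inverse {m} {u} {v} {w} 0<m m≡ uw vp = inverse-unique {fromℕ m} (n*inv[n]≡1 0<m) (begin
      fromℕ m * (k * k * g⁻¹ * p⁻¹ * w)
        ≡⟨ cong (_* (k * k * g⁻¹ * p⁻¹ * w)) m≡ ⟩
      u * v * τ n j * (k⁻¹ * k⁻¹) * (k * k * g⁻¹ * p⁻¹ * w)
        ≡⟨ solve 8 (λ u v g k⁻¹ k g⁻¹ p⁻¹ w → u :* v :* g :* (k⁻¹ :* k⁻¹) :* (k :* k :* g⁻¹ :* p⁻¹ :* w) :=
             (u :* w) :* (v :* p⁻¹) :* (g :* g⁻¹) :* ((k :* k⁻¹) :* (k :* k⁻¹))) refl u v (τ n j) k⁻¹ k g⁻¹ p⁻¹ w ⟩
      (u * w) * (v * p⁻¹) * (τ n j * g⁻¹) * ((k * k⁻¹) * (k * k⁻¹))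
        ≡⟨ cong₂ _*_ (cong₂ _*_ (cong₂ _*_ uw vp) gg⁻¹) (cong₂ _*_ kk⁻¹ kk⁻¹) ⟩
      1ℚ ∎)
    invN : inv (t N (suc j)) ≡ k * k * g⁻¹ * p⁻¹ * s⁻¹
    invN = inverse {u = fromℕ n + k + 1ℚ} {fromℕ n + k} {s⁻¹} (k≤n⇒t>0 (ℕ.m≤n⇒m≤1+n j<n)) (τ[1+n,1+j] n j)
      (trans (cong (_* s⁻¹) (trans (solve 2 (λ n k → n :+ k :+ κ 1 := κ 1 :+ n :+ k)
           refl (fromℕ n) k) (cong (_+ k) (sym (fromℕ-suc n))))) ss⁻¹)
      pp⁻¹
    inv-n : inv (t n (suc j)) ≡ k * k * g⁻¹ * p⁻¹ * r⁻¹
    inv-n = inverse {u = fromℕ n - y} {fromℕ n + k} {r⁻¹} (k≤n⇒t>0 j<n)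
      (trans (τ[n,1+j] n j) (cong (λ u → u * τ n j * (k⁻¹ * k⁻¹)) (*-comm (fromℕ n + k) (fromℕ n - y))))
      (trans (cong (_* r⁻¹) (begin
        fromℕ n - y             ≡⟨ solve 2 (λ n y → n :- y := κ 1 :+ n :- (κ 1 :+ y)) refl (fromℕ n) y ⟩
        1ℚ + fromℕ n - (1ℚ + y) ≡⟨ cong₂ _-_ (fromℕ-suc n) (fromℕ-suc j) ⟨
        x - k ∎)) rr⁻¹)
      pp⁻¹

-- Creative telescoping for the summands of both sequences.

module Certificate where

  open import Data.Nat.Base as ℕ using (ℕ; suc)
  import Data.Nat.Properties as ℕ
  open import Data.Rational.Base
  open import Data.Rational.Properties
  open import Data.Sum using ([_,_]′)
  open import Relation.Binary.PropositionalEquality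
  open import Defs using (partialSum)
  open Binomial
  open Rationals
  open Approximation
  open ℚ-Solver using (Polynomial; solve; _:+_; _:*_; _:-_; :-_; _:=_)

  cube : ℚ → ℚ
  cube x = x * x * x

  apéryPoly : ℚ → ℚ
  apéryPoly x = fromℕ 34 * cube x + fromℕ 51 * (x * x) + fromℕ 27 * x + fromℕ 5

  -- Zeilberger's certificate: with x = n, the terms of the Apéry recurrence for Σₖ weight n k
  -- are the differences of cert n k · weight n k.
  cert : ℚ → ℚ → ℚ
  cert x k = fromℕ 4 * (x + (x + 1ℚ)) * (k * (k + k + 1ℚ) - (x + (x + 1ℚ)) * (x + (x + 1ℚ)))

  -- This is 5(2n + 1)/(n(n + 1)), the coefficient of the extra term in the certificate of b. The
  -- reciprocals are arguments so that the ring solver can treat them as variables.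
  ε-coeff : ℚ → ℚ → ℚ → ℚ
  ε-coeff x x⁻¹ m⁻¹ = fromℕ 5 * (x + (x + 1ℚ)) * (x⁻¹ * m⁻¹)

  private
    cubeᴾ : ∀ {m} → Polynomial m → Polynomial m
    cubeᴾ x = x :* x :* x

    apéryPolyᴾ : ∀ {m} → Polynomial m → Polynomial m
    apéryPolyᴾ x = κ 34 :* cubeᴾ x :+ κ 51 :* (x :* x) :+ κ 27 :* x :+ κ 5

    certᴾ : ∀ {m} → Polynomial m → Polynomial m → Polynomial m
    certᴾ x k = κ 4 :* (x :+ (x :+ κ 1)) :* (k :* (k :+ k :+ κ 1) :- (x :+ (x :+ κ 1)) :* (x :+ (x :+ κ 1)))

    square : ℚ → ℚ
    square x = x * x

    -- Writing the last g as g (k k⁻¹)² gives all terms the common factor g² k⁻⁴. What remains is a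
    -- polynomial identity in x and y.
    λ-identity : ∀ {k} x y k⁻¹ g → let i = k⁻¹ * k⁻¹ in k ≡ 1ℚ + y → k * k⁻¹ ≡ 1ℚ →
      cube (x + 1ℚ) * square ((x + k + 1ℚ) * (x + k) * g * i)
        - apéryPoly x * square ((x + k) * (x - y) * g * i)
        + cube x * square ((x - k) * (x - y) * g * i)
      ≡ cert x k * square ((x + k) * (x - y) * g * i) - cert x y * square g
    λ-identity x y k⁻¹ g refl kk⁻¹ = begin
      cube (x + 1ℚ) * square ((x + k + 1ℚ) * (x + k) * g * i)
        - apéryPoly x * square ((x + k) * (x - y) * g * i)
        + cube x * square ((x - k) * (x - y) * g * i)
        ≡⟨ solve 4 (λ x y k⁻¹ g → let k = κ 1 :+ y ; i = k⁻¹ :* k⁻¹ ; sq = λ (u : Polynomial 4) → u :* u in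
             cubeᴾ (x :+ κ 1) :* sq ((x :+ k :+ κ 1) :* (x :+ k) :* g :* i)
               :- apéryPolyᴾ x :* sq ((x :+ k) :* (x :- y) :* g :* i)
               :+ cubeᴾ x :* sq ((x :- k) :* (x :- y) :* g :* i)
             := certᴾ x k :* sq ((x :+ k) :* (x :- y) :* g :* i)
               :- certᴾ x y :* sq (g :* ((k :* k⁻¹) :* (k :* k⁻¹)))) refl x y k⁻¹ g ⟩
      cert x k * square ((x + k) * (x - y) * g * i) - cert x y * square (g * ((k * k⁻¹) * (k * k⁻¹)))
        ≡⟨ cong (λ e → cert x k * square ((x + k) * (x - y) * g * i) - cert x y * square (g * (e * e))) kk⁻¹ ⟩
      cert x k * square ((x + k) * (x - y) * g * i) - cert x y * square (g * (1ℚ * 1ℚ))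
        ≡⟨ cong (λ u → cert x k * square ((x + k) * (x - y) * g * i) - cert x y * square u) (*-identityʳ g) ⟩
      cert x k * square ((x + k) * (x - y) * g * i) - cert x y * square g ∎
      where
      open ≡-Reasoning
      k = 1ℚ + y
      i = k⁻¹ * k⁻¹

    -- For k = j + 1 and m = n + 1, n, n - 1 (δ⁺, δ⁰, δ⁻ respectively),
    -- weighted m k - weight m k · ζ-approx n j = sign j · τ m k · δ; a common ζ-approx n j
    -- is what lets the certificate of a serve for b.
    δ⁺ δ⁰ δ⁻ : ℚ → ℚ → ℚ → ℚ → ℚ → ℚ
    δ⁺ h x k k⁻¹ m⁻¹ = h * cube k⁻¹ + (x + k + 1ℚ) * (k⁻¹ * k⁻¹) * (m⁻¹ * m⁻¹)
    δ⁰ h x k k⁻¹ _   = h * cube k⁻¹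
    δ⁻ h x k k⁻¹ x⁻¹ = h * cube k⁻¹ - (x - k) * (k⁻¹ * k⁻¹) * (x⁻¹ * x⁻¹)

    -- This handles what is left of b after the common approximation has been split off. The two
    -- ε-terms appear with a plus sign; multiplication by the alternating sign (-1)^j turns their
    -- sum into a telescoping difference.
    δ-identity : ∀ {k} h x y k⁻¹ x⁻¹ m⁻¹ g → let i = k⁻¹ * k⁻¹ in k ≡ 1ℚ + y →
      fromℕ 2 * h ≡ 1ℚ → k * k⁻¹ ≡ 1ℚ → x * x⁻¹ ≡ 1ℚ → (x + 1ℚ) * m⁻¹ ≡ 1ℚ →
      cube (x + 1ℚ) * ((x + k + 1ℚ) * (x + k) * g * i * δ⁺ h x k k⁻¹ m⁻¹)
        - apéryPoly x * ((x + k) * (x - y) * g * i * δ⁰ h x k k⁻¹ x⁻¹)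
        + cube x * ((x - k) * (x - y) * g * i * δ⁻ h x k k⁻¹ x⁻¹)
      ≡ cert x k * ((x + k) * (x - y) * g * i * δ⁰ h x k k⁻¹ x⁻¹)
        + ε-coeff x x⁻¹ m⁻¹ * (k * ((x + k) * (x - y) * g * i) + y * g)
    δ-identity h x y k⁻¹ x⁻¹ m⁻¹ g refl 2h kk⁻¹ xx⁻¹ mm⁻¹ = begin
      cube (x + 1ℚ) * ((x + k + 1ℚ) * (x + k) * g * i * δ⁺ h x k k⁻¹ m⁻¹)
        - apéryPoly x * ((x + k) * (x - y) * g * i * δ⁰ h x k k⁻¹ x⁻¹)
        + cube x * ((x - k) * (x - y) * g * i * δ⁻ h x k k⁻¹ x⁻¹)
        ≡⟨ solve 7 (λ h x y k⁻¹ x⁻¹ m⁻¹ g → let k = κ 1 :+ y ; i = k⁻¹ :* k⁻¹ in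
             cubeᴾ (x :+ κ 1) :* ((x :+ k :+ κ 1) :* (x :+ k) :* g :* i :* (h :* cubeᴾ k⁻¹ :+ (x :+ k :+ κ 1) :* (k⁻¹ :* k⁻¹) :* (m⁻¹ :* m⁻¹)))
               :- apéryPolyᴾ x :* ((x :+ k) :* (x :- y) :* g :* i :* (h :* cubeᴾ k⁻¹))
               :+ cubeᴾ x :* ((x :- k) :* (x :- y) :* g :* i :* (h :* cubeᴾ k⁻¹ :- (x :- k) :* (k⁻¹ :* k⁻¹) :* (x⁻¹ :* x⁻¹)))
             := g :* i :* (h :* cubeᴾ k⁻¹ :* (cubeᴾ (x :+ κ 1) :* ((x :+ k :+ κ 1) :* (x :+ k)) :- apéryPolyᴾ x :* ((x :+ k) :* (x :- y))
                  :+ cubeᴾ x :* ((x :- k) :* (x :- y)))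
                :+ i :* (((x :+ κ 1) :* m⁻¹) :* ((x :+ κ 1) :* m⁻¹) :* ((x :+ κ 1) :* (x :+ k) :* ((x :+ k :+ κ 1) :* (x :+ k :+ κ 1)))
                  :- (x :* x⁻¹) :* (x :* x⁻¹) :* (x :* (x :- y) :* ((x :- k) :* (x :- k)))))) refl h x y k⁻¹ x⁻¹ m⁻¹ g ⟩
      g * i * (h * cube k⁻¹ * X + i * (((x + 1ℚ) * m⁻¹) * ((x + 1ℚ) * m⁻¹) * Y - (x * x⁻¹) * (x * x⁻¹) * Z))
        ≡⟨ cong₂ (λ e f → g * i * (h * cube k⁻¹ * X + i * (e * e * Y - f * f * Z))) mm⁻¹ xx⁻¹ ⟩
      g * i * (h * cube k⁻¹ * X + i * (1ℚ * 1ℚ * Y - 1ℚ * 1ℚ * Z))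
        ≡⟨ solve 6 (λ gi h k X Y Z → gi :* (h :* X :+ k :* (κ 1 :* κ 1 :* Y :- κ 1 :* κ 1 :* Z)) :=
             gi :* (h :* X :+ κ 1 :* κ 1 :* k :* (Y :- Z))) refl (g * i) (h * cube k⁻¹) i X Y Z ⟩
      g * i * (h * cube k⁻¹ * X + 1ℚ * 1ℚ * i * (Y - Z))
        -- The factor 2h · k k⁻¹ = 1 brings Y - Z over the same h k⁻³ as X. The identity left to
        -- check is X + 2k(Y - Z) = cert x k · (x + k)(x - y) + 10(2x + 1) k⁴.
        ≡⟨ cong₂ (λ e f → g * i * (h * cube k⁻¹ * X + e * f * i * (Y - Z))) 2h kk⁻¹ ⟨
      g * i * (h * cube k⁻¹ * X + fromℕ 2 * h * (k * k⁻¹) * i * (Y - Z))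
        ≡⟨ solve 5 (λ h x y k⁻¹ g → let k = κ 1 :+ y ; i = k⁻¹ :* k⁻¹ in
             g :* i :* (h :* cubeᴾ k⁻¹ :* (cubeᴾ (x :+ κ 1) :* ((x :+ k :+ κ 1) :* (x :+ k)) :- apéryPolyᴾ x :* ((x :+ k) :* (x :- y))
                  :+ cubeᴾ x :* ((x :- k) :* (x :- y))) :+ κ 2 :* h :* (k :* k⁻¹) :* i :*
                  (((x :+ κ 1) :* (x :+ k) :* ((x :+ k :+ κ 1) :* (x :+ k :+ κ 1))) :- (x :* (x :- y) :* ((x :- k) :* (x :- k))))) :=
             certᴾ x k :* ((x :+ k) :* (x :- y) :* g :* i :* (h :* cubeᴾ k⁻¹))
               :+ κ 5 :* (x :+ (x :+ κ 1)) :* (k :* g :* i) :* (κ 2 :* h :* ((k :* k⁻¹) :* (k :* k⁻¹) :* (k :* k⁻¹))))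
                    refl h x y k⁻¹ g ⟩
      W + fromℕ 5 * (x + (x + 1ℚ)) * (k * g * i) * (fromℕ 2 * h * ((k * k⁻¹) * (k * k⁻¹) * (k * k⁻¹)))
        ≡⟨ cong₂ (λ e f → W + fromℕ 5 * (x + (x + 1ℚ)) * (k * g * i) * (e * (f * f * f))) 2h kk⁻¹ ⟩
      W + fromℕ 5 * (x + (x + 1ℚ)) * (k * g * i) * (1ℚ * (1ℚ * 1ℚ * 1ℚ))
        -- Inserting 1 in this form produces the denominator x(x + 1) of `ε-coeff`, while its
        -- numerator splits as x(x + 1) = (x + k)(x - y) + y k.
        ≡⟨ cong (λ e → W + fromℕ 5 * (x + (x + 1ℚ)) * (k * g * i) * e) (sym (cong₂ _*_ xx⁻¹ mm⁻¹)) ⟩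
      W + fromℕ 5 * (x + (x + 1ℚ)) * (k * g * i) * ((x * x⁻¹) * ((x + 1ℚ) * m⁻¹))
        ≡⟨ solve 7 (λ w x y k⁻¹ x⁻¹ m⁻¹ g → let k = κ 1 :+ y ; i = k⁻¹ :* k⁻¹ in
             w :+ κ 5 :* (x :+ (x :+ κ 1)) :* (k :* g :* i) :* ((x :* x⁻¹) :* ((x :+ κ 1) :* m⁻¹)) :=
             w :+ κ 5 :* (x :+ (x :+ κ 1)) :* (x⁻¹ :* m⁻¹) :* (k :* ((x :+ k) :* (x :- y) :* g :* i) :+ y :* (k :* k :* g :* i)))
             refl W x y k⁻¹ x⁻¹ m⁻¹ g ⟩
      W + ε-coeff x x⁻¹ m⁻¹ * (k * ((x + k) * (x - y) * g * i) + y * (k * k * g * i))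
        ≡⟨ cong (λ u → W + ε-coeff x x⁻¹ m⁻¹ * (k * ((x + k) * (x - y) * g * i) + y * u)) k²gi≡g ⟩
      W + ε-coeff x x⁻¹ m⁻¹ * (k * ((x + k) * (x - y) * g * i) + y * g) ∎
      where
      open ≡-Reasoning
      k = 1ℚ + y
      i = k⁻¹ * k⁻¹
      X = cube (x + 1ℚ) * ((x + k + 1ℚ) * (x + k)) - apéryPoly x * ((x + k) * (x - y)) + cube x * ((x - k) * (x - y))
      Y = (x + 1ℚ) * (x + k) * ((x + k + 1ℚ) * (x + k + 1ℚ))
      Z = x * (x - y) * ((x - k) * (x - k))
      W = cert x k * ((x + k) * (x - y) * g * i * δ⁰ h x k k⁻¹ x⁻¹)
      k²gi≡g : k * k * g * i ≡ g
      k²gi≡g = begin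
        k * k * g * i                  ≡⟨ solve 3 (λ k g k⁻¹ → k :* k :* g :* (k⁻¹ :* k⁻¹) :=
             g :* ((k :* k⁻¹) :* (k :* k⁻¹))) refl k g k⁻¹ ⟩
        g * ((k * k⁻¹) * (k * k⁻¹))    ≡⟨ cong (λ e → g * (e * e)) kk⁻¹ ⟩
        g * (1ℚ * 1ℚ)                  ≡⟨ *-identityʳ g ⟩
        g                              ∎

  weight : ℕ → ℕ → ℚ
  weight n k = τ n k * τ n k

  weighted : ℕ → ℕ → ℚ
  weighted n k = weight n k * ζ-approx n k

  private
    correction-weight : ∀ n j → weight n (suc j) * correction n j ≡
      sign j * (τ n (suc j) * (inv 2 * cube (inv (suc j))))
    correction-weight n j = begin
      T * T * (sign j * (inv 2 * i * i * i * inv (t n (suc j))))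
        ≡⟨ solve 5 (λ T σ h i u → T :* T :* (σ :* (h :* i :* i :* i :* u)) :=
             σ :* ((T :* T :* u) :* (h :* (i :* i :* i)))) refl
             T (sign j) (inv 2) i (inv (t n (suc j))) ⟩
      sign j * ((T * T * inv (t n (suc j))) * (inv 2 * (i * i * i)))
        ≡⟨ cong (λ u → sign j * (u * (inv 2 * (i * i * i)))) (n*n*inv[n]≡n (t n (suc j))) ⟩
      sign j * (T * (inv 2 * cube i)) ∎
      where
      open ≡-Reasoning
      T = τ n (suc j)
      i = inv (suc j)

    -- One of the two factors τ in a weight absorbs the denominators n + 1 + j and t n j of
    -- `ζ-approx-stepˡ`. Only powers of k⁻¹ and a linear factor survive, as the definitions of δ⁺
    -- and δ⁻ require.
    cancel-step : ∀ n j → j ℕ.≤ n → ∀ {T u} →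
      T ≡ u * (fromℕ n + fromℕ (suc j)) * τ n j * (inv (suc j) * inv (suc j)) →
      T * (inv (suc n ℕ.+ j) * inv (t n j)) ≡ u * (inv (suc j) * inv (suc j))
    cancel-step n j j≤n {T} {u} T≡ = begin
      T * (p⁻¹ * g⁻¹)
        ≡⟨ cong (_* (p⁻¹ * g⁻¹)) T≡ ⟩
      u * p * τ n j * i * (p⁻¹ * g⁻¹)
        ≡⟨ solve 6 (λ u p g i p⁻¹ g⁻¹ → u :* p :* g :* i :* (p⁻¹ :* g⁻¹) := u :* i :* ((p :* p⁻¹) :* (g :* g⁻¹)))
             refl u p (τ n j) i p⁻¹ g⁻¹ ⟩
      u * i * ((p * p⁻¹) * (τ n j * g⁻¹))
        ≡⟨ cong (u * i *_) (cong₂ _*_ pp⁻¹ (n*inv[n]≡1 (k≤n⇒t>0 j≤n))) ⟩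
      u * i * (1ℚ * 1ℚ)
        ≡⟨ *-identityʳ (u * i) ⟩
      u * i ∎
      where
      open ≡-Reasoning
      p = fromℕ n + fromℕ (suc j)
      i = inv (suc j) * inv (suc j)
      p⁻¹ = inv (suc n ℕ.+ j)
      g⁻¹ = inv (t n j)
      pp⁻¹ : p * p⁻¹ ≡ 1ℚ
      pp⁻¹ = trans (cong (_* p⁻¹) (trans (sym (fromℕ-homo-+ n (suc j))) (cong fromℕ (ℕ.+-suc n j)))) (n*inv[n]≡1 {suc n ℕ.+ j} ℕ.z<s)

    ζ-approx-suc : ∀ n j → ζ-approx n (suc j) ≡ ζ-approx n j + correction n j
    ζ-approx-suc n j = sym (+-assoc (ζ₃ n) (partialSum (correction n) j) (correction n j))

    weighted⁰ : ∀ n j → weighted n (suc j) ≡ weight n (suc j) * ζ-approx n j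
      + sign j * (τ n (suc j) * δ⁰ (inv 2) (fromℕ n) (fromℕ (suc j)) (inv (suc j)) (inv n))
    weighted⁰ n j = begin
      weighted n (suc j)
        ≡⟨ cong (weight n (suc j) *_) (ζ-approx-suc n j) ⟩
      weight n (suc j) * (ζ-approx n j + correction n j)
        ≡⟨ *-distribˡ-+ (weight n (suc j)) (ζ-approx n j) (correction n j) ⟩
      weight n (suc j) * ζ-approx n j + weight n (suc j) * correction n j
        ≡⟨ cong (weight n (suc j) * ζ-approx n j +_) (correction-weight n j) ⟩
      weight n (suc j) * ζ-approx n j + sign j * (τ n (suc j) * (inv 2 * cube (inv (suc j)))) ∎
      where open ≡-Reasoning

    weighted⁺ : ∀ n j → j ℕ.≤ n → weighted (suc n) (suc j) ≡ weight (suc n) (suc j) * ζ-approx n j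
      + sign j * (τ (suc n) (suc j) * δ⁺ (inv 2) (fromℕ n) (fromℕ (suc j)) (inv (suc j)) (inv (suc n)))
    weighted⁺ n j j≤n = begin
      T * T * ζ-approx (suc n) (suc j)
        ≡⟨ cong (T * T *_) (ζ-approx-suc (suc n) j) ⟩
      T * T * (ζ-approx (suc n) j + correction (suc n) j)
        ≡⟨ solve 4 (λ w c c⁺ d → w :* (c⁺ :+ d) := w :* c :+ (w :* (c⁺ :- c) :+ w :* d)) refl
             (T * T) (ζ-approx n j) (ζ-approx (suc n) j) (correction (suc n) j) ⟩
      T * T * ζ-approx n j + (T * T * (ζ-approx (suc n) j - ζ-approx n j) + T * T * correction (suc n) j)
        ≡⟨ cong (T * T * ζ-approx n j +_) (cong₂ _+_ (cong (T * T *_) (ζ-approx-stepˡ n j j≤n)) (correction-weight (suc n) j)) ⟩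
      T * T * ζ-approx n j + (T * T * (sign j * (m⁻¹ * m⁻¹ * p⁻¹ * g⁻¹)) + sign j * (T * (inv 2 * cube k⁻¹)))
        ≡⟨ solve 8 (λ T c σ m⁻¹ p⁻¹ g⁻¹ h k → T :* T :* c :+ (T :* T :* (σ :* (m⁻¹ :* m⁻¹ :* p⁻¹ :* g⁻¹)) :+ σ :* (T :* (h :* k))) :=
             T :* T :* c :+ σ :* (T :* (h :* k :+ T :* (p⁻¹ :* g⁻¹) :* (m⁻¹ :* m⁻¹)))) refl
             T (ζ-approx n j) (sign j) m⁻¹ p⁻¹ g⁻¹ (inv 2) (cube k⁻¹) ⟩
      T * T * ζ-approx n j + sign j * (T * (inv 2 * cube k⁻¹ + T * (p⁻¹ * g⁻¹) * (m⁻¹ * m⁻¹)))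
        ≡⟨ cong (λ u → T * T * ζ-approx n j + sign j * (T * (inv 2 * cube k⁻¹ + u * (m⁻¹ * m⁻¹))))
             (cancel-step n j j≤n {T} {fromℕ n + fromℕ (suc j) + 1ℚ} (τ[1+n,1+j] n j)) ⟩
      T * T * ζ-approx n j + sign j * (T * δ⁺ (inv 2) (fromℕ n) (fromℕ (suc j)) k⁻¹ m⁻¹) ∎
      where
      open ≡-Reasoning
      T = τ (suc n) (suc j)
      m⁻¹ = inv (suc n)
      k⁻¹ = inv (suc j)
      p⁻¹ = inv (suc n ℕ.+ j)
      g⁻¹ = inv (t n j)

    -- Beyond j = n the closed form of `ζ-approx-stepˡ` gives nothing, but here t n (j + 1) = 0
    -- makes both sides vanish.
    weighted⁻-≥ : ∀ n j → n ℕ.≤ j → weighted n (suc j) ≡ weight n (suc j) * ζ-approx (suc n) j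
      + sign j * (τ n (suc j) * δ⁻ (inv 2) (fromℕ (suc n)) (fromℕ (suc j)) (inv (suc j)) (inv (suc n)))
    weighted⁻-≥ n j n≤j = begin
      T * T * ζ-approx n (suc j)             ≡⟨ cong (λ u → u * u * ζ-approx n (suc j)) T≡0 ⟩
      0ℚ * 0ℚ * ζ-approx n (suc j)
        ≡⟨ solve 4 (λ a b σ d → κ 0 :* κ 0 :* a := κ 0 :* κ 0 :* b :+ σ :* (κ 0 :* d))
             refl (ζ-approx n (suc j)) (ζ-approx (suc n) j) (sign j) D ⟩
      0ℚ * 0ℚ * ζ-approx (suc n) j + sign j * (0ℚ * D)
        ≡⟨ cong (λ u → u * u * ζ-approx (suc n) j + sign j * (u * D)) T≡0 ⟨
      T * T * ζ-approx (suc n) j + sign j * (T * D) ∎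
      where
      open ≡-Reasoning
      T = τ n (suc j)
      D = δ⁻ (inv 2) (fromℕ (suc n)) (fromℕ (suc j)) (inv (suc j)) (inv (suc n))
      T≡0 : T ≡ 0ℚ
      T≡0 = cong fromℕ (k>n⇒t≡0 (ℕ.s≤s n≤j))

    weighted⁻-< : ∀ n j → j ℕ.< n → weighted n (suc j) ≡ weight n (suc j) * ζ-approx (suc n) j
      + sign j * (τ n (suc j) * δ⁻ (inv 2) (fromℕ (suc n)) (fromℕ (suc j)) (inv (suc j)) (inv (suc n)))
    weighted⁻-< n j j<n = begin
      T * T * ζ-approx n (suc j)
        ≡⟨ cong (T * T *_) (ζ-approx-suc n j) ⟩
      T * T * (ζ-approx n j + correction n j)
        ≡⟨ solve 4 (λ w c c⁻ d → w :* (c⁻ :+ d) := w :* c :+ (w :* d :- w :* (c :- c⁻))) refl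
             (T * T) (ζ-approx (suc n) j) (ζ-approx n j) (correction n j) ⟩
      T * T * ζ-approx (suc n) j + (T * T * correction n j - T * T * (ζ-approx (suc n) j - ζ-approx n j))
        ≡⟨ cong (T * T * ζ-approx (suc n) j +_) (cong₂ _-_ (correction-weight n j) (cong (T * T *_) (ζ-approx-stepˡ n j (ℕ.<⇒≤ j<n)))) ⟩
      T * T * ζ-approx (suc n) j + (sign j * (T * (inv 2 * cube k⁻¹)) - T * T * (sign j * (m⁻¹ * m⁻¹ * p⁻¹ * g⁻¹)))
        ≡⟨ solve 8 (λ T c σ m⁻¹ p⁻¹ g⁻¹ h k → T :* T :* c :+ (σ :* (T :* (h :* k)) :- T :* T :* (σ :* (m⁻¹ :* m⁻¹ :* p⁻¹ :* g⁻¹))) :=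
             T :* T :* c :+ σ :* (T :* (h :* k :- T :* (p⁻¹ :* g⁻¹) :* (m⁻¹ :* m⁻¹)))) refl
             T (ζ-approx (suc n) j) (sign j) m⁻¹ p⁻¹ g⁻¹ (inv 2) (cube k⁻¹) ⟩
      T * T * ζ-approx (suc n) j + sign j * (T * (inv 2 * cube k⁻¹ - T * (p⁻¹ * g⁻¹) * (m⁻¹ * m⁻¹)))
        ≡⟨ cong (λ u → T * T * ζ-approx (suc n) j + sign j * (T * (inv 2 * cube k⁻¹ - u * (m⁻¹ * m⁻¹))))
             (cancel-step n j (ℕ.<⇒≤ j<n) {T} {x - k} T≡) ⟩
      T * T * ζ-approx (suc n) j + sign j * (T * δ⁻ (inv 2) x k k⁻¹ m⁻¹) ∎
      where
      open ≡-Reasoning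
      x = fromℕ (suc n)
      k = fromℕ (suc j)
      T = τ n (suc j)
      m⁻¹ = inv (suc n)
      k⁻¹ = inv (suc j)
      p⁻¹ = inv (suc n ℕ.+ j)
      g⁻¹ = inv (t n j)
      T≡ : T ≡ (x - k) * (fromℕ n + k) * τ n j * (k⁻¹ * k⁻¹)
      T≡ = begin
        T
          ≡⟨ τ[n,1+j] n j ⟩
        (fromℕ n + k) * (fromℕ n - fromℕ j) * τ n j * (k⁻¹ * k⁻¹)
          ≡⟨ solve 5 (λ n k y g i → (n :+ k) :* (n :- y) :* g :* i :=
               (κ 1 :+ n :- (κ 1 :+ y)) :* (n :+ k) :* g :* i) refl
               (fromℕ n) k (fromℕ j) (τ n j) (k⁻¹ * k⁻¹) ⟩
        (1ℚ + fromℕ n - (1ℚ + fromℕ j)) * (fromℕ n + k) * τ n j * (k⁻¹ * k⁻¹)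
          ≡⟨ cong₂ (λ u v → (u - v) * (fromℕ n + k) * τ n j * (k⁻¹ * k⁻¹)) (fromℕ-suc n) (fromℕ-suc j) ⟨
        (x - k) * (fromℕ n + k) * τ n j * (k⁻¹ * k⁻¹) ∎

    weighted⁻ : ∀ n j → weighted n (suc j) ≡ weight n (suc j) * ζ-approx (suc n) j
      + sign j * (τ n (suc j) * δ⁻ (inv 2) (fromℕ (suc n)) (fromℕ (suc j)) (inv (suc j)) (inv (suc n)))
    weighted⁻ n j = [ weighted⁻-< n j , weighted⁻-≥ n j ]′ (ℕ.<-≤-connex j n)

  apéry-operator : ℚ → ℚ → ℚ → ℚ → ℚ
  apéry-operator x u v w = cube (x + 1ℚ) * u - apéryPoly x * v + cube x * w

  certᵃ : ℕ → ℕ → ℚ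
  certᵃ n k = cert (fromℕ n) (fromℕ k) * weight n k

  -- The approximation in `weighted` itself depends on n and k, so the certificate of a alone does
  -- not telescope. The extra term 5(2n+1)(-1)^(k-1) k t n k / (n(n+1)) compensates for this.
  certᵇ : ℕ → ℕ → ℚ
  certᵇ n k = cert (fromℕ n) (fromℕ k) * weighted n k
    - ε-coeff (fromℕ n) (inv n) (inv (suc n)) * (sign k * (fromℕ k * τ n k))

  certᵃ-telescopes : ∀ n j → let n′ = suc n in
    apéry-operator (fromℕ n′) (weight (suc n′) (suc j)) (weight n′ (suc j)) (weight n (suc j)) ≡ certᵃ n′ (suc j) - certᵃ n′ j
  certᵃ-telescopes n j = begin
    apéry-operator x (square (τ (suc n′) (suc j))) (square (τ n′ (suc j))) (square (τ n (suc j)))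
      ≡⟨ cong₂ (λ u w → apéry-operator x (square u) (square (τ n′ (suc j))) (square w)) (τ[1+n,1+j] n′ j) (τ[n-1,1+j] n j) ⟩
    apéry-operator x (square ((x + k + 1ℚ) * (x + k) * g * i)) (square (τ n′ (suc j))) (square ((x - k) * (x - y) * g * i))
      ≡⟨ cong (λ u → apéry-operator x (square ((x + k + 1ℚ) * (x + k) * g * i)) (square u) (square ((x - k) * (x - y) * g * i))) (τ[n,1+j] n′ j) ⟩
    apéry-operator x (square ((x + k + 1ℚ) * (x + k) * g * i)) (square ((x + k) * (x - y) * g * i)) (square ((x - k) * (x - y) * g * i))
      ≡⟨ λ-identity x y (inv (suc j)) g (fromℕ-suc j) (n*inv[n]≡1 {suc j} ℕ.z<s) ⟩
    cert x k * square ((x + k) * (x - y) * g * i) - cert x y * square g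
      ≡⟨ cong (λ u → cert x k * square u - cert x y * square g) (τ[n,1+j] n′ j) ⟨
    certᵃ n′ (suc j) - certᵃ n′ j ∎
    where
    open ≡-Reasoning
    n′ = suc n
    x = fromℕ n′
    y = fromℕ j
    k = fromℕ (suc j)
    g = τ n′ j
    i = inv (suc j) * inv (suc j)

  -- Writing all three summands with the common value c₀ = `ζ-approx n′ j` splits the operator into
  -- c₀ times the telescoping of a, plus sign j times the δ-terms. The new value of the
  -- approximation is then reassembled from c₀ and δ⁰.
  certᵇ-telescopes : ∀ n j → let n′ = suc n in j ℕ.≤ n′ →
    apéry-operator (fromℕ n′) (weighted (suc n′) (suc j)) (weighted n′ (suc j)) (weighted n (suc j)) ≡ certᵇ n′ (suc j) - certᵇ n′ j
  certᵇ-telescopes n j j≤n′ = begin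
    apéry-operator x (weighted (suc n′) (suc j)) (weighted n′ (suc j)) (weighted n (suc j))
      ≡⟨ cong₂ (λ u w → apéry-operator x u (weighted n′ (suc j)) w) (weighted⁺ n′ j j≤n′) (weighted⁻ n j) ⟩
    apéry-operator x (w⁺ * c₀ + σ * (τ (suc n′) (suc j) * d⁺)) (weighted n′ (suc j)) (w⁻ * c₀ + σ * (τ n (suc j) * d⁻))
      ≡⟨ cong (λ u → apéry-operator x (w⁺ * c₀ + σ * (τ (suc n′) (suc j) * d⁺)) u (w⁻ * c₀ + σ * (τ n (suc j) * d⁻))) (weighted⁰ n′ j) ⟩
    apéry-operator x (w⁺ * c₀ + σ * (τ (suc n′) (suc j) * d⁺)) (w⁰ * c₀ + σ * (τ n′ (suc j) * d⁰)) (w⁻ * c₀ + σ * (τ n (suc j) * d⁻))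
      ≡⟨ solve 11 (λ p q r w⁺ w⁰ w⁻ c₀ σ u v w →
           p :* (w⁺ :* c₀ :+ σ :* u) :- q :* (w⁰ :* c₀ :+ σ :* v) :+ r :* (w⁻ :* c₀ :+ σ :* w) :=
           (p :* w⁺ :- q :* w⁰ :+ r :* w⁻) :* c₀ :+ σ :* (p :* u :- q :* v :+ r :* w)) refl
           (cube (x + 1ℚ)) (apéryPoly x) (cube x) w⁺ w⁰ w⁻ c₀ σ (τ (suc n′) (suc j) * d⁺) (τ n′ (suc j) * d⁰) (τ n (suc j) * d⁻) ⟩
    apéry-operator x w⁺ w⁰ w⁻ * c₀ + σ * apéry-operator x (τ (suc n′) (suc j) * d⁺) (τ n′ (suc j) * d⁰) (τ n (suc j) * d⁻)
      ≡⟨ cong₂ (λ u v → u * c₀ + σ * v) (certᵃ-telescopes n j) δ-part ⟩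
    (certᵃ n′ (suc j) - certᵃ n′ j) * c₀ + σ * (cert x k * (τ n′ (suc j) * d⁰) + e * (k * τ n′ (suc j) + y * g))
      ≡⟨ solve 11 (λ B w⁰ B′ w c₀ σ v e k T yg →
           (B :* w⁰ :- B′ :* w) :* c₀ :+ σ :* (B :* v :+ e :* (k :* T :+ yg)) :=
           B :* (w⁰ :* c₀ :+ σ :* v) :- e :* (:- σ :* (k :* T)) :- (B′ :* (w :* c₀) :- e :* (σ :* yg))) refl
           (cert x k) w⁰ (cert x y) (weight n′ j) c₀ σ (τ n′ (suc j) * d⁰) e k (τ n′ (suc j)) (y * g) ⟩
    cert x k * (w⁰ * c₀ + σ * (τ n′ (suc j) * d⁰)) - e * (- σ * (k * τ n′ (suc j))) - certᵇ n′ j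
      ≡⟨ cong (λ u → cert x k * u - e * (- σ * (k * τ n′ (suc j))) - certᵇ n′ j) (weighted⁰ n′ j) ⟨
    certᵇ n′ (suc j) - certᵇ n′ j ∎
    where
    open ≡-Reasoning
    n′ = suc n
    x = fromℕ n′
    y = fromℕ j
    k = fromℕ (suc j)
    k⁻¹ = inv (suc j)
    i = k⁻¹ * k⁻¹
    g = τ n′ j
    σ = sign j
    c₀ = ζ-approx n′ j
    w⁺ = weight (suc n′) (suc j)
    w⁰ = weight n′ (suc j)
    w⁻ = weight n (suc j)
    d⁺ = δ⁺ (inv 2) x k k⁻¹ (inv (suc n′))
    d⁰ = δ⁰ (inv 2) x k k⁻¹ (inv n′)
    d⁻ = δ⁻ (inv 2) x k k⁻¹ (inv n′)
    e = ε-coeff x (inv n′) (inv (suc n′))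
    δ-part : apéry-operator x (τ (suc n′) (suc j) * d⁺) (τ n′ (suc j) * d⁰) (τ n (suc j) * d⁻) ≡
      cert x k * (τ n′ (suc j) * d⁰) + e * (k * τ n′ (suc j) + y * g)
    δ-part = begin
      apéry-operator x (τ (suc n′) (suc j) * d⁺) (τ n′ (suc j) * d⁰) (τ n (suc j) * d⁻)
        ≡⟨ cong₂ (λ u w → apéry-operator x (u * d⁺) (τ n′ (suc j) * d⁰) (w * d⁻)) (τ[1+n,1+j] n′ j) (τ[n-1,1+j] n j) ⟩
      apéry-operator x ((x + k + 1ℚ) * (x + k) * g * i * d⁺) (τ n′ (suc j) * d⁰) ((x - k) * (x - y) * g * i * d⁻)
        ≡⟨ cong (λ v → apéry-operator x ((x + k + 1ℚ) * (x + k) * g * i * d⁺) (v * d⁰) ((x - k) * (x - y) * g * i * d⁻)) (τ[n,1+j] n′ j) ⟩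
      apéry-operator x ((x + k + 1ℚ) * (x + k) * g * i * d⁺) ((x + k) * (x - y) * g * i * d⁰) ((x - k) * (x - y) * g * i * d⁻)
        ≡⟨ δ-identity (inv 2) x y k⁻¹ (inv n′) (inv (suc n′)) g (fromℕ-suc j) (n*inv[n]≡1 {2} ℕ.z<s) (n*inv[n]≡1 {suc j} ℕ.z<s)
             (n*inv[n]≡1 {n′} ℕ.z<s) (trans (cong (_* inv (suc n′)) (trans (+-comm x 1ℚ) (sym (fromℕ-suc n′)))) (n*inv[n]≡1 {suc n′} ℕ.z<s)) ⟩
      cert x k * ((x + k) * (x - y) * g * i * d⁰) + e * (k * ((x + k) * (x - y) * g * i) + y * g)
        ≡⟨ cong (λ v → cert x k * (v * d⁰) + e * (k * v + y * g)) (τ[n,1+j] n′ j) ⟨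
      cert x k * (τ n′ (suc j) * d⁰) + e * (k * τ n′ (suc j) + y * g) ∎

-- The three-term recurrence for both sequences, and their Casoratian.

module Recurrence where

  open import Data.Nat.Base as ℕ using (ℕ; zero; suc)
  import Data.Nat.Properties as ℕ
  open import Data.Rational.Base
  open import Data.Rational.Properties
  open import Relation.Binary.PropositionalEquality
  open import Defs using (partialSum; ζ-term)
  open Binomial
  open Rationals
  open Approximation
  open Certificate
  open ℚ-Solver using (Polynomial; solve; _:+_; _:*_; _:-_; :-_; _:=_)

  private
    -- The condition f 0 = F 0 plays the part of F (-1) = 0.
    telescope : ∀ (f F : ℕ → ℚ) m → f 0 ≡ F 0 → (∀ j → j ℕ.< m → f (suc j) ≡ F (suc j) - F j) → partialSum f (suc m) ≡ F m
    telescope f F zero    f₀ _  = trans (+-identityˡ (f 0)) f₀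
    telescope f F (suc m) f₀ fₛ = begin
      partialSum f (suc m) + f (suc m)
        ≡⟨ cong₂ _+_ (telescope f F m f₀ (λ j j<m → fₛ j (ℕ.m<n⇒m<1+n j<m))) (fₛ m (ℕ.n<1+n m)) ⟩
      F m + (F (suc m) - F m)
        ≡⟨ solve 2 (λ u v → u :+ (v :- u) := v) refl (F m) (F (suc m)) ⟩
      F (suc m) ∎
      where open ≡-Reasoning

    partialSum-operator : ∀ x (u v w : ℕ → ℚ) m → partialSum (λ k → apéry-operator x (u k) (v k) (w k)) m ≡
      apéry-operator x (partialSum u m) (partialSum v m) (partialSum w m)
    partialSum-operator x u v w zero =
      solve 3 (λ p q r → κ 0 := p :* κ 0 :- q :* κ 0 :+ r :* κ 0) refl (cube (x + 1ℚ)) (apéryPoly x) (cube x)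
    partialSum-operator x u v w (suc m) = trans
      (cong (_+ apéry-operator x (u m) (v m) (w m)) (partialSum-operator x u v w m))
      (solve 9 (λ p q r U V W u v w → p :* U :- q :* V :+ r :* W :+ (p :* u :- q :* v :+ r :* w) :=
          p :* (U :+ u) :- q :* (V :+ v) :+ r :* (W :+ w)) refl
        (cube (x + 1ℚ)) (apéryPoly x) (cube x) (partialSum u m) (partialSum v m) (partialSum w m) (u m) (v m) (w m))

    -- The three sums have different lengths. The two shorter ones are padded with their zero terms
    -- up to k = n + 2, then everything telescopes to F (n + 2), which is 0.
    operator-sum : ∀ n {U : ℕ → ℚ} {u : ℕ → ℕ → ℚ} → (∀ n → U n ≡ partialSum (u n) (suc n)) → (F : ℕ → ℚ) → (∀ {m k} → m ℕ.< k → u m k ≡ 0ℚ) →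
      let n′ = suc n ; x = fromℕ n′ ; r = λ k → apéry-operator x (u (suc n′) k) (u n′ k) (u n k) in
      r 0 ≡ F 0 → (∀ j → j ℕ.≤ n′ → r (suc j) ≡ F (suc j) - F j) → F (suc n′) ≡ 0ℚ →
      apéry-operator x (U (suc n′)) (U n′) (U n) ≡ 0ℚ
    operator-sum n {U} {u} U≡ F u≡0 r₀ rₛ F≡0 = begin
      apéry-operator x (U (suc n′)) (U n′) (U n)
        ≡⟨ cong₂ (λ v w → apéry-operator x v (U n′) w) (U≡ (suc n′)) (U≡ n) ⟩
      apéry-operator x S⁺ (U n′) (partialSum (u n) (suc n))
        ≡⟨ cong (λ v → apéry-operator x S⁺ v (partialSum (u n) (suc n))) (U≡ n′) ⟩
      apéry-operator x S⁺ (partialSum (u n′) (suc n′)) (partialSum (u n) (suc n))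
        ≡⟨ cong₂ (apéry-operator x S⁺) (extend (u n′) (suc n′) (u≡0 (ℕ.n<1+n n′)))
             (trans (extend (u n) (suc n) (u≡0 (ℕ.n<1+n n))) (extend (u n) (suc n′) (u≡0 (ℕ.m<n⇒m<1+n (ℕ.n<1+n n))))) ⟩
      apéry-operator x S⁺ (partialSum (u n′) (suc (suc n′))) (partialSum (u n) (suc (suc n′)))
        ≡⟨ partialSum-operator x (u (suc n′)) (u n′) (u n) (suc (suc n′)) ⟨
      partialSum (λ k → apéry-operator x (u (suc n′) k) (u n′ k) (u n k)) (suc (suc n′))
        ≡⟨ telescope _ F (suc n′) r₀ (λ j j<1+n′ → rₛ j (ℕ.s≤s⁻¹ j<1+n′)) ⟩
      F (suc n′)
        ≡⟨ F≡0 ⟩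
      0ℚ ∎
      where
      open ≡-Reasoning
      n′ = suc n
      x = fromℕ n′
      S⁺ = partialSum (u (suc n′)) (suc (suc n′))
      extend : ∀ (f : ℕ → ℚ) m → f m ≡ 0ℚ → partialSum f m ≡ partialSum f (suc m)
      extend f m fm≡0 = sym (trans (cong (partialSum f m +_) fm≡0) (+-identityʳ (partialSum f m)))

    k>n⇒τ≡0 : ∀ {n k} → n ℕ.< k → τ n k ≡ 0ℚ
    k>n⇒τ≡0 n<k = cong fromℕ (k>n⇒t≡0 n<k)

    k>n⇒weight≡0 : ∀ {n k} → n ℕ.< k → weight n k ≡ 0ℚ
    k>n⇒weight≡0 n<k = cong (λ u → u * u) (k>n⇒τ≡0 n<k)

    k>n⇒weighted≡0 : ∀ {n k} → n ℕ.< k → weighted n k ≡ 0ℚ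
    k>n⇒weighted≡0 {n} {k} n<k = trans (cong (_* ζ-approx n k) (k>n⇒weight≡0 n<k)) (*-zeroˡ (ζ-approx n k))

  -- Sealed so that later goals do not unfold these sums; `a≡` and `b≡` give access to them. The
  -- initial values a 0 = 1, a 1 = 5, b 0 = 0, b 1 = 6 are evaluated inside the block, where
  -- unfolding is allowed.
  opaque
    a : ℕ → ℚ
    a n = partialSum (weight n) (suc n)

    b : ℕ → ℚ
    b n = partialSum (weighted n) (suc n)

    a≡ : ∀ n → a n ≡ partialSum (weight n) (suc n)
    a≡ n = refl

    b≡ : ∀ n → b n ≡ partialSum (weighted n) (suc n)
    b≡ n = refl

    casoratian₀ : cube (fromℕ 1) * (b 1 * a 0 - a 1 * b 0) ≡ fromℕ 6
    casoratian₀ = refl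

  a-recurrence : ∀ n → apéry-operator (fromℕ (suc n)) (a (suc (suc n))) (a (suc n)) (a n) ≡ 0ℚ
  a-recurrence n = operator-sum n a≡ (certᵃ n′) k>n⇒weight≡0
    -- The boundary k = 0: every t m 0 is 1, and (x + 1)³ - (34x³ + 51x² + 27x + 5) + x³ = -4(2x +
    -- 1)³.
    (solve 1 (λ x → let s = x :+ (x :+ κ 1) ; i = κ 1 :* κ 1 in
       (x :+ κ 1) :* (x :+ κ 1) :* (x :+ κ 1) :* i
         :- (κ 34 :* (x :* x :* x) :+ κ 51 :* (x :* x) :+ κ 27 :* x :+ κ 5) :* i
         :+ x :* x :* x :* i
       := κ 4 :* s :* (κ 0 :* (κ 0 :+ κ 0 :+ κ 1) :- s :* s) :* i) refl (fromℕ n′))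
    (λ j _ → certᵃ-telescopes n j)
    (trans (cong (cert (fromℕ n′) (fromℕ (suc n′)) *_) (k>n⇒weight≡0 (ℕ.n<1+n n′))) (*-zeroʳ (cert (fromℕ n′) (fromℕ (suc n′)))))
    where n′ = suc n

  b-recurrence : ∀ n → apéry-operator (fromℕ (suc n)) (b (suc (suc n))) (b (suc n)) (b n) ≡ 0ℚ
  b-recurrence n = operator-sum n b≡ (certᵇ n′) k>n⇒weighted≡0 r₀
    (λ j j≤n′ → certᵇ-telescopes n j j≤n′)
    F≡0
    where
    open ≡-Reasoning
    n′ = suc n
    x = fromℕ n′
    e = ε-coeff x (inv n′) (inv (suc n′))
    m⁻¹ = inv (suc n′)
    x⁻¹ = inv n′
    xx⁻¹ : x * x⁻¹ ≡ 1ℚ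
    xx⁻¹ = n*inv[n]≡1 {n′} ℕ.z<s
    mm⁻¹ : (x + 1ℚ) * m⁻¹ ≡ 1ℚ
    mm⁻¹ = trans (cong (_* m⁻¹) (trans (+-comm x 1ℚ) (sym (fromℕ-suc n′)))) (n*inv[n]≡1 {suc n′} ℕ.z<s)
    F≡0 : certᵇ n′ (suc n′) ≡ 0ℚ
    F≡0 = begin
      cert x (fromℕ (suc n′)) * weighted n′ (suc n′) - e * (sign (suc n′) * (fromℕ (suc n′) * τ n′ (suc n′)))
        ≡⟨ cong₂ (λ u v → cert x (fromℕ (suc n′)) * u - e * (sign (suc n′) * (fromℕ (suc n′) * v)))
             (k>n⇒weighted≡0 (ℕ.n<1+n n′)) (k>n⇒τ≡0 (ℕ.n<1+n n′)) ⟩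
      cert x (fromℕ (suc n′)) * 0ℚ - e * (sign (suc n′) * (fromℕ (suc n′) * 0ℚ))
        ≡⟨ solve 4 (λ p e σ k → p :* κ 0 :- e :* (σ :* (k :* κ 0)) := κ 0)
             refl (cert x (fromℕ (suc n′))) e (sign (suc n′)) (fromℕ (suc n′)) ⟩
      0ℚ ∎
    r₀ : apéry-operator x (weighted (suc n′) 0) (weighted n′ 0) (weighted n 0) ≡ certᵇ n′ 0
    r₀ = begin
      apéry-operator x (1ℚ * 1ℚ * (ζ₃ n + ζ-term 3 n + ζ-term 3 n′ + 0ℚ)) (1ℚ * 1ℚ * (ζ₃ n + ζ-term 3 n + 0ℚ)) (1ℚ * 1ℚ * (ζ₃ n + 0ℚ))
        ≡⟨ cong₂ (λ u v → apéry-operator x (1ℚ * 1ℚ * (ζ₃ n + u + v + 0ℚ)) (1ℚ * 1ℚ * (ζ₃ n + u + 0ℚ)) (1ℚ * 1ℚ * (ζ₃ n + 0ℚ))) (ζ-term₃ n) (ζ-term₃ n′) ⟩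
      apéry-operator x (1ℚ * 1ℚ * (ζ₃ n + cube x⁻¹ + cube m⁻¹ + 0ℚ)) (1ℚ * 1ℚ * (ζ₃ n + cube x⁻¹ + 0ℚ)) (1ℚ * 1ℚ * (ζ₃ n + 0ℚ))
        -- Relative to the value z + x⁻³ at n′, the two outer sums of cubes contribute (x + 1)³ m⁻³
        -- and -x³ x⁻³. These are 1 and -1 and cancel in the next step.
        ≡⟨ solve 5 (λ x z x⁻¹ m⁻¹ e → let cb = λ (u : Polynomial 5) → u :* u :* u ; s = x :+ (x :+ κ 1) ; i = κ 1 :* κ 1 in
             cb (x :+ κ 1) :* (i :* (z :+ cb x⁻¹ :+ cb m⁻¹ :+ κ 0))
               :- (κ 34 :* (x :* x :* x) :+ κ 51 :* (x :* x) :+ κ 27 :* x :+ κ 5) :* (i :* (z :+ cb x⁻¹ :+ κ 0))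
               :+ cb x :* (i :* (z :+ κ 0))
             := κ 4 :* s :* (κ 0 :* (κ 0 :+ κ 0 :+ κ 1) :- s :* s) :* (i :* (z :+ cb x⁻¹ :+ κ 0)) :- e :* (κ 1 :* (κ 0 :* κ 1))
                :+ (cb ((x :+ κ 1) :* m⁻¹) :- cb (x :* x⁻¹))) refl x (ζ₃ n) x⁻¹ m⁻¹ e ⟩
      cert x 0ℚ * (1ℚ * 1ℚ * (ζ₃ n + cube x⁻¹ + 0ℚ)) - e * (1ℚ * (0ℚ * 1ℚ)) + (cube ((x + 1ℚ) * m⁻¹) - cube (x * x⁻¹))
        ≡⟨ cong₂ (λ u v → cert x 0ℚ * (1ℚ * 1ℚ * (ζ₃ n + cube x⁻¹ + 0ℚ)) - e * (1ℚ * (0ℚ * 1ℚ)) + (cube u - cube v)) mm⁻¹ xx⁻¹ ⟩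
      cert x 0ℚ * (1ℚ * 1ℚ * (ζ₃ n + cube x⁻¹ + 0ℚ)) - e * (1ℚ * (0ℚ * 1ℚ)) + 0ℚ
        ≡⟨ +-identityʳ _ ⟩
      cert x 0ℚ * (1ℚ * 1ℚ * (ζ₃ n + cube x⁻¹ + 0ℚ)) - e * (1ℚ * (0ℚ * 1ℚ))
        ≡⟨ cong (λ u → cert x 0ℚ * (1ℚ * 1ℚ * (ζ₃ n + u + 0ℚ)) - e * (1ℚ * (0ℚ * 1ℚ))) (ζ-term₃ n) ⟨
      certᵇ n′ 0 ∎

  -- Multiplying the recurrence of b by a and that of a by b eliminates the middle coefficient.
  -- Hence (n + 1)³ times the determinant does not depend on n, and n = 0 gives 6.
  casoratian : ∀ n → cube (fromℕ (suc n)) * (b (suc n) * a n - a (suc n) * b n) ≡ fromℕ 6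
  casoratian zero = casoratian₀
  casoratian (suc n) = begin
    cube (fromℕ (suc n′)) * (b (suc n′) * a n′ - a (suc n′) * b n′)
      ≡⟨ cong (λ u → cube u * (b (suc n′) * a n′ - a (suc n′) * b n′)) (trans (fromℕ-suc n′) (+-comm 1ℚ x)) ⟩
    cube (x + 1ℚ) * (b (suc n′) * a n′ - a (suc n′) * b n′)
      ≡⟨ solve 9 (λ p q r a a′ a″ b b′ b″ → p :* (b″ :* a′ :- a″ :* b′) :=
           (p :* b″ :- q :* b′ :+ r :* b) :* a′ :- (p :* a″ :- q :* a′ :+ r :* a) :* b′ :+ r :* (b′ :* a :- a′ :* b)) refl
           (cube (x + 1ℚ)) (apéryPoly x) (cube x) (a n) (a n′) (a (suc n′)) (b n) (b n′) (b (suc n′)) ⟩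
    apéry-operator x (b (suc n′)) (b n′) (b n) * a n′ - apéry-operator x (a (suc n′)) (a n′) (a n) * b n′ + cube x * (b n′ * a n - a n′ * b n)
      ≡⟨ cong₂ (λ u v → u * a n′ - v * b n′ + cube x * (b n′ * a n - a n′ * b n)) (b-recurrence n) (a-recurrence n) ⟩
    0ℚ * a n′ - 0ℚ * b n′ + cube x * (b n′ * a n - a n′ * b n)
      ≡⟨ solve 3 (λ a b u → κ 0 :* a :- κ 0 :* b :+ u := u) refl (a n′) (b n′) (cube x * (b n′ * a n - a n′ * b n)) ⟩
    cube x * (b n′ * a n - a n′ * b n)
      ≡⟨ casoratian n ⟩
    fromℕ 6 ∎
    where
    open ≡-Reasoning
    n′ = suc n
    x = fromℕ n′

-- Exponential lower bound for the denominators a n, in ℕ.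

module Growth where

  open import Data.Nat.Base
  open import Data.Nat.Properties
  open import Data.Nat.Solver using (module +-*-Solver)
  open import Data.Unit using (tt)
  import Data.Integer.Properties as ℤ
  import Data.Rational.Base as ℚ
  import Data.Rational.Properties as ℚ
  open import Relation.Binary.PropositionalEquality
  open import Defs using (partialSum)
  open Binomial
  open Rationals
  open Certificate
  open Recurrence
  open +-*-Solver using (solve; _:+_; _:*_; _:=_; con)

  private
    sumSq : ℕ → ℕ → ℕ
    sumSq n zero    = 0
    sumSq n (suc k) = sumSq n k + t n k * t n k

    fromℕ-sumSq : ∀ n k → fromℕ (sumSq n k) ≡ partialSum (weight n) k
    fromℕ-sumSq n zero    = refl
    fromℕ-sumSq n (suc k) = trans (fromℕ-homo-+ (sumSq n k) (t n k * t n k))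
      (cong₂ ℚ._+_ (fromℕ-sumSq n k) (fromℕ-homo-* (t n k) (t n k)))

    sumSq>0 : ∀ n k → 0 < sumSq n (suc k)
    sumSq>0 n zero    = s≤s z≤n
    sumSq>0 n (suc k) = <-≤-trans (sumSq>0 n k) (m≤m+n (sumSq n (suc k)) _)

    fromℕ-injective : ∀ {m n} → fromℕ m ≡ fromℕ n → m ≡ n
    fromℕ-injective {m} {n} eq = ℤ.+-injective (cong ℚ.ℚ.numerator eq)

  -- `A n` is a n as a natural number, the form in which reciprocals, growth and integrality use it.
  -- The numerical base case stands inside the block because there `A 11` and `A 12` can be
  -- evaluated.
  opaque
    A : ℕ → ℕ
    A n = sumSq n (suc n)

    fromℕ[A]≡a : ∀ n → fromℕ (A n) ≡ a n
    fromℕ[A]≡a n = trans (fromℕ-sumSq n (suc n)) (sym (a≡ n))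

    A>0 : ∀ n → 0 < A n
    A>0 n = sumSq>0 n n

    29*A[11]≤A[12] : 29 * A 11 ≤ A 12
    29*A[11]≤A[12] = ≤ᵇ⇒≤ (29 * A 11) (A 12) tt

  A-recurrence : ∀ n → let x = suc n ; y = suc x in
    y * y * y * A (suc x) + x * x * x * A n ≡ (34 * (x * x * x) + 51 * (x * x) + 27 * x + 5) * A x
  A-recurrence n = fromℕ-injective (begin
    fromℕ (y * y * y * A (suc x) + x * x * x * A n)
      ≡⟨ trans (fromℕ-homo-+ (y * y * y * A (suc x)) (x * x * x * A n)) (cong₂ ℚ._+_ (homo₄ y (A (suc x)) (a (suc x)) (fromℕ[A]≡a (suc x))) (homo₄ x (A n) (a n) (fromℕ[A]≡a n))) ⟩
    cube Y ℚ.* a (suc x) ℚ.+ cube X ℚ.* a n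
      ≡⟨ cong (λ u → cube u ℚ.* a (suc x) ℚ.+ cube X ℚ.* a n) (trans (fromℕ-suc x) (ℚ.+-comm ℚ.1ℚ X)) ⟩
    cube (X ℚ.+ ℚ.1ℚ) ℚ.* a (suc x) ℚ.+ cube X ℚ.* a n
      ≡⟨ S.solve 6 (λ p q r u v w → p S.:* u S.:+ r S.:* w S.:= (p S.:* u S.:- q S.:* v S.:+ r S.:* w) S.:+ q S.:* v) refl
           (cube (X ℚ.+ ℚ.1ℚ)) (apéryPoly X) (cube X) (a (suc x)) (a x) (a n) ⟩
    apéry-operator X (a (suc x)) (a x) (a n) ℚ.+ apéryPoly X ℚ.* a x
      ≡⟨ trans (cong (ℚ._+ apéryPoly X ℚ.* a x) (a-recurrence n)) (ℚ.+-identityˡ (apéryPoly X ℚ.* a x)) ⟩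
    apéryPoly X ℚ.* a x
      ≡⟨ cong₂ ℚ._*_ fromℕ-apéryPoly (fromℕ[A]≡a x) ⟨
    fromℕ (34 * (x * x * x) + 51 * (x * x) + 27 * x + 5) ℚ.* fromℕ (A x)
      ≡⟨ fromℕ-homo-* (34 * (x * x * x) + 51 * (x * x) + 27 * x + 5) (A x) ⟨
    fromℕ ((34 * (x * x * x) + 51 * (x * x) + 27 * x + 5) * A x) ∎)
    where
    open ≡-Reasoning
    module S = ℚ-Solver
    x = suc n
    y = suc x
    X = fromℕ x
    Y = fromℕ y
    fromℕ-cube : ∀ m → fromℕ (m * m * m) ≡ cube (fromℕ m)
    fromℕ-cube m = trans (fromℕ-homo-* (m * m) m) (cong (ℚ._* fromℕ m) (fromℕ-homo-* m m))
    homo₄ : ∀ m u v → fromℕ u ≡ v → fromℕ (m * m * m * u) ≡ cube (fromℕ m) ℚ.* v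
    homo₄ m u v u≡v = trans (fromℕ-homo-* (m * m * m) u) (cong₂ ℚ._*_ (fromℕ-cube m) u≡v)
    fromℕ-apéryPoly : fromℕ (34 * (x * x * x) + 51 * (x * x) + 27 * x + 5) ≡ apéryPoly X
    fromℕ-apéryPoly =
      trans (fromℕ-homo-+ (34 * (x * x * x) + 51 * (x * x) + 27 * x) 5) (cong (ℚ._+ fromℕ 5)
      (trans (fromℕ-homo-+ (34 * (x * x * x) + 51 * (x * x)) (27 * x)) (cong₂ ℚ._+_
        (trans (fromℕ-homo-+ (34 * (x * x * x)) (51 * (x * x))) (cong₂ ℚ._+_
          (trans (fromℕ-homo-* 34 (x * x * x)) (cong (fromℕ 34 ℚ.*_) (fromℕ-cube x)))
          (trans (fromℕ-homo-* 51 (x * x)) (cong (fromℕ 51 ℚ.*_) (fromℕ-homo-* x x)))))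
        (fromℕ-homo-* 27 x))))

  -- The ratio tends to (1 + √2)⁴ ≈ 33.97; any bound above (num / den)^(3/41) ≈ 27.6 suffices.
  29*A[n]≤A[1+n] : ∀ d → 29 * A (11 + d) ≤ A (12 + d)
  29*A[n]≤A[1+n] zero    = 29*A[11]≤A[12]
  29*A[n]≤A[1+n] (suc d) = *-cancelˡ-≤ (29 * (y * y * y)) (+-cancelʳ-≤ (x * x * x * A x) _ _ (begin
    29 * (y * y * y) * (29 * A x) + x * x * x * A x
      ≤⟨ m≤m+n _ (R * A x) ⟩
    29 * (y * y * y) * (29 * A x) + x * x * x * A x + R * A x
      ≡⟨ solve 2 (λ d a → let x = con 12 :+ d ; y = con 1 :+ x in
           con 29 :* (y :* y :* y) :* (con 29 :* a) :+ x :* x :* x :* a :+ (con 144 :* (d :* d :* d) :+ con 4140 :* (d :* d) :+ con 35412 :* d :+ con 76920) :* a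
           := con 29 :* ((con 34 :* (x :* x :* x) :+ con 51 :* (x :* x) :+ con 27 :* x :+ con 5) :* a)) refl d (A x) ⟩
    29 * ((34 * (x * x * x) + 51 * (x * x) + 27 * x + 5) * A x)
      ≡⟨ cong (29 *_) (A-recurrence n) ⟨
    29 * (y * y * y * A (suc x) + x * x * x * A n)
      ≡⟨ solve 4 (λ y a x b → con 29 :* (y :* a :+ x :* b) := con 29 :* y :* a :+ x :* (con 29 :* b))
           refl (y * y * y) (A (suc x)) (x * x * x) (A n) ⟩
    29 * (y * y * y) * A (suc x) + x * x * x * (29 * A n)
      ≤⟨ +-monoʳ-≤ (29 * (y * y * y) * A (suc x)) (*-monoʳ-≤ (x * x * x) (29*A[n]≤A[1+n] d)) ⟩
    29 * (y * y * y) * A (suc x) + x * x * x * A x ∎))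
    where
    open ≤-Reasoning
    n = 11 + d
    x = 12 + d
    y = 13 + d
    -- This is 29(34x³ + 51x² + 27x + 5) - 29²(x + 1)³ - x³ expanded at x = 12 + d. No coefficient
    -- is negative there, so the slack lies in ℕ.
    R = 144 * (d * d * d) + 4140 * (d * d) + 35412 * d + 76920

-- Convergence of b n / a n to ζ(3), with an explicit error.

module Limit where

  open import Data.Nat.Base as ℕ using (ℕ; zero; suc)
  import Data.Nat.Properties as ℕ
  import Data.Integer.Base as ℤ
  open import Data.Rational.Base
  open import Data.Rational.Properties
  open import Data.Product using (∃-syntax; _,_; _×_)
  open import Data.Sum using (inj₁; inj₂)
  open import Relation.Binary.PropositionalEquality
  open import Defs using (partialSum; _≈_; fromℚ; ζ)
  open Binomial
  open Rationals
  open Approximation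
  open Certificate
  open Recurrence
  open Growth
  open ℚ-Solver using (solve; _:+_; _:*_; _:-_; :-_; _:=_)

  0<*0< : ∀ {p q} → 0ℚ < p → 0ℚ < q → 0ℚ < p * q
  0<*0< {p} {q} 0<p 0<q = positive⁻¹ (p * q) {{pos*pos⇒pos p {{positive 0<p}} q {{positive 0<q}}}}

  private
    p≤∣p∣ : ∀ p → p ≤ ∣ p ∣
    p≤∣p∣ p with ∣p∣≡p∨∣p∣≡-p p
    ... | inj₁ eq = ≤-reflexive (sym eq)
    ... | inj₂ eq = ≤-trans (subst (_≤ 0ℚ) (neg-involutive p) (neg-antimono-≤ (subst (0ℚ ≤_) eq (0≤∣p∣ p)))) (0≤∣p∣ p)
      where
      neg-involutive : ∀ p → - (- p) ≡ p
      neg-involutive = solve 1 (λ p → :- (:- p) := p) refl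

    0≤q-p : ∀ {p q} → p ≤ q → 0ℚ ≤ q - p
    0≤q-p {p} {q} p≤q = subst (_≤ q - p) (+-inverseʳ p) (+-monoˡ-≤ (- p) p≤q)

    0≤*0≤ : ∀ {p q} → 0ℚ ≤ p → 0ℚ ≤ q → 0ℚ ≤ p * q
    0≤*0≤ {p} {q} 0≤p 0≤q = nonNegative⁻¹ (p * q) {{nonNeg*nonNeg⇒nonNeg p {{nonNegative 0≤p}} q {{nonNegative 0≤q}}}}

    p≤q+[p-q] : ∀ {p q r} → p ≡ q - r → 0ℚ ≤ r → p ≤ q
    p≤q+[p-q] {p} {q} {r} p≡ 0≤r = begin
      p       ≡⟨ p≡ ⟩
      q - r   ≤⟨ +-monoʳ-≤ q (neg-antimono-≤ 0≤r) ⟩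
      q + 0ℚ  ≡⟨ +-identityʳ q ⟩
      q       ∎
      where open ≤-Reasoning

    ∣partialSum∣≤ : ∀ {f g : ℕ → ℚ} m → (∀ i → i ℕ.< m → ∣ f i ∣ ≤ g i) → ∣ partialSum f m ∣ ≤ partialSum g m
    ∣partialSum∣≤ zero _ = ≤-refl
    ∣partialSum∣≤ {f} {g} (suc m) f≤g = ≤-trans (∣p+q∣≤∣p∣+∣q∣ (partialSum f m) (f m))
      (+-mono-≤ (∣partialSum∣≤ m (λ i i<m → f≤g i (ℕ.m<n⇒m<1+n i<m))) (f≤g m (ℕ.n<1+n m)))

    partialSum-*ʳ : ∀ (f : ℕ → ℚ) r m → partialSum (λ i → f i * r) m ≡ partialSum f m * r
    partialSum-*ʳ f r zero    = sym (*-zeroˡ r)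
    partialSum-*ʳ f r (suc m) = trans (cong (_+ f m * r) (partialSum-*ʳ f r m)) (sym (*-distribʳ-+ r (partialSum f m) (f m)))

    partialSum-const : ∀ r m → partialSum (λ _ → r) m ≡ fromℕ m * r
    partialSum-const r zero    = sym (*-zeroˡ r)
    partialSum-const r (suc m) = begin
      partialSum (λ _ → r) m + r  ≡⟨ cong (_+ r) (partialSum-const r m) ⟩
      fromℕ m * r + r             ≡⟨ solve 2 (λ m r → m :* r :+ r := (κ 1 :+ m) :* r) refl (fromℕ m) r ⟩
      (1ℚ + fromℕ m) * r          ≡⟨ cong (_* r) (fromℕ-suc m) ⟨
      fromℕ (suc m) * r           ∎
      where open ≡-Reasoning

    inv-antimono : ∀ {m n} → 0 ℕ.< m → m ℕ.≤ n → inv n ≤ inv m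
    inv-antimono {m} {n} 0<m m≤n = p≤q+[p-q] {r = (N - M) * (inv m * inv n)} (begin
      inv n
        ≡⟨ solve 2 (λ u v → v := u :- (u :* κ 1 :- κ 1 :* v)) refl (inv m) (inv n) ⟩
      inv m - (inv m * 1ℚ - 1ℚ * inv n)
        ≡⟨ cong₂ (λ e f → inv m - (inv m * e - f * inv n)) (n*inv[n]≡1 0<n) (n*inv[n]≡1 0<m) ⟨
      inv m - (inv m * (N * inv n) - (M * inv m) * inv n)
        ≡⟨ cong (_-_ (inv m)) (solve 4 (λ M N u v → u :* (N :* v) :- M :* u :* v := (N :- M) :* (u :* v))
             refl M N (inv m) (inv n)) ⟩
      inv m - (N - M) * (inv m * inv n) ∎)
      (0≤*0≤ (0≤q-p (fromℕ-mono-≤ m≤n)) (0≤*0≤ (<⇒≤ (0<inv 0<m)) (<⇒≤ (0<inv 0<n))))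
      where
      open ≡-Reasoning
      M = fromℕ m
      N = fromℕ n
      0<n = ℕ.<-≤-trans 0<m m≤n

    inv≤1 : ∀ {n} → 0 ℕ.< n → inv n ≤ 1ℚ
    inv≤1 {n} 0<n = inv-antimono {1} (ℕ.s≤s ℕ.z≤n) 0<n

    0≤inv : ∀ n → 0ℚ ≤ inv n
    0≤inv zero    = ≤-refl
    0≤inv (suc n) = <⇒≤ (0<inv {suc n} ℕ.z<s)

    ∣sign∣≡1 : ∀ k → ∣ sign k ∣ ≡ 1ℚ
    ∣sign∣≡1 zero    = refl
    ∣sign∣≡1 (suc k) = trans (∣-p∣≡∣p∣ (sign k)) (∣sign∣≡1 k)

    -- Split 1/(2k³ t n k) into 1/(2k), which is at most 1, and 1/(k² t n k), which `n²≤k²t` bounds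
    -- by 1/n².
    ∣correction∣≤ : ∀ {n j} → j ℕ.< n → ∣ correction n j ∣ ≤ inv n * inv n
    ∣correction∣≤ {n} {j} j<n = begin
      ∣ sign j * (inv 2 * inv k * inv k * inv k * inv (t n k)) ∣
        ≡⟨ ∣p*q∣≡∣p∣*∣q∣ (sign j) _ ⟩
      ∣ sign j ∣ * ∣ inv 2 * inv k * inv k * inv k * inv (t n k) ∣
        ≡⟨ cong (_* ∣ inv 2 * inv k * inv k * inv k * inv (t n k) ∣) (∣sign∣≡1 j) ⟩
      1ℚ * ∣ inv 2 * inv k * inv k * inv k * inv (t n k) ∣
        ≡⟨ *-identityˡ _ ⟩
      ∣ inv 2 * inv k * inv k * inv k * inv (t n k) ∣
        ≡⟨ cong ∣_∣ (solve 3 (λ h k u → h :* k :* k :* k :* u := (h :* k) :* (k :* k :* u))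
             refl (inv 2) (inv k) (inv (t n k))) ⟩
      ∣ (inv 2 * inv k) * (inv k * inv k * inv (t n k)) ∣
        ≡⟨ cong ∣_∣ (cong₂ _*_ (sym (inv-homo-* 2 k)) (trans (cong (_* inv (t n k)) (sym (inv-homo-* k k))) (sym (inv-homo-* (k ℕ.* k) (t n k))))) ⟩
      ∣ inv (2 ℕ.* k) * inv (k ℕ.* k ℕ.* t n k) ∣
        ≡⟨ 0≤p⇒∣p∣≡p (0≤*0≤ (0≤inv (2 ℕ.* k)) (0≤inv (k ℕ.* k ℕ.* t n k))) ⟩
      inv (2 ℕ.* k) * inv (k ℕ.* k ℕ.* t n k)
        ≤⟨ *-monoʳ-≤-nonNeg (inv (k ℕ.* k ℕ.* t n k)) {{nonNegative (0≤inv (k ℕ.* k ℕ.* t n k))}} (inv≤1 {2 ℕ.* k} ℕ.z<s) ⟩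
      1ℚ * inv (k ℕ.* k ℕ.* t n k)
        ≡⟨ *-identityˡ _ ⟩
      inv (k ℕ.* k ℕ.* t n k)
        ≤⟨ inv-antimono (ℕ.*-mono-≤ 0<n 0<n) (n²≤k²t {n} {k} (ℕ.s≤s ℕ.z≤n) j<n) ⟩
      inv (n ℕ.* n)
        ≡⟨ inv-homo-* n n ⟩
      inv n * inv n ∎
      where
      open ≤-Reasoning
      k = suc j
      0<n = ℕ.≤-<-trans ℕ.z≤n j<n

    ∣ζ-approx-ζ₃∣≤ : ∀ {n k} → 0 ℕ.< n → k ℕ.≤ n → ∣ partialSum (correction n) k ∣ ≤ inv n
    ∣ζ-approx-ζ₃∣≤ {n} {k} 0<n k≤n = begin
      ∣ partialSum (correction n) k ∣
        ≤⟨ ∣partialSum∣≤ k (λ i i<k → ∣correction∣≤ (ℕ.<-≤-trans i<k k≤n)) ⟩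
      partialSum (λ _ → inv n * inv n) k
        ≡⟨ partialSum-const (inv n * inv n) k ⟩
      fromℕ k * (inv n * inv n)
        ≤⟨ *-monoʳ-≤-nonNeg (inv n * inv n) {{nonNegative (0≤*0≤ (0≤inv n) (0≤inv n))}} (fromℕ-mono-≤ k≤n) ⟩
      fromℕ n * (inv n * inv n)
        ≡⟨ *-assoc (fromℕ n) (inv n) (inv n) ⟨
      fromℕ n * inv n * inv n
        ≡⟨ cong (_* inv n) (n*inv[n]≡1 0<n) ⟩
      1ℚ * inv n
        ≡⟨ *-identityˡ (inv n) ⟩
      inv n ∎
      where open ≤-Reasoning

    b≡a*ζ₃+ : ∀ n → b n ≡ a n * ζ₃ n + partialSum (λ k → weight n k * partialSum (correction n) k) (suc n)
    b≡a*ζ₃+ n = trans (b≡ n) (trans (go (suc n)) (cong (λ u → u * ζ₃ n + partialSum (λ k → weight n k * partialSum (correction n) k) (suc n)) (sym (a≡ n))))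
      where
      go : ∀ m → partialSum (weighted n) m ≡
        partialSum (weight n) m * ζ₃ n + partialSum (λ k → weight n k * partialSum (correction n) k) m
      go zero    = solve 1 (λ z → κ 0 := κ 0 :* z :+ κ 0) refl (ζ₃ n)
      go (suc m) = trans (cong (_+ weighted n m) (go m))
        (solve 5 (λ W z P w p → W :* z :+ P :+ w :* (z :+ p) := (W :+ w) :* z :+ (P :+ w :* p)) refl
          (partialSum (weight n) m) (ζ₃ n) (partialSum (λ k → weight n k * partialSum (correction n) k) m)
          (weight n m) (partialSum (correction n) m))

    0≤weight : ∀ n k → 0ℚ ≤ weight n k
    0≤weight n k = 0≤*0≤ (0≤fromℕ (t n k)) (0≤fromℕ (t n k))

  ρ : ℕ → ℚ
  ρ n = b n * inv (A n)

  a*inv[A]≡1 : ∀ n → a n * inv (A n) ≡ 1ℚ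
  a*inv[A]≡1 n = trans (cong (_* inv (A n)) (sym (fromℕ[A]≡a n))) (n*inv[n]≡1 (A>0 n))

  -- The quotient `ρ n` is the average of the `ζ-approx n k` with weights (t n k)², and each of
  -- these is within 1/n of `ζ₃ n`.
  ∣ρ-ζ₃∣≤inv : ∀ {n} → 0 ℕ.< n → ∣ ρ n - ζ₃ n ∣ ≤ inv n
  ∣ρ-ζ₃∣≤inv {n} 0<n = begin
    ∣ b n * inv (A n) - ζ₃ n ∣
      ≡⟨ cong ∣_∣ (begin-equality
        b n * inv (A n) - ζ₃ n
          ≡⟨ cong (λ u → u * inv (A n) - ζ₃ n) (b≡a*ζ₃+ n) ⟩
        (a n * ζ₃ n + P) * inv (A n) - ζ₃ n
          ≡⟨ solve 4 (λ a z P u → (a :* z :+ P) :* u :- z := (a :* u) :* z :- z :+ P :* u)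
               refl (a n) (ζ₃ n) P (inv (A n)) ⟩
        (a n * inv (A n)) * ζ₃ n - ζ₃ n + P * inv (A n)
          ≡⟨ cong (λ e → e * ζ₃ n - ζ₃ n + P * inv (A n)) (a*inv[A]≡1 n) ⟩
        1ℚ * ζ₃ n - ζ₃ n + P * inv (A n)
          ≡⟨ solve 2 (λ z u → κ 1 :* z :- z :+ u := u) refl (ζ₃ n) (P * inv (A n)) ⟩
        P * inv (A n) ∎) ⟩
    ∣ P * inv (A n) ∣
      ≡⟨ trans (∣p*q∣≡∣p∣*∣q∣ P (inv (A n))) (cong (∣ P ∣ *_) (0≤p⇒∣p∣≡p (0≤inv (A n)))) ⟩
    ∣ P ∣ * inv (A n)
      ≤⟨ *-monoʳ-≤-nonNeg (inv (A n)) {{nonNegative (0≤inv (A n))}} ∣P∣≤ ⟩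
    a n * inv n * inv (A n)
      ≡⟨ solve 3 (λ a n u → a :* n :* u := (a :* u) :* n) refl (a n) (inv n) (inv (A n)) ⟩
    (a n * inv (A n)) * inv n
      ≡⟨ trans (cong (_* inv n) (a*inv[A]≡1 n)) (*-identityˡ (inv n)) ⟩
    inv n ∎
    where
    open ≤-Reasoning
    P = partialSum (λ k → weight n k * partialSum (correction n) k) (suc n)
    ∣P∣≤ : ∣ P ∣ ≤ a n * inv n
    ∣P∣≤ = subst (∣ P ∣ ≤_) (trans (partialSum-*ʳ (weight n) (inv n) (suc n)) (cong (_* inv n) (sym (a≡ n)))) (∣partialSum∣≤ (suc n) λ k k≤n → begin
      ∣ weight n k * partialSum (correction n) k ∣
        ≡⟨ trans (∣p*q∣≡∣p∣*∣q∣ (weight n k) _) (cong (_* ∣ partialSum (correction n) k ∣) (0≤p⇒∣p∣≡p (0≤weight n k))) ⟩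
      weight n k * ∣ partialSum (correction n) k ∣
        ≤⟨ *-monoˡ-≤-nonNeg (weight n k) {{nonNegative (0≤weight n k)}} (∣ζ-approx-ζ₃∣≤ 0<n (ℕ.s≤s⁻¹ k≤n)) ⟩
      weight n k * inv n ∎)

  ρ-step : ∀ n → ρ (suc n) - ρ n ≡ fromℕ 6 * cube (inv (suc n)) * (inv (A n) * inv (A (suc n)))
  ρ-step n = begin
    b n′ * u′ - b n * u
      ≡⟨ solve 4 (λ b′ u′ b u → b′ :* u′ :- b :* u := b′ :* u′ :* κ 1 :- b :* u :* κ 1) refl (b n′) u′ (b n) u ⟩
    b n′ * u′ * 1ℚ - b n * u * 1ℚ
      ≡⟨ cong₂ (λ e f → b n′ * u′ * e - b n * u * f) (a*inv[A]≡1 n) (a*inv[A]≡1 n′) ⟨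
    b n′ * u′ * (a n * u) - b n * u * (a n′ * u′)
      ≡⟨ solve 6 (λ b′ u′ a u b a′ → b′ :* u′ :* (a :* u) :- b :* u :* (a′ :* u′) :=
           (b′ :* a :- a′ :* b) :* κ 1 :* (u :* u′)) refl
           (b n′) u′ (a n) u (b n) (a n′) ⟩
    (b n′ * a n - a n′ * b n) * 1ℚ * (u * u′)
      ≡⟨ cong (λ e → (b n′ * a n - a n′ * b n) * (e * e * e) * (u * u′)) (n*inv[n]≡1 {n′} ℕ.z<s) ⟨
    (b n′ * a n - a n′ * b n) * cube (x * x⁻¹) * (u * u′)
      ≡⟨ solve 4 (λ w x x⁻¹ v → w :* ((x :* x⁻¹) :* (x :* x⁻¹) :* (x :* x⁻¹)) :* v :=
           (x :* x :* x :* w) :* (x⁻¹ :* x⁻¹ :* x⁻¹) :* v) refl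
           (b n′ * a n - a n′ * b n) x x⁻¹ (u * u′) ⟩
    cube x * (b n′ * a n - a n′ * b n) * cube x⁻¹ * (u * u′)
      ≡⟨ cong (λ w → w * cube x⁻¹ * (u * u′)) (casoratian n) ⟩
    fromℕ 6 * cube x⁻¹ * (u * u′) ∎
    where
    open ≡-Reasoning
    n′ = suc n
    x = fromℕ n′
    x⁻¹ = inv n′
    u = inv (A n)
    u′ = inv (A n′)

  private
    0<inv[A] : ∀ n → 0ℚ < inv (A n)
    0<inv[A] n = 0<inv (A>0 n)

    0<ρ-step : ∀ n → 0ℚ < ρ (suc n) - ρ n
    0<ρ-step n = subst (0ℚ <_) (sym (ρ-step n)) (0<*0< (0<*0< {fromℕ 6} (fromℕ-mono-< {0} {6} ℕ.z<s) (0<*0< (0<*0< 0<i 0<i) 0<i)) (0<*0< (0<inv[A] n) (0<inv[A] (suc n))))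
      where 0<i = 0<inv {suc n} ℕ.z<s

    ρ<ρ[1+n] : ∀ n → ρ n < ρ (suc n)
    ρ<ρ[1+n] n = subst₂ _<_ (+-identityˡ (ρ n)) (solve 2 (λ u v → u :- v :+ v := u)
         refl (ρ (suc n)) (ρ n)) (+-monoˡ-< (ρ n) (0<ρ-step n))

    ρ-mono : ∀ {m n} → m ℕ.≤′ n → ρ m ≤ ρ n
    ρ-mono (ℕ.≤′-reflexive refl) = ≤-refl
    ρ-mono (ℕ.≤′-step {n} m≤n)   = ≤-trans (ρ-mono m≤n) (<⇒≤ (ρ<ρ[1+n] n))

    A-mono : ∀ {d e} → d ℕ.≤′ e → A (11 ℕ.+ d) ℕ.≤ A (11 ℕ.+ e)
    A-mono (ℕ.≤′-reflexive refl) = ℕ.≤-refl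
    A-mono (ℕ.≤′-step {e} d≤e)   = ℕ.≤-trans (A-mono d≤e) (ℕ.≤-trans (ℕ.m≤n*m (A (11 ℕ.+ e)) 29) (29*A[n]≤A[1+n] e))

    -- The ratio 29 leaves 28 copies of the larger term to cover the smaller one. This supplies the
    -- hypothesis of `ρ-step≤`.
    A+A≤A : ∀ {d e} → d ℕ.≤′ e → A (11 ℕ.+ e) ℕ.+ A (11 ℕ.+ d) ℕ.≤ A (12 ℕ.+ e)
    A+A≤A {d} {e} d≤e = ℕ.≤-trans (ℕ.+-monoʳ-≤ (A (11 ℕ.+ e)) (ℕ.≤-trans (A-mono d≤e) (ℕ.m≤n*m (A (11 ℕ.+ e)) 28)))
      (29*A[n]≤A[1+n] e)

    -- Since A n ≤ A (k + 1) - A k, the Casoratian increment of ρ is dominated by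
    -- an increment of the telescoping sequence - 6 / (A n · A k).
    ρ-step≤ : ∀ {n k} → A k ℕ.+ A n ℕ.≤ A (suc k) →
      ρ (suc k) + fromℕ 6 * inv (A n) * inv (A (suc k)) ≤ ρ k + fromℕ 6 * inv (A n) * inv (A k)
    ρ-step≤ {n} {k} A+A≤A = begin
      ρ (suc k) + fromℕ 6 * v * u′
        ≡⟨ solve 4 (λ r r′ v u′ → r′ :+ κ 6 :* v :* u′ := (r′ :- r) :+ (r :+ κ 6 :* v :* u′))
             refl (ρ k) (ρ (suc k)) v u′ ⟩
      (ρ (suc k) - ρ k) + (ρ k + fromℕ 6 * v * u′)
        ≡⟨ cong (_+ (ρ k + fromℕ 6 * v * u′)) (ρ-step k) ⟩
      fromℕ 6 * cube i * (u * u′) + (ρ k + fromℕ 6 * v * u′)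
        ≤⟨ +-monoˡ-≤ (ρ k + fromℕ 6 * v * u′) bound ⟩
      fromℕ 6 * (v * (fromℕ (A (suc k)) - fromℕ (A k)) * (u * u′)) + (ρ k + fromℕ 6 * v * u′)
        ≡⟨ solve 6 (λ v a′ a u u′ r → κ 6 :* (v :* (a′ :- a) :* (u :* u′)) :+ (r :+ κ 6 :* v :* u′) :=
             r :+ κ 6 :* v :* ((a′ :* u′) :* u :- (a :* u) :* u′ :+ u′))
                  refl v (fromℕ (A (suc k))) (fromℕ (A k)) u u′ (ρ k) ⟩
      ρ k + fromℕ 6 * v * ((fromℕ (A (suc k)) * u′) * u - (fromℕ (A k) * u) * u′ + u′)
        ≡⟨ cong₂ (λ e f → ρ k + fromℕ 6 * v * (e * u - f * u′ + u′)) (n*inv[n]≡1 (A>0 (suc k))) (n*inv[n]≡1 (A>0 k)) ⟩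
      ρ k + fromℕ 6 * v * (1ℚ * u - 1ℚ * u′ + u′)
        ≡⟨ solve 4 (λ r v u u′ → r :+ κ 6 :* v :* (κ 1 :* u :- κ 1 :* u′ :+ u′) := r :+ κ 6 :* v :* u)
             refl (ρ k) v u u′ ⟩
      ρ k + fromℕ 6 * v * u ∎
      where
      open ≤-Reasoning
      i = inv (suc k)
      v = inv (A n)
      u = inv (A k)
      u′ = inv (A (suc k))
      0≤uu′ : 0ℚ ≤ u * u′
      0≤uu′ = 0≤*0≤ (0≤inv (A k)) (0≤inv (A (suc k)))
      i³≤1 : cube i ≤ 1ℚ
      i³≤1 = begin
        i * i * i                         ≡⟨ trans (cong (_* i) (sym (inv-homo-* (suc k) (suc k)))) (sym (inv-homo-* (suc k ℕ.* suc k) (suc k))) ⟩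
        inv (suc k ℕ.* suc k ℕ.* suc k)   ≤⟨ inv≤1 {suc k ℕ.* suc k ℕ.* suc k} ℕ.z<s ⟩
        1ℚ                                ∎
      1≤ : 1ℚ ≤ v * (fromℕ (A (suc k)) - fromℕ (A k))
      1≤ = begin
        1ℚ                     ≡⟨ n*inv[n]≡1 (A>0 n) ⟨
        fromℕ (A n) * v        ≡⟨ *-comm (fromℕ (A n)) v ⟩
        v * fromℕ (A n)        ≤⟨ *-monoˡ-≤-nonNeg v {{nonNegative (0≤inv (A n))}} (begin
          fromℕ (A n)                              ≡⟨ solve 2 (λ a b → a := b :+ a :- b)
               refl (fromℕ (A n)) (fromℕ (A k)) ⟩
          fromℕ (A k) + fromℕ (A n) - fromℕ (A k)  ≡⟨ cong (_- fromℕ (A k)) (fromℕ-homo-+ (A k) (A n)) ⟨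
          fromℕ (A k ℕ.+ A n) - fromℕ (A k)        ≤⟨ +-monoˡ-≤ (- fromℕ (A k)) (fromℕ-mono-≤ A+A≤A) ⟩
          fromℕ (A (suc k)) - fromℕ (A k)          ∎) ⟩
        v * (fromℕ (A (suc k)) - fromℕ (A k)) ∎
      bound : fromℕ 6 * cube i * (u * u′) ≤ fromℕ 6 * (v * (fromℕ (A (suc k)) - fromℕ (A k)) * (u * u′))
      bound = begin
        fromℕ 6 * cube i * (u * u′)   ≡⟨ *-assoc (fromℕ 6) (cube i) (u * u′) ⟩
        fromℕ 6 * (cube i * (u * u′)) ≤⟨ *-monoˡ-≤-nonNeg (fromℕ 6) (*-monoʳ-≤-nonNeg (u * u′) {{nonNegative 0≤uu′}} (≤-trans i³≤1 1≤)) ⟩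
        fromℕ 6 * (v * (fromℕ (A (suc k)) - fromℕ (A k)) * (u * u′)) ∎

    -- For fixed n, `ρ-step≤` makes ρ k + 6/(A n · A k) non-increasing in k ≥ n; the right side is
    -- its value at k = n.
    ρ≤′ : ∀ {d e} → d ℕ.≤′ e → let n = 11 ℕ.+ d ; k = 11 ℕ.+ e in
      ρ k + fromℕ 6 * inv (A n) * inv (A k) ≤ ρ n + fromℕ 6 * inv (A n) * inv (A n)
    ρ≤′ (ℕ.≤′-reflexive refl) = ≤-refl
    ρ≤′ {d} (ℕ.≤′-step {e} d≤e) = ≤-trans (ρ-step≤ {11 ℕ.+ d} {11 ℕ.+ e} (A+A≤A d≤e)) (ρ≤′ d≤e)

    ρ≤ : ∀ {d e} → d ℕ.≤ e → let n = 11 ℕ.+ d in ρ (11 ℕ.+ e) ≤ ρ n + fromℕ 6 * inv (A n) * inv (A n)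
    ρ≤ {d} {e} d≤e = begin
      ρ k                                      ≡⟨ +-identityʳ (ρ k) ⟨
      ρ k + 0ℚ                                 ≤⟨ +-monoʳ-≤ (ρ k) (0≤*0≤ (0≤*0≤ (0≤fromℕ 6) (0≤inv (A n))) (0≤inv (A k))) ⟩
      ρ k + fromℕ 6 * inv (A n) * inv (A k)    ≤⟨ ρ≤′ (ℕ.≤⇒≤′ d≤e) ⟩
      ρ n + fromℕ 6 * inv (A n) * inv (A n)    ∎
      where
      open ≤-Reasoning
      n = 11 ℕ.+ d
      k = 11 ℕ.+ e

    archimedean : ∀ ε → 0ℚ < ε → ∃[ m ] (0 ℕ.< m × inv m ≤ ε)
    archimedean (mkℚ (ℤ.+ zero)    d _) (*<* (ℤ.+<+ ()))
    archimedean (mkℚ ℤ.+[1+ n ]    d _) _ = suc d , ℕ.z<s , *≤* (ℤ.+≤+ (ℕ.*-monoˡ-≤ (suc d) {1} {suc n} (ℕ.s≤s ℕ.z≤n)))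
    archimedean (mkℚ ℤ.-[1+ n ]    d _) (*<* ())

  module _ {q : ℚ} (ζ[3]≈q : ζ 3 ≈ fromℚ q) where

    private
      -- The error splits into ε/2 for ρ k against the partial sum and ε/2 for the partial sum
      -- against q. A single late index is enough, since it will only serve to refute strict
      -- inequalities.
      ρ-close : ∀ ε → 0ℚ < ε → ∀ n → ∃[ k ] (n ℕ.≤ k × ∣ ρ k - q ∣ < ε)
      ρ-close ε 0<ε n =
        let 0<ε/2 = 0<*0< {ε} {inv 2} 0<ε (0<inv {2} ℕ.z<s)
            m , 0<m , inv[m]≤ = archimedean (ε * inv 2) 0<ε/2
            N , close = ζ[3]≈q (ε * inv 2) 0<ε/2
            k = n ℕ.+ (m ℕ.+ N)
            m≤k = ℕ.≤-trans (ℕ.m≤m+n m N) (ℕ.m≤n+m (m ℕ.+ N) n)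
            N≤k = ℕ.≤-trans (ℕ.m≤n+m N m) (ℕ.m≤n+m (m ℕ.+ N) n)
        in k , ℕ.m≤m+n n (m ℕ.+ N) , ∣ρ-q∣< {ε} {k} (≤-trans (∣ρ-ζ₃∣≤inv (ℕ.<-≤-trans 0<m m≤k)) (≤-trans (inv-antimono 0<m m≤k) inv[m]≤)) (close k N≤k)
        where
        open ≤-Reasoning
        ∣ρ-q∣< : ∀ {ε k} → ∣ ρ k - ζ₃ k ∣ ≤ ε * inv 2 → ∣ ζ₃ k - q ∣ < ε * inv 2 → ∣ ρ k - q ∣ < ε
        ∣ρ-q∣< {ε} {k} ρ-close ζ-close = begin-strict
          ∣ ρ k - q ∣
            ≡⟨ cong ∣_∣ (solve 3 (λ r z q → r :- q := (r :- z) :+ (z :- q)) refl (ρ k) (ζ₃ k) q) ⟩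
          ∣ (ρ k - ζ₃ k) + (ζ₃ k - q) ∣
            ≤⟨ ∣p+q∣≤∣p∣+∣q∣ (ρ k - ζ₃ k) (ζ₃ k - q) ⟩
          ∣ ρ k - ζ₃ k ∣ + ∣ ζ₃ k - q ∣
            <⟨ +-mono-≤-< ρ-close ζ-close ⟩
          ε * inv 2 + ε * inv 2
            ≡⟨ solve 2 (λ e h → e :* h :+ e :* h := e :* (κ 2 :* h)) refl ε (inv 2) ⟩
          ε * (fromℕ 2 * inv 2)
            ≡⟨ trans (cong (ε *_) (n*inv[n]≡1 {2} ℕ.z<s)) (*-identityʳ ε) ⟩
          ε ∎

      0<q-p : ∀ {p q} → p < q → 0ℚ < q - p
      0<q-p {p} {q} p<q = subst (_< q - p) (+-inverseʳ p) (+-monoˡ-< (- p) p<q)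

      -- If q < l, an index k ≥ n with |ρ k - q| < l - q would force ρ k < l.
      limit-≥ : ∀ {l} n → (∀ k → n ℕ.≤ k → l ≤ ρ k) → l ≤ q
      limit-≥ {l} n l≤ρ = ≮⇒≥ λ q<l → let k , n≤k , close = ρ-close (l - q) (0<q-p q<l) n in
        <-irrefl refl (≤-<-trans (≤-trans (+-monoˡ-≤ (- q) (l≤ρ k n≤k)) (p≤∣p∣ (ρ k - q))) close)

      limit-≤ : ∀ {l} n → (∀ k → n ℕ.≤ k → ρ k ≤ l) → q ≤ l
      limit-≤ {l} n ρ≤l = ≮⇒≥ λ l<q → let k , n≤k , close = ρ-close (q - l) (0<q-p l<q) n in
        <-irrefl refl (≤-<-trans (begin
          q - l             ≤⟨ +-monoʳ-≤ q (neg-antimono-≤ (ρ≤l k n≤k)) ⟩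
          q - ρ k           ≤⟨ p≤∣p∣ (q - ρ k) ⟩
          ∣ q - ρ k ∣       ≡⟨ cong ∣_∣ (solve 2 (λ q r → q :- r := :- (r :- q)) refl q (ρ k)) ⟩
          ∣ - (ρ k - q) ∣   ≡⟨ ∣-p∣≡∣p∣ (ρ k - q) ⟩
          ∣ ρ k - q ∣       ∎) close)
        where open ≤-Reasoning

    -- Strictness comes from one step of the strictly increasing ρ: ρ n < ρ (n + 1) ≤ q.
    0<aq-b : ∀ n → 0ℚ < a n * q - b n
    0<aq-b n = subst (0ℚ <_) eq (0<*0< 0<a (0<q-p (<-≤-trans (ρ<ρ[1+n] n) (limit-≥ (suc n) (λ k n<k → ρ-mono (ℕ.≤⇒≤′ n<k))))))
      where
      open ≡-Reasoning
      0<a : 0ℚ < a n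
      0<a = subst (0ℚ <_) (fromℕ[A]≡a n) (fromℕ-mono-< (A>0 n))
      eq : a n * (q - ρ n) ≡ a n * q - b n
      eq = begin
        a n * (q - b n * inv (A n))         ≡⟨ solve 4 (λ a q b u → a :* (q :- b :* u) := a :* q :- b :* (a :* u))
             refl (a n) q (b n) (inv (A n)) ⟩
        a n * q - b n * (a n * inv (A n))   ≡⟨ cong (λ e → a n * q - b n * e) (a*inv[A]≡1 n) ⟩
        a n * q - b n * 1ℚ                  ≡⟨ cong (_-_ (a n * q)) (*-identityʳ (b n)) ⟩
        a n * q - b n                       ∎

    aq-b≤6/a : ∀ d → let n = 11 ℕ.+ d in a n * q - b n ≤ fromℕ 6 * inv (A n)
    aq-b≤6/a d = begin
      a n * q - b n
        ≤⟨ +-monoˡ-≤ (- b n) (*-monoˡ-≤-nonNeg (a n) {{nonNegative 0≤a}} (limit-≤ n λ k n≤k → bound k n≤k)) ⟩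
      a n * (b n * u + fromℕ 6 * u * u) - b n
        ≡⟨ solve 3 (λ a b u → a :* (b :* u :+ κ 6 :* u :* u) :- b := b :* (a :* u) :- b :+ κ 6 :* u :* (a :* u))
             refl (a n) (b n) u ⟩
      b n * (a n * u) - b n + fromℕ 6 * u * (a n * u)
        ≡⟨ cong (λ e → b n * e - b n + fromℕ 6 * u * e) (a*inv[A]≡1 n) ⟩
      b n * 1ℚ - b n + fromℕ 6 * u * 1ℚ
        ≡⟨ solve 2 (λ b u → b :* κ 1 :- b :+ κ 6 :* u :* κ 1 := κ 6 :* u) refl (b n) u ⟩
      fromℕ 6 * u ∎
      where
      open ≤-Reasoning
      n = 11 ℕ.+ d
      u = inv (A n)
      0≤a : 0ℚ ≤ a n
      0≤a = subst (0ℚ ≤_) (fromℕ[A]≡a n) (0≤fromℕ (A n))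
      bound : ∀ k → n ℕ.≤ k → ρ k ≤ ρ n + fromℕ 6 * u * u
      bound k n≤k = subst (λ j → ρ j ≤ ρ n + fromℕ 6 * u * u) (ℕ.m+[n∸m]≡n (ℕ.m+n≤o⇒m≤o 11 n≤k))
        (ρ≤ {d} {k ℕ.∸ 11} (ℕ.∸-monoˡ-≤ 11 n≤k))

-- Divisibility by prime powers and Legendre's formula for factorials.

module PrimePowers where

  open import Data.Nat.Base
  open import Data.Nat.Properties
  open import Data.Nat.Divisibility
  open import Data.Nat.DivMod
  open import Data.Nat.Primality
  open import Data.Nat.Primality.Factorisation using (factorise; PrimeFactorisation)
  open import Data.Nat.ListAction using (product)
  open import Data.Nat.Solver using (module +-*-Solver)
  open import Data.List.Base using ([]; _∷_)
  open import Data.List.Relation.Unary.All using (All; []; _∷_)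
  open import Data.Product using (∃-syntax; _×_; _,_)
  open import Data.Sum using (inj₁; inj₂)
  open import Relation.Nullary using (¬_; yes; no; contradiction)
  open import Relation.Binary.PropositionalEquality
  open +-*-Solver using (solve; _:+_; _:*_; _:=_; con)

  p∤m⇒p^e∣m*n⇒p^e∣n : ∀ {p} → Prime p → ∀ {m} → ¬ (p ∣ m) → ∀ e {n} → p ^ e ∣ m * n → p ^ e ∣ n
  p∤m⇒p^e∣m*n⇒p^e∣n pr p∤m zero {n} _ = 1∣ n
  p∤m⇒p^e∣m*n⇒p^e∣n {p} pr {m} p∤m (suc e) {n} p*p^e∣mn with euclidsLemma m n pr (m*n∣⇒m∣ p (p ^ e) p*p^e∣mn)
  ... | inj₁ p∣m = contradiction p∣m p∤m
  ... | inj₂ (divides n′ refl) = subst (p * p ^ e ∣_) (*-comm p n′) (*-monoʳ-∣ p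
    (p∤m⇒p^e∣m*n⇒p^e∣n pr p∤m e (*-cancelˡ-∣ p (subst (p * p ^ e ∣_)
      (solve 3 (λ m n p → m :* (n :* p) := p :* (m :* n)) refl m n′ p) p*p^e∣mn))))
    where instance _ = prime⇒nonZero pr

  prime∣prime⇒≡ : ∀ {p r} → Prime p → Prime r → r ∣ p → r ≡ p
  prime∣prime⇒≡ pr rr r∣p with prime⇒irreducible pr r∣p
  ... | inj₁ refl = contradiction rr ¬prime[1]
  ... | inj₂ r≡p = r≡p

  -- Strip one prime p at a time from a factorisation of d, writing n = n′ p. For the rest, powers
  -- of p are supplied by the hypothesis with exponent raised by one, and powers of another prime
  -- pass from n′ p to n′ by coprimality.
  ∣-byPrimePowers : ∀ {d n} → 0 < d → (∀ p i → Prime p → p ^ i ∣ d → p ^ i ∣ n) → d ∣ n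
  ∣-byPrimePowers {d} 0<d h = subst (_∣ _) (sym (PrimeFactorisation.isFactorisation f))
    (go (PrimeFactorisation.factors f) (PrimeFactorisation.factorsPrime f)
      (subst (λ d → ∀ p i → Prime p → p ^ i ∣ d → p ^ i ∣ _) (PrimeFactorisation.isFactorisation f) h))
    where
    f = factorise d {{>-nonZero 0<d}}
    go : ∀ ps {n} → All Prime ps → (∀ p i → Prime p → p ^ i ∣ product ps → p ^ i ∣ n) → product ps ∣ n
    go [] {n} [] _ = 1∣ n
    go (p ∷ ps) {n} (pr ∷ prs) h with subst (_∣ n) (*-identityʳ p)
                                    (h p 1 pr (subst (_∣ p * product ps) (sym (*-identityʳ p)) (m∣m*n (product ps))))
    ... | divides n′ refl = subst (p * product ps ∣_) (*-comm p n′) (*-monoʳ-∣ p (go ps prs h′))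
      where
      instance _ = prime⇒nonZero pr
      h′ : ∀ r i → Prime r → r ^ i ∣ product ps → r ^ i ∣ n′
      h′ r i rr r^i∣ps with r ≟ p
      ... | yes refl = *-cancelˡ-∣ p (subst (p * p ^ i ∣_) (*-comm n′ p) (h p (suc i) pr (*-monoʳ-∣ p r^i∣ps)))
      ... | no r≢p = p∤m⇒p^e∣m*n⇒p^e∣n rr (λ r∣p → r≢p (prime∣prime⇒≡ pr rr r∣p)) i
                       (subst (r ^ i ∣_) (*-comm n′ p) (h r i rr (∣n⇒∣m*n p r^i∣ps)))

  record HasValuation (p n e : ℕ) : Set where
    constructor hasValuation
    field
      cofactor     : ℕ
      n≡p^e*u      : n ≡ p ^ e * cofactor
      p∤u          : ¬ (p ∣ cofactor)

  valuation-* : ∀ {p} → Prime p → ∀ {m n e f} → HasValuation p m e → HasValuation p n f → HasValuation p (m * n) (e + f)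
  valuation-* {p} pr {e = e} {f} (hasValuation u refl p∤u) (hasValuation v refl p∤v) = hasValuation (u * v) (begin
      p ^ e * u * (p ^ f * v)    ≡⟨ solve 4 (λ a u b v → a :* u :* (b :* v) := a :* b :* (u :* v))
           refl (p ^ e) u (p ^ f) v ⟩
      p ^ e * p ^ f * (u * v)    ≡⟨ cong (_* (u * v)) (^-distribˡ-+-* p e f) ⟨
      p ^ (e + f) * (u * v)      ∎) p∤uv
    where
    open ≡-Reasoning
    p∤uv : ¬ (p ∣ u * v)
    p∤uv p∣uv with euclidsLemma u v pr p∣uv
    ... | inj₁ p∣u = p∤u p∣u
    ... | inj₂ p∣v = p∤v p∣v

  valuation-1 : ∀ {p} → Prime p → HasValuation p 1 0
  valuation-1 {p} pr = hasValuation 1 refl λ p∣1 → ¬prime[1] (subst Prime (∣1⇒≡1 p∣1) pr)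

  valuation : ∀ {p} → Prime p → ∀ {n} → 0 < n → ∃[ e ] HasValuation p n e
  valuation {p} pr {n} 0<n = subst (λ m → ∃[ e ] HasValuation p m e) (sym (PrimeFactorisation.isFactorisation f))
    (go (PrimeFactorisation.factorsPrime f))
    where
    f = factorise n {{>-nonZero 0<n}}
    factor : ∀ {r} → Prime r → ∃[ e ] HasValuation p r e
    factor {r} rr with p ≟ r
    ... | yes refl = 1 , hasValuation 1 (sym (trans (*-identityʳ (p ^ 1)) (*-identityʳ p))) λ p∣1 → ¬prime[1] (subst Prime (∣1⇒≡1 p∣1) pr)
    ... | no p≢r = 0 , hasValuation r (sym (+-identityʳ r)) λ p∣r → p≢r (prime∣prime⇒≡ rr pr p∣r)
    go : ∀ {rs} → All Prime rs → ∃[ e ] HasValuation p (product rs) e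
    go [] = 0 , valuation-1 pr
    go (rr ∷ rrs) = let e , v = factor rr ; f , w = go rrs in e + f , valuation-* pr v w

  private
    ^-monoʳ-∣ : ∀ p {e f} → e ≤ f → p ^ e ∣ p ^ f
    ^-monoʳ-∣ p {e} {f} e≤f with m≤n⇒∃[o]m+o≡n e≤f
    ... | o , refl = subst (p ^ e ∣_) (sym (^-distribˡ-+-* p e o)) (m∣m*n (p ^ o))

    /-unique : ∀ {n d q} .{{_ : NonZero d}} → q * d ≤ n → n < suc q * d → n / d ≡ q
    /-unique {n} {d} {q} qd≤n n<qd = ≤-antisym (s≤s⁻¹ (m<n*o⇒m/o<n n<qd))
      (subst (_≤ n / d) (m*n/n≡m q d) (/-monoˡ-≤ d qd≤n))

    n<[1+n/d]*d : ∀ n d .{{_ : NonZero d}} → n < suc (n / d) * d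
    n<[1+n/d]*d n d = subst (_< suc (n / d) * d) (sym (m≡m%n+[m/n]*n n d)) (+-monoˡ-< (n / d * d) (m%n<n n d))

    [1+n]/d-∣ : ∀ n d .{{_ : NonZero d}} → d ∣ suc n → suc n / d ≡ suc (n / d)
    [1+n]/d-∣ n d@(suc d-1) (divides (suc k) eq) = begin
      suc n / d       ≡⟨ /-congˡ {o = d} eq ⟩
      suc k * d / d   ≡⟨ m*n/n≡m (suc k) d ⟩
      suc k           ≡⟨ cong suc (/-unique {n} {d} {k}
                           (s≤s⁻¹ (≤-trans (s≤s (m≤n+m (k * d) d-1)) (≤-reflexive (sym eq))))
                           (≤-reflexive eq)) ⟨
      suc (n / d)     ∎
      where open ≡-Reasoning

    [1+n]/d-∤ : ∀ n d .{{_ : NonZero d}} → ¬ (d ∣ suc n) → suc n / d ≡ n / d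
    [1+n]/d-∤ n d d∤ = /-unique {suc n} {d} {n / d} (m≤n⇒m≤1+n (m/n*n≤m n d))
      (≤∧≢⇒< (n<[1+n/d]*d n d) λ eq → d∤ (divides (suc (n / d)) eq))

  floor : (p : ℕ) .{{_ : NonZero p}} → ℕ → ℕ → ℕ
  floor p s n = (n / p ^ s) {{m^n≢0 p s}}

  -- Legendre's sum of the floors of n / p^r for 1 ≤ r ≤ s. The cut-off s is a parameter so that the
  -- sums for several factorials can be compared level by level.
  legendre : (p : ℕ) .{{_ : NonZero p}} → ℕ → ℕ → ℕ
  legendre p zero    n = 0
  legendre p (suc s) n = legendre p s n + floor p (suc s) n

  module _ {p : ℕ} (pr : Prime p) where
    private instance
      p≢0 : NonZero p
      p≢0 = prime⇒nonZero pr

    private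
      1<p : 1 < p
      1<p = nonTrivial⇒n>1 p {{prime⇒nonTrivial pr}}

    n<p^n : ∀ n → n < p ^ n
    n<p^n zero    = s≤s z≤n
    n<p^n (suc n) = begin-strict
      suc n           ≤⟨ n<p^n n ⟩
      p ^ n           <⟨ m<m*n (p ^ n) p {{m^n≢0 p n}} 1<p ⟩
      p ^ n * p       ≡⟨ *-comm (p ^ n) p ⟩
      p * p ^ n       ∎
      where open ≤-Reasoning

    private
      floor-suc : ∀ {n e} → HasValuation p (suc n) e → ∀ s →
        (s ≤ e → floor p s (suc n) ≡ suc (floor p s n)) × (e < s → floor p s (suc n) ≡ floor p s n)
      floor-suc {n} {e} (hasValuation u eq p∤u) s = divisible , indivisible
        where
        instance _ = m^n≢0 p s
        divisible : s ≤ e → suc n / p ^ s ≡ suc (n / p ^ s)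
        divisible s≤e = [1+n]/d-∣ n (p ^ s) (subst (p ^ s ∣_) (sym eq) (∣m⇒∣m*n u (^-monoʳ-∣ p s≤e)))
        indivisible : e < s → suc n / p ^ s ≡ n / p ^ s
        indivisible e<s = [1+n]/d-∤ n (p ^ s) λ p^s∣n → p∤u (*-cancelˡ-∣ (p ^ e) {{m^n≢0 p e}}
          (subst₂ _∣_ (*-comm p (p ^ e)) eq (∣-trans (^-monoʳ-∣ p e<s) p^s∣n)))

      -- From n to n + 1 the floor at level r rises by one exactly when p^r divides n + 1, that is
      -- for r ≤ e; of these levels s ⊓ e lie below the cut-off.
      legendre-suc : ∀ {n e} → HasValuation p (suc n) e → ∀ s → legendre p s (suc n) ≡ legendre p s n + s ⊓ e
      legendre-suc v zero = refl
      legendre-suc {n} {e} v (suc s) with suc s ≤? e | floor-suc v (suc s)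
      ... | yes s<e | divisible , _ = begin
        legendre p s (suc n) + floor p (suc s) (suc n)    ≡⟨ cong₂ _+_ (legendre-suc v s) (divisible s<e) ⟩
        legendre p s n + s ⊓ e + suc (floor p (suc s) n)
          ≡⟨ cong (λ k → legendre p s n + k + suc (floor p (suc s) n)) (m≤n⇒m⊓n≡m (<⇒≤ s<e)) ⟩
        legendre p s n + s + suc (floor p (suc s) n)
          ≡⟨ solve 3 (λ l s f → l :+ s :+ (con 1 :+ f) := l :+ f :+ (con 1 :+ s))
               refl (legendre p s n) s (floor p (suc s) n) ⟩
        legendre p s n + floor p (suc s) n + suc s        ≡⟨ cong (legendre p (suc s) n +_) (m≤n⇒m⊓n≡m s<e) ⟨
        legendre p s n + floor p (suc s) n + suc s ⊓ e    ∎
        where open ≡-Reasoning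
      ... | no s≮e | _ , indivisible = begin
        legendre p s (suc n) + floor p (suc s) (suc n)    ≡⟨ cong₂ _+_ (legendre-suc v s) (indivisible (≰⇒> s≮e)) ⟩
        legendre p s n + s ⊓ e + floor p (suc s) n
          ≡⟨ cong (λ k → legendre p s n + k + floor p (suc s) n) (m≥n⇒m⊓n≡n (s≤s⁻¹ (≰⇒> s≮e))) ⟩
        legendre p s n + e + floor p (suc s) n
          ≡⟨ solve 3 (λ l s f → l :+ s :+ f := l :+ f :+ s) refl (legendre p s n) e (floor p (suc s) n) ⟩
        legendre p s n + floor p (suc s) n + e            ≡⟨ cong (legendre p (suc s) n +_) (m≥n⇒m⊓n≡n (<⇒≤ (≰⇒> s≮e))) ⟨
        legendre p s n + floor p (suc s) n + suc s ⊓ e    ∎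
        where open ≡-Reasoning

      legendre-0 : ∀ s → legendre p s 0 ≡ 0
      legendre-0 zero    = refl
      legendre-0 (suc s) = cong₂ _+_ (legendre-0 s) (0/n≡0 (p ^ suc s) {{m^n≢0 p (suc s)}})

    -- The cut-off s ≥ n loses nothing: the exponent e of p in a factor m ≤ n satisfies e < p^e ≤ m
    -- ≤ s.
    valuation-! : ∀ s n → n ≤ s → HasValuation p (n !) (legendre p s n)
    valuation-! s zero    _   = subst (HasValuation p 1) (sym (legendre-0 s)) (valuation-1 pr)
    valuation-! s (suc n) n<s with valuation pr {suc n} (s≤s z≤n)
    ... | e , v@(hasValuation u eq p∤u) = subst (HasValuation p (suc n !)) (begin
        e + legendre p s n        ≡⟨ +-comm e _ ⟩
        legendre p s n + e        ≡⟨ cong (legendre p s n +_) (m≥n⇒m⊓n≡n (≤-trans (s≤s⁻¹ e<1+n) (<⇒≤ n<s))) ⟨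
        legendre p s n + s ⊓ e    ≡⟨ legendre-suc v s ⟨
        legendre p s (suc n)      ∎)
      (valuation-* pr v (valuation-! s n (<⇒≤ n<s)))
      where
      open ≡-Reasoning
      e<1+n : e < suc n
      e<1+n = <-≤-trans (n<p^n e) (subst (p ^ e ≤_) (sym eq) (m≤m*n (p ^ e) u {{≢-nonZero λ { refl → p∤u (p ∣0) }}}))

-- Chebyshev-type construction of small common multiples of 1, ..., 42^j.

module CommonMultiples where

  open import Data.Nat.Base
  open import Data.Nat.Properties
  open import Data.Nat.Combinatorics
  open import Data.Nat.Divisibility
  open import Data.Nat.DivMod
  open import Data.Nat.Primality
  open import Data.Nat.Solver using (module +-*-Solver)
  open import Data.Product using (∃-syntax; _×_; _,_)
  open import Data.Unit using (tt)
  open import Relation.Nullary using (yes; no; contradiction)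
  open import Relation.Binary.PropositionalEquality
  open Binomial
  open PrimePowers
  open +-*-Solver using (solve; _:+_; _:*_; _:=_; con)

  [m+n]Cm*[m!*n!]≡[m+n]! : ∀ m n → ((m + n) C m) * (m ! * n !) ≡ (m + n) !
  [m+n]Cm*[m!*n!]≡[m+n]! m n = begin
    ((m + n) C m) * (m ! * n !)
      ≡⟨ cong (λ j → ((m + n) C m) * (m ! * j !)) (m+n∸m≡n m n) ⟨
    ((m + n) C m) * (m ! * (m + n ∸ m) !)
      ≡⟨ cong (_* (m ! * (m + n ∸ m) !)) (nCk≡n!/k![n-k]! (m≤m+n m n)) ⟩
    (m + n) ! / (m ! * (m + n ∸ m) !) * (m ! * (m + n ∸ m) !)
      ≡⟨ m/n*n≡m (k![n∸k]!∣n! (m≤m+n m n)) ⟩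
    (m + n) ! ∎
    where
    open ≡-Reasoning
    instance _ = m !* (m + n ∸ m) !≢0

  -- A single term of the binomial expansion, followed through Pascal's rule. For x : y = k : (n -
  -- k) it yields the exact exponential growth rate of C(n,k).
  nCk*x^k*y^[n∸k]≤[x+y]^n : ∀ x y n k → (n C k) * (x ^ k * y ^ (n ∸ k)) ≤ (x + y) ^ n
  nCk*x^k*y^[n∸k]≤[x+y]^n x y zero zero = ≤-refl
  nCk*x^k*y^[n∸k]≤[x+y]^n x y zero (suc k) = subst (λ c → c * (x ^ suc k * 1) ≤ 1) (sym (k>n⇒nCk≡0 {0} {suc k} (s≤s z≤n))) z≤n
  nCk*x^k*y^[n∸k]≤[x+y]^n x y (suc n) zero = ≤-trans (≤-reflexive (trans (*-identityˡ _) (*-identityˡ _))) (^-monoˡ-≤ (suc n) (m≤n+m y x))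
  nCk*x^k*y^[n∸k]≤[x+y]^n x y (suc n) (suc k) = begin
    (suc n C suc k) * (x * x ^ k * y ^ (n ∸ k))
      ≡⟨ cong (_* (x * x ^ k * y ^ (n ∸ k))) (nCk+nC[k+1]≡[n+1]C[k+1] n k) ⟨
    (n C k + n C suc k) * (x * x ^ k * y ^ (n ∸ k))
      ≡⟨ solve 5 (λ c d x u v → (c :+ d) :* (x :* u :* v) := x :* (c :* (u :* v)) :+ d :* (x :* u :* v))
           refl (n C k) (n C suc k) x (x ^ k) (y ^ (n ∸ k)) ⟩
    x * ((n C k) * (x ^ k * y ^ (n ∸ k))) + (n C suc k) * (x ^ suc k * y ^ (n ∸ k))
      ≤⟨ +-mono-≤ (*-monoʳ-≤ x (nCk*x^k*y^[n∸k]≤[x+y]^n x y n k)) next ⟩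
    x * (x + y) ^ n + y * (x + y) ^ n
      ≡⟨ *-distribʳ-+ ((x + y) ^ n) x y ⟨
    (x + y) * (x + y) ^ n ∎
    where
    open ≤-Reasoning
    next : (n C suc k) * (x ^ suc k * y ^ (n ∸ k)) ≤ y * (x + y) ^ n
    next with suc k ≤? n
    ... | no k≮n = subst (λ c → c * (x ^ suc k * y ^ (n ∸ k)) ≤ y * (x + y) ^ n) (sym (k>n⇒nCk≡0 (≰⇒> k≮n))) z≤n
    ... | yes k<n = begin
      (n C suc k) * (x ^ suc k * y ^ (n ∸ k))
        ≡⟨ cong (λ j → (n C suc k) * (x ^ suc k * y ^ j)) (+-∸-assoc 1 k<n) ⟩
      (n C suc k) * (x ^ suc k * (y * y ^ (n ∸ suc k)))
        ≡⟨ solve 4 (λ c u y v → c :* (u :* (y :* v)) := y :* (c :* (u :* v)))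
             refl (n C suc k) (x ^ suc k) y (y ^ (n ∸ suc k)) ⟩
      y * ((n C suc k) * (x ^ suc k * y ^ (n ∸ suc k)))
        ≤⟨ *-monoʳ-≤ y (nCk*x^k*y^[n∸k]≤[x+y]^n x y n (suc k)) ⟩
      y * (x + y) ^ n ∎

  -- (42 m)! / ((21 m)! (14 m)! (6 m)! m!), where 1/2 + 1/3 + 1/7 + 1/42 = 1.
  multinomial : ℕ → ℕ
  multinomial m = ((42 * m) C (21 * m)) * (((21 * m) C (14 * m)) * ((7 * m) C (6 * m)))

  private
    split-! : ∀ a b m → (((a + b) * m) C (a * m)) * ((a * m) ! * (b * m) !) ≡ ((a + b) * m) !
    split-! a b m = subst (λ n → (n C (a * m)) * ((a * m) ! * (b * m) !) ≡ n !) (sym (*-distribʳ-+ m a b))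
      ([m+n]Cm*[m!*n!]≡[m+n]! (a * m) (b * m))

  multinomial-! : ∀ m → (21 * m) ! * ((14 * m) ! * ((6 * m) ! * m !)) * multinomial m ≡ (42 * m) !
  multinomial-! m = begin
    (21 * m) ! * ((14 * m) ! * ((6 * m) ! * m !)) * multinomial m
      ≡⟨ solve 7 (λ a b c d u v w → a :* (b :* (c :* d)) :* (u :* (v :* w)) :=
           u :* (a :* (v :* (b :* (w :* (c :* d)))))) refl
           ((21 * m) !) ((14 * m) !) ((6 * m) !) (m !) ((42 * m) C (21 * m)) ((21 * m) C (14 * m)) ((7 * m) C (6 * m)) ⟩
    ((42 * m) C (21 * m)) * ((21 * m) ! * (((21 * m) C (14 * m)) * ((14 * m) ! * (((7 * m) C (6 * m)) * ((6 * m) ! * m !)))))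
      ≡⟨ cong (λ u → ((42 * m) C (21 * m)) * ((21 * m) ! * (((21 * m) C (14 * m)) * ((14 * m) ! * u))))
           (trans (cong (λ n → ((7 * m) C (6 * m)) * ((6 * m) ! * n !)) (sym (*-identityˡ m))) (split-! 6 1 m)) ⟩
    ((42 * m) C (21 * m)) * ((21 * m) ! * (((21 * m) C (14 * m)) * ((14 * m) ! * (7 * m) !)))
      ≡⟨ cong (λ u → ((42 * m) C (21 * m)) * ((21 * m) ! * u)) (split-! 14 7 m) ⟩
    ((42 * m) C (21 * m)) * ((21 * m) ! * (21 * m) !)
      ≡⟨ split-! 21 21 m ⟩
    (42 * m) ! ∎
    where open ≡-Reasoning

  private
    module _ (d : ℕ) .{{_ : NonZero d}} where

      k*[n/d]≤[k*n]/d : ∀ k n → k * (n / d) ≤ (k * n) / d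
      k*[n/d]≤[k*n]/d k n = subst (_≤ (k * n) / d) (m*n/n≡m (k * (n / d)) d)
        (/-monoˡ-≤ d (≤-trans (≤-reflexive (*-assoc k (n / d) d)) (*-monoʳ-≤ k (m/n*n≤m n d))))

      [m/d]+[n/d]≤[m+n]/d : ∀ m n → m / d + n / d ≤ (m + n) / d
      [m/d]+[n/d]≤[m+n]/d m n = subst (_≤ (m + n) / d) (m*n/n≡m (m / d + n / d) d)
        (/-monoˡ-≤ d (≤-trans (≤-reflexive (*-distribʳ-+ d (m / d) (n / d))) (+-mono-≤ (m/n*n≤m m d) (m/n*n≤m n d))))

      floors-≤ : ∀ m → (21 * m) / d + ((14 * m) / d + ((6 * m) / d + m / d)) ≤ (42 * m) / d
      floors-≤ m = begin
        (21 * m) / d + ((14 * m) / d + ((6 * m) / d + m / d))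
          ≤⟨ +-monoʳ-≤ ((21 * m) / d) (+-monoʳ-≤ ((14 * m) / d) ([m/d]+[n/d]≤[m+n]/d (6 * m) m)) ⟩
        (21 * m) / d + ((14 * m) / d + (6 * m + m) / d)
          ≤⟨ +-monoʳ-≤ ((21 * m) / d) ([m/d]+[n/d]≤[m+n]/d (14 * m) (6 * m + m)) ⟩
        (21 * m) / d + (14 * m + (6 * m + m)) / d
          ≤⟨ [m/d]+[n/d]≤[m+n]/d (21 * m) (14 * m + (6 * m + m)) ⟩
        (21 * m + (14 * m + (6 * m + m))) / d
          ≡⟨ /-congˡ {o = d} (solve 1 (λ m → con 21 :* m :+ (con 14 :* m :+ (con 6 :* m :+ m)) := con 42 :* m) refl m) ⟩
        (42 * m) / d ∎
        where open ≤-Reasoning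

      -- For m < d ≤ 42 m the last floor vanishes while 1/2 + 1/3 + 1/7 = 41/42 < 1.
      floors-< : ∀ m → m < d → d ≤ 42 * m → (21 * m) / d + ((14 * m) / d + ((6 * m) / d + m / d)) < (42 * m) / d
      floors-< m m<d d≤42m = *-cancelˡ-< 42 _ _ (begin-strict
        42 * (a + (b + (c + m / d)))
          ≡⟨ cong (λ e → 42 * (a + (b + (c + e)))) (m<n⇒m/n≡0 m<d) ⟩
        42 * (a + (b + (c + 0)))
          ≡⟨ solve 3 (λ a b c → con 42 :* (a :+ (b :+ (c :+ con 0))) :=
               con 21 :* (con 2 :* a) :+ con 14 :* (con 3 :* b) :+ con 6 :* (con 7 :* c)) refl a b c ⟩
        21 * (2 * a) + 14 * (3 * b) + 6 * (7 * c)
          ≤⟨ +-mono-≤ (+-mono-≤ (*-monoʳ-≤ 21 (part 2 21)) (*-monoʳ-≤ 14 (part 3 14))) (*-monoʳ-≤ 6 (part 7 6)) ⟩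
        21 * q + 14 * q + 6 * q
          ≡⟨ solve 1 (λ q → con 21 :* q :+ con 14 :* q :+ con 6 :* q := con 41 :* q) refl q ⟩
        41 * q
          <⟨ *-monoˡ-< q {{>-nonZero (m≥n⇒m/n>0 d≤42m)}} (≤-refl {42}) ⟩
        42 * q ∎)
        where
        open ≤-Reasoning
        a = (21 * m) / d
        b = (14 * m) / d
        c = (6 * m) / d
        q = (42 * m) / d
        part : ∀ k l → k * ((l * m) / d) ≤ (k * l * m) / d
        part k l = ≤-trans (k*[n/d]≤[k*n]/d k (l * m)) (≤-reflexive (/-congˡ {o = d} (sym (*-assoc k l m))))

  module _ {p : ℕ} (pr : Prime p) where
    private instance
      p≢0 : NonZero p
      p≢0 = prime⇒nonZero pr

    private
      legendre₄ : ℕ → ℕ → ℕ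
      legendre₄ s m = legendre p s (21 * m) + (legendre p s (14 * m) + (legendre p s (6 * m) + legendre p s m))

      -- At every level `floors-≤` gives an inequality, and at the levels r with j < r ≤ i, where m
      -- < p^r ≤ 42 m, `floors-<` gives a surplus of one. The term s ⊓ i ∸ j counts such levels up
      -- to s.
      legendre-gap : ∀ m i j → p ^ i ≤ 42 * m → m < p ^ suc j → ∀ s →
        legendre₄ s m + (s ⊓ i ∸ j) ≤ legendre p s (42 * m)
      legendre-gap m i j p^i≤ m< zero = ≤-reflexive (0∸n≡0 j)
      legendre-gap m i j p^i≤ m< (suc s) = begin
        legendre₄ (suc s) m + (suc s ⊓ i ∸ j)
          ≡⟨ solve 9 (λ a a′ b b′ c c′ d d′ e → a :+ a′ :+ (b :+ b′ :+ (c :+ c′ :+ (d :+ d′))) :+ e :=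
               a :+ (b :+ (c :+ d)) :+ (a′ :+ (b′ :+ (c′ :+ d′)) :+ e)) refl
               (legendre p s (21 * m)) (floor p (suc s) (21 * m)) (legendre p s (14 * m)) (floor p (suc s) (14 * m))
               (legendre p s (6 * m)) (floor p (suc s) (6 * m)) (legendre p s m) (floor p (suc s) m) (suc s ⊓ i ∸ j) ⟩
        legendre₄ s m + (F + (suc s ⊓ i ∸ j))
          ≤⟨ +-monoʳ-≤ (legendre₄ s m) gap ⟩
        legendre₄ s m + ((s ⊓ i ∸ j) + floor p (suc s) (42 * m))
          ≡⟨ +-assoc (legendre₄ s m) (s ⊓ i ∸ j) (floor p (suc s) (42 * m)) ⟨
        legendre₄ s m + (s ⊓ i ∸ j) + floor p (suc s) (42 * m)
          ≤⟨ +-monoˡ-≤ (floor p (suc s) (42 * m)) (legendre-gap m i j p^i≤ m< s) ⟩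
        legendre p s (42 * m) + floor p (suc s) (42 * m) ∎
        where
        open ≤-Reasoning
        instance _ = m^n≢0 p (suc s)
        F = floor p (suc s) (21 * m) + (floor p (suc s) (14 * m) + (floor p (suc s) (6 * m) + floor p (suc s) m))
        gap : F + (suc s ⊓ i ∸ j) ≤ (s ⊓ i ∸ j) + floor p (suc s) (42 * m)
        gap with suc s ≤? i | suc j ≤? suc s
        ... | no s≮i | _ = begin
          F + (suc s ⊓ i ∸ j)  ≡⟨ cong (λ k → F + (k ∸ j)) (trans (m≥n⇒m⊓n≡n (<⇒≤ (≰⇒> s≮i))) (sym (m≥n⇒m⊓n≡n (s≤s⁻¹ (≰⇒> s≮i))))) ⟩
          F + (s ⊓ i ∸ j)      ≡⟨ +-comm F (s ⊓ i ∸ j) ⟩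
          (s ⊓ i ∸ j) + F      ≤⟨ +-monoʳ-≤ (s ⊓ i ∸ j) (floors-≤ (p ^ suc s) m) ⟩
          (s ⊓ i ∸ j) + floor p (suc s) (42 * m) ∎
        ... | yes s<i | yes (s≤s j≤s) = begin
          F + (suc s ⊓ i ∸ j)  ≡⟨ cong (λ k → F + (k ∸ j)) (m≤n⇒m⊓n≡m s<i) ⟩
          F + (suc s ∸ j)      ≡⟨ cong (F +_) (+-∸-assoc 1 j≤s) ⟩
          F + suc (s ∸ j)      ≡⟨ solve 2 (λ f k → f :+ (con 1 :+ k) := k :+ (con 1 :+ f)) refl F (s ∸ j) ⟩
          (s ∸ j) + suc F      ≤⟨ +-monoʳ-≤ (s ∸ j) (floors-< (p ^ suc s) m (<-≤-trans m< (^-monoʳ-≤ p (s≤s j≤s))) (≤-trans (^-monoʳ-≤ p s<i) p^i≤)) ⟩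
          (s ∸ j) + floor p (suc s) (42 * m) ≡⟨ cong (λ k → (k ∸ j) + floor p (suc s) (42 * m)) (m≤n⇒m⊓n≡m (<⇒≤ s<i)) ⟨
          (s ⊓ i ∸ j) + floor p (suc s) (42 * m) ∎
        ... | yes s<i | no j≮s = begin
          F + (suc s ⊓ i ∸ j)  ≡⟨ cong (λ k → F + (k ∸ j)) (m≤n⇒m⊓n≡m s<i) ⟩
          F + (suc s ∸ j)      ≡⟨ cong (F +_) (m≤n⇒m∸n≡0 (s≤s⁻¹ (≰⇒> j≮s))) ⟩
          F + 0                ≡⟨ +-identityʳ F ⟩
          F                    ≤⟨ floors-≤ (p ^ suc s) m ⟩
          floor p (suc s) (42 * m) ≤⟨ m≤n+m _ (s ⊓ i ∸ j) ⟩
          (s ⊓ i ∸ j) + floor p (suc s) (42 * m) ∎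

    -- All five factorials are measured with the cut-off s = 42 m, which exceeds i because i < p^i.
    -- The surplus of `legendre-gap` leaves p^(i-j) in w · multinomial m, where w is the part of the
    -- denominator prime to p, and w drops out.
    primePower∣multinomial : ∀ m i j → p ^ i ≤ 42 * m → m < p ^ suc j → p ^ (i ∸ j) ∣ multinomial m
    primePower∣multinomial m i j p^i≤ m< with
      valuation-* pr (valuation-! pr s (21 * m) (*-monoˡ-≤ m (≤ᵇ⇒≤ 21 42 tt)))
        (valuation-* pr (valuation-! pr s (14 * m) (*-monoˡ-≤ m (≤ᵇ⇒≤ 14 42 tt)))
          (valuation-* pr (valuation-! pr s (6 * m) (*-monoˡ-≤ m (≤ᵇ⇒≤ 6 42 tt)))
            (valuation-! pr s m (m≤m+n m (41 * m)))))
      | valuation-! pr s (42 * m) ≤-refl | m≤n⇒∃[o]m+o≡n (legendre-gap m i j p^i≤ m< s)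
      where s = 42 * m
    ... | hasValuation w eq p∤w | hasValuation u eq′ _ | o , eq″ = p∤m⇒p^e∣m*n⇒p^e∣n pr p∤w (i ∸ j)
      (∣-trans p^[i∸j]∣ (divides (p ^ o * u) (*-cancelˡ-≡ _ _ (p ^ L) {{m^n≢0 p L}} (begin
        p ^ L * (w * multinomial m)         ≡⟨ *-assoc (p ^ L) w (multinomial m) ⟨
        p ^ L * w * multinomial m           ≡⟨ cong (_* multinomial m) eq ⟨
        (21 * m) ! * ((14 * m) ! * ((6 * m) ! * m !)) * multinomial m ≡⟨ multinomial-! m ⟩
        (42 * m) !                          ≡⟨ eq′ ⟩
        p ^ legendre p s (42 * m) * u       ≡⟨ cong (λ k → p ^ k * u) eq″ ⟨
        p ^ (L + (s ⊓ i ∸ j) + o) * u       ≡⟨ cong (_* u) (trans (^-distribˡ-+-* p (L + (s ⊓ i ∸ j)) o) (cong (_* p ^ o) (^-distribˡ-+-* p L (s ⊓ i ∸ j)))) ⟩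
        p ^ L * p ^ (s ⊓ i ∸ j) * p ^ o * u ≡⟨ solve 4 (λ l k o u → l :* k :* o :* u := l :* (o :* u :* k))
             refl (p ^ L) (p ^ (s ⊓ i ∸ j)) (p ^ o) u ⟩
        p ^ L * (p ^ o * u * p ^ (s ⊓ i ∸ j)) ∎))))
      where
      open ≡-Reasoning
      s = 42 * m
      L = legendre₄ s m
      p^[i∸j]∣ : p ^ (i ∸ j) ∣ p ^ (s ⊓ i ∸ j)
      p^[i∸j]∣ = ∣-reflexive (cong (λ k → p ^ (k ∸ j)) (sym (m≥n⇒m⊓n≡n (≤-trans (<⇒≤ (n<p^n pr i)) p^i≤))))

  CommonMultiple : ℕ → ℕ → Set
  CommonMultiple n D = ∀ d → 0 < d → d ≤ n → d ∣ D

  private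
    bracket : ∀ p m i → 0 < m → m < p ^ i → ∃[ j ] (p ^ j ≤ m × m < p ^ suc j × j < i)
    bracket p m zero    0<m m<1 = contradiction 0<m (<⇒≱ m<1)
    bracket p m (suc i) 0<m m< with m <? p ^ i
    ... | no m≮p^i = i , ≮⇒≥ m≮p^i , m< , ≤-refl
    ... | yes m<p^i = let j , p^j≤m , m<p^j , j<i = bracket p m i 0<m m<p^i in j , p^j≤m , m<p^j , m<n⇒m<1+n j<i

  -- Only prime powers p^i dividing some d ≤ 42 m matter. If p^i > m, choose p^j ≤ m < p^(j+1): then
  -- p^j divides D, and the missing p^(i-j) divides the multinomial coefficient.
  commonMultiple-step : ∀ {m D} → 0 < m → CommonMultiple m D → CommonMultiple (42 * m) (multinomial m * D)
  commonMultiple-step {m} {D} 0<m cm d 0<d d≤42m = ∣-byPrimePowers 0<d power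
    where
    power : ∀ p i → Prime p → p ^ i ∣ d → p ^ i ∣ multinomial m * D
    power p i pr p^i∣d with p ^ i ≤? m
    ... | yes p^i≤m = ∣n⇒∣m*n (multinomial m) (cm (p ^ i) (m^n>0 p {{prime⇒nonZero pr}} i) p^i≤m)
    ... | no p^i≰m with bracket p m i 0<m (≰⇒> p^i≰m)
    ...   | j , p^j≤m , m<p^j , j<i = subst (_∣ multinomial m * D)
              (trans (sym (^-distribˡ-+-* p (i ∸ j) j)) (cong (p ^_) (m∸n+n≡m (<⇒≤ j<i))))
              (*-pres-∣ (primePower∣multinomial pr m i j (≤-trans (∣⇒≤ {{>-nonZero 0<d}} p^i∣d) d≤42m) m<p^j)
                        (cm (p ^ j) (m^n>0 p {{prime⇒nonZero pr}} j) p^j≤m))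

  multiple : ℕ → ℕ
  multiple zero    = 1
  multiple (suc j) = multinomial (42 ^ j) * multiple j

  multiple-common : ∀ j → CommonMultiple (42 ^ j) (multiple j)
  multiple-common zero    d 0<d d≤1 = ∣-reflexive (≤-antisym d≤1 0<d)
  multiple-common (suc j) = commonMultiple-step (m^n>0 42 j) (multiple-common j)

  -- num / den = 42^42 / (21^21 · 14^14 · 6^6), the exponential growth rate of multinomial.
  num den : ℕ
  num = 2 ^ 42 * (3 ^ 21 * 7 ^ 7)
  den = 2 ^ 14 * 6 ^ 6

  private
    binomial-≤ : ∀ x y k l m → (((k + l) * m) C (k * m)) * ((x ^ k) ^ m * (y ^ l) ^ m) ≤ ((x + y) ^ (k + l)) ^ m
    binomial-≤ x y k l m = begin
      (((k + l) * m) C (k * m)) * ((x ^ k) ^ m * (y ^ l) ^ m)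
        ≡⟨ cong₂ (λ u v → (((k + l) * m) C (k * m)) * (u * v)) (^-*-assoc x k m) (^-*-assoc y l m) ⟩
      (((k + l) * m) C (k * m)) * (x ^ (k * m) * y ^ (l * m))
        ≡⟨ cong (λ j → (((k + l) * m) C (k * m)) * (x ^ (k * m) * y ^ j))
             (sym (trans (cong (_∸ k * m) (*-distribʳ-+ m k l)) (m+n∸m≡n (k * m) (l * m)))) ⟩
      (((k + l) * m) C (k * m)) * (x ^ (k * m) * y ^ ((k + l) * m ∸ k * m))
        ≤⟨ nCk*x^k*y^[n∸k]≤[x+y]^n x y ((k + l) * m) (k * m) ⟩
      (x + y) ^ ((k + l) * m)
        ≡⟨ ^-*-assoc (x + y) (k + l) m ⟨
      ((x + y) ^ (k + l)) ^ m ∎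
      where open ≤-Reasoning

  ^-distribʳ-* : ∀ x y m → (x * y) ^ m ≡ x ^ m * y ^ m
  ^-distribʳ-* x y zero    = refl
  ^-distribʳ-* x y (suc m) = begin
    x * y * (x * y) ^ m         ≡⟨ cong (x * y *_) (^-distribʳ-* x y m) ⟩
    x * y * (x ^ m * y ^ m)     ≡⟨ solve 4 (λ x y u v → x :* y :* (u :* v) := x :* u :* (y :* v))
         refl x y (x ^ m) (y ^ m) ⟩
    x * x ^ m * (y * y ^ m)     ∎
    where open ≡-Reasoning

  multinomial-≤ : ∀ m → multinomial m * den ^ m ≤ num ^ m
  multinomial-≤ m = begin
    multinomial m * den ^ m
      ≡⟨ cong (multinomial m *_) (^-distribʳ-* (2 ^ 14) (6 ^ 6) m) ⟩
    u * (v * w) * (x * y)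
      ≡⟨ solve 5 (λ u v w x y → u :* (v :* w) :* (x :* y) :=
           u :* (con 1 :* con 1) :* (v :* (x :* con 1) :* (w :* (y :* con 1)))) refl u v w x y ⟩
    u * (1 * 1) * (v * (x * 1) * (w * (y * 1)))
      ≡⟨ cong (λ e → u * (e * e) * (v * (x * e) * (w * (y * e)))) (^-zeroˡ m) ⟨
    u * (1 ^ m * 1 ^ m) * (v * (x * 1 ^ m) * (w * (y * 1 ^ m)))
      -- The weights 1 : 1, 2 : 1 and 6 : 1 are the proportions 21 : 21, 14 : 7 and 6 : 1 of the
      -- three binomials, which makes the bounds sharp up to subexponential factors.
      ≤⟨ *-mono-≤ (binomial-≤ 1 1 21 21 m) (*-mono-≤ (binomial-≤ 2 1 14 7 m) (binomial-≤ 6 1 6 1 m)) ⟩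
    (2 ^ 42) ^ m * ((3 ^ 21) ^ m * (7 ^ 7) ^ m)
      ≡⟨ trans (^-distribʳ-* (2 ^ 42) (3 ^ 21 * 7 ^ 7) m) (cong ((2 ^ 42) ^ m *_) (^-distribʳ-* (3 ^ 21) (7 ^ 7) m)) ⟨
    num ^ m ∎
    where
    open ≤-Reasoning
    u = (42 * m) C (21 * m)
    v = (21 * m) C (14 * m)
    w = (7 * m) C (6 * m)
    x = (2 ^ 14) ^ m
    y = (6 ^ 6) ^ m

  -- The sum of the arguments 42^i, i < j, of the multinomials in `multiple j`, equal to (42^j -
  -- 1)/41. The 41 here is the reason for comparing with 29^41.
  exponent : ℕ → ℕ
  exponent zero    = 0
  exponent (suc j) = 42 ^ j + exponent j

  42^j≡41*exponent+1 : ∀ j → 42 ^ j ≡ 41 * exponent j + 1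
  42^j≡41*exponent+1 zero    = refl
  42^j≡41*exponent+1 (suc j) = begin
    42 * 42 ^ j                     ≡⟨ *-distribʳ-+ (42 ^ j) 41 1 ⟩
    41 * 42 ^ j + 1 * 42 ^ j        ≡⟨ cong (λ k → 41 * 42 ^ j + 1 * k) (42^j≡41*exponent+1 j) ⟩
    41 * 42 ^ j + 1 * (41 * exponent j + 1) ≡⟨ solve 2 (λ u v → con 41 :* u :+ con 1 :* (con 41 :* v :+ con 1) :=
         con 41 :* (u :+ v) :+ con 1) refl (42 ^ j) (exponent j) ⟩
    41 * (42 ^ j + exponent j) + 1         ∎
    where open ≡-Reasoning

  j≤exponent : ∀ j → j ≤ exponent j
  j≤exponent zero    = z≤n
  j≤exponent (suc j) = +-mono-≤ (m^n>0 42 j) (j≤exponent j)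

  multiple-≤ : ∀ j → multiple j * den ^ exponent j ≤ num ^ exponent j
  multiple-≤ zero    = ≤-refl
  multiple-≤ (suc j) = begin
    multinomial n * multiple j * den ^ (n + exponent j)
      ≡⟨ cong (multinomial n * multiple j *_) (^-distribˡ-+-* den n (exponent j)) ⟩
    multinomial n * multiple j * (den ^ n * den ^ exponent j)
      ≡⟨ solve 4 (λ a b u v → a :* b :* (u :* v) := a :* u :* (b :* v))
           refl (multinomial n) (multiple j) (den ^ n) (den ^ exponent j) ⟩
    multinomial n * den ^ n * (multiple j * den ^ exponent j)
      ≤⟨ *-mono-≤ (multinomial-≤ n) (multiple-≤ j) ⟩
    num ^ n * num ^ exponent j
      ≡⟨ ^-distribˡ-+-* num n (exponent j) ⟨
    num ^ (n + exponent j) ∎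
    where
    open ≤-Reasoning
    n = 42 ^ j

  multiple>0 : ∀ j → 0 < multiple j
  multiple>0 zero    = s≤s z≤n
  multiple>0 (suc j) = *-mono-≤ (*-mono-≤ (k≤n⇒nCk>0 (*-monoˡ-≤ m (≤ᵇ⇒≤ 21 42 tt)))
    (*-mono-≤ (k≤n⇒nCk>0 (*-monoˡ-≤ m (≤ᵇ⇒≤ 14 21 tt))) (k≤n⇒nCk>0 (*-monoˡ-≤ m (≤ᵇ⇒≤ 6 7 tt))))) (multiple>0 j)
    where m = 42 ^ j

-- Binomial denominators cleared by common multiples.

module LeibnizTriangle where

  open import Data.Nat.Base
  open import Data.Nat.Properties
  open import Data.Nat.Combinatorics
  open import Data.Nat.Divisibility
  open import Data.Nat.Solver using (module +-*-Solver)
  open import Data.Product using (_,_)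
  open import Relation.Binary.PropositionalEquality
  open Binomial
  open CommonMultiples
  open +-*-Solver using (solve; _:+_; _:*_; _:=_; con)

  -- Leibniz's harmonic triangle: 1 / (k · C(n,k)) is an integer combination of 1/1, …, 1/n.
  [1+k]*nC[1+k]∣commonMultiple : ∀ k {n D} → k < n → CommonMultiple n D → suc k * (n C suc k) ∣ D
  [1+k]*nC[1+k]∣commonMultiple zero {n} {D} 0<n cm =
    subst (_∣ D) (sym (trans (*-identityˡ (n C 1)) (nC1≡n n))) (cm n 0<n ≤-refl)
  [1+k]*nC[1+k]∣commonMultiple (suc k) {suc n} {D} (s≤s k<n) cm
    with [1+k]*nC[1+k]∣commonMultiple k k<n (λ d 0<d d≤n → cm d 0<d (m≤n⇒m≤1+n d≤n))
       | [1+k]*nC[1+k]∣commonMultiple k (m<n⇒m<1+n k<n) cm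
  -- With L(n,k) = 1/(k C(n,k)) the triangle satisfies L(n+1,k+2) = L(n,k+1) - L(n+1,k+1). Here x
  -- and y are D times the two terms on the right, so the new quotient is their difference.
  ... | divides x D≡x | divides y D≡y = divides (x ∸ y) (begin
    D                                       ≡⟨ D≡y ⟩
    y * (suc k * (suc n C suc k))           ≡⟨ cong (y *_) ([1+k]*[1+n]C[1+k]≡[1+n]*nCk n k) ⟩
    y * (suc n * c)                         ≡⟨ solve 3 (λ y n c → y :* (n :* c) := n :* (y :* c)) refl y (suc n) c ⟩
    suc n * (y * c)                         ≡⟨ cong (suc n *_) (m+n∸n≡m (y * c) (y * c′)) ⟨
    suc n * (y * c + y * c′ ∸ y * c′)       ≡⟨ cong (λ u → suc n * (u ∸ y * c′)) yc+yc′≡xc′ ⟩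
    suc n * (x * c′ ∸ y * c′)               ≡⟨ cong (suc n *_) (*-distribʳ-∸ c′ x y) ⟨
    suc n * ((x ∸ y) * c′)                  ≡⟨ solve 3 (λ n d c → n :* (d :* c) := d :* (n :* c))
         refl (suc n) (x ∸ y) c′ ⟩
    (x ∸ y) * (suc n * c′)                  ≡⟨ cong ((x ∸ y) *_) ([1+k]*[1+n]C[1+k]≡[1+n]*nCk n (suc k)) ⟨
    (x ∸ y) * (suc (suc k) * (suc n C suc (suc k))) ∎)
    where
    open ≡-Reasoning
    c  = n C k
    c′ = n C suc k
    yc+yc′≡xc′ : y * c + y * c′ ≡ x * c′
    yc+yc′≡xc′ = *-cancelˡ-≡ _ _ (suc k) (begin
      suc k * (y * c + y * c′)        ≡⟨ solve 4 (λ k y c c′ → k :* (y :* c :+ y :* c′) := y :* (k :* (c :+ c′)))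
           refl (suc k) y c c′ ⟩
      y * (suc k * (c + c′))          ≡⟨ cong (λ u → y * (suc k * u)) (nCk+nC[k+1]≡[n+1]C[k+1] n k) ⟩
      y * (suc k * (suc n C suc k))   ≡⟨ D≡y ⟨
      D                               ≡⟨ D≡x ⟩
      x * (suc k * c′)                ≡⟨ solve 3 (λ x k c → x :* (k :* c) := k :* (x :* c)) refl x (suc k) c′ ⟩
      suc k * (x * c′)                ∎)

  -- Both sides are the trinomial coefficient (m + d + n)! / (m! d! n!).
  nCk*kCm : ∀ m d n → ((m + d + n) C (m + d)) * ((m + d) C m) ≡ ((d + (m + n)) C d) * ((m + n) C m)
  nCk*kCm m d n = *-cancelʳ-≡ _ _ (m ! * (d ! * n !)) {{m*n≢0 (m !) (d ! * n !) {{m !≢0}} {{d !* n !≢0}}}} (begin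
    c₁ * c₂ * (m ! * (d ! * n !))
      ≡⟨ solve 5 (λ c₁ c₂ m d n → c₁ :* c₂ :* (m :* (d :* n)) := c₁ :* ((c₂ :* (m :* d)) :* n))
           refl c₁ c₂ (m !) (d !) (n !) ⟩
    c₁ * ((c₂ * (m ! * d !)) * n !)
      ≡⟨ cong (λ u → c₁ * (u * n !)) ([m+n]Cm*[m!*n!]≡[m+n]! m d) ⟩
    c₁ * ((m + d) ! * n !)
      ≡⟨ [m+n]Cm*[m!*n!]≡[m+n]! (m + d) n ⟩
    (m + d + n) !
      ≡⟨ cong _! (solve 3 (λ m d n → m :+ d :+ n := d :+ (m :+ n)) refl m d n) ⟩
    (d + (m + n)) !
      ≡⟨ [m+n]Cm*[m!*n!]≡[m+n]! d (m + n) ⟨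
    c₃ * (d ! * (m + n) !)
      ≡⟨ cong (λ u → c₃ * (d ! * u)) ([m+n]Cm*[m!*n!]≡[m+n]! m n) ⟨
    c₃ * (d ! * (c₄ * (m ! * n !)))
      ≡⟨ solve 5 (λ c₃ c₄ m d n → c₃ :* (d :* (c₄ :* (m :* n))) := c₃ :* c₄ :* (m :* (d :* n)))
           refl c₃ c₄ (m !) (d !) (n !) ⟩
    c₃ * c₄ * (m ! * (d ! * n !)) ∎)
    where
    open ≡-Reasoning
    c₁ = (m + d + n) C (m + d)
    c₂ = (m + d) C m
    c₃ = (d + (m + n)) C d
    c₄ = (m + n) C m

  -- From C(n+k,k) C(k,j) = C(n+k,k-j) C(n+j,j) the quotient is C(n,k) C(n+k,k-j) times D/(j
  -- C(n,j)), D/(j C(k,j)) and D/j. All three are integers, the first two by the harmonic triangle.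
  -- Thus one factor t n k and D³ clear the denominator j³ t n j of a correction, up to the factor
  -- 2.
  j³*t∣D³*t : ∀ {n k i D} → CommonMultiple n D → i < k → k ≤ n →
    let j = suc i in j * j * j * t n j ∣ D * D * D * t n k
  j³*t∣D³*t {n} {k} {i} {D} cm i<k k≤n with m≤n⇒∃[o]m+o≡n i<k
  ... | d , refl with [1+k]*nC[1+k]∣commonMultiple i (<-≤-trans i<k k≤n) cm
                    | [1+k]*nC[1+k]∣commonMultiple i i<k (λ d 0<d d≤k → cm d 0<d (≤-trans d≤k k≤n))
                    | cm (suc i) (s≤s z≤n) (≤-trans i<k k≤n)
  ... | divides x D≡x | divides y D≡y | divides z D≡z = divides ((n C k) * (x * y * z * Y)) (begin
    D * D * D * ((n C k) * X)
      ≡⟨ cong (_* ((n C k) * X)) (cong₂ _*_ (cong₂ _*_ D≡x D≡y) D≡z) ⟩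
    x * (j * (n C j)) * (y * (j * (k C j))) * (z * j) * ((n C k) * X)
      ≡⟨ solve 8 (λ x y z j c c′ c″ X → x :* (j :* c) :* (y :* (j :* c′)) :* (z :* j) :* (c″ :* X) :=
           c″ :* (x :* y :* z) :* (j :* j :* j) :* c :* (X :* c′)) refl x y z j (n C j) (k C j) (n C k) X ⟩
    (n C k) * (x * y * z) * (j * j * j) * (n C j) * (X * (k C j))
      ≡⟨ cong ((n C k) * (x * y * z) * (j * j * j) * (n C j) *_) X*kCj ⟩
    (n C k) * (x * y * z) * (j * j * j) * (n C j) * (Y * ((n + j) C j))
      ≡⟨ solve 6 (λ c w j c′ Y v → c :* w :* j :* c′ :* (Y :* v) := c :* (w :* Y) :* (j :* (c′ :* v))) refl
           (n C k) (x * y * z) (j * j * j) (n C j) Y ((n + j) C j) ⟩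
    (n C k) * (x * y * z * Y) * (j * j * j * t n j) ∎)
    where
    open ≡-Reasoning
    j = suc i
    X = (n + k) C k
    Y = (d + (j + n)) C d
    X*kCj : X * (k C j) ≡ Y * ((n + j) C j)
    X*kCj = begin
      ((n + k) C k) * (k C j)   ≡⟨ cong (λ m → (m C k) * (k C j)) (+-comm n k) ⟩
      ((k + n) C k) * (k C j)   ≡⟨ nCk*kCm j d n ⟩
      Y * ((j + n) C j)         ≡⟨ cong (λ m → Y * (m C j)) (+-comm j n) ⟩
      Y * ((n + j) C j)         ∎

-- Integrality of the scaled linear form, and the final comparison of growth rates.

module Irrationality where

  open import Data.Nat.Base as ℕ using (ℕ; zero; suc)
  import Data.Nat.Properties as ℕ
  open import Data.Nat.Divisibility using (_∣_; divides)
  open import Data.Nat.Solver using (module +-*-Solver)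
  open import Data.Integer.Base as ℤ using (+[1+_])
  import Data.Integer.Properties as ℤ
  open import Data.Rational.Base
  open import Data.Rational.Properties
  open import Data.Rational.Literals using (fromℤ)
  import Data.Rational.Unnormalised.Base as ℚᵘ
  import Data.Rational.Unnormalised.Properties as ℚᵘ
  open import Data.Product using (∃-syntax; _×_; _,_)
  open import Data.Unit using (tt)
  open import Data.Empty using (⊥)
  open import Relation.Nullary using (¬_)
  open import Relation.Binary.PropositionalEquality
  open import Defs using (partialSum; ζ-term; ζ; _≈_; fromℚ; Irrational)
  open Binomial
  open Rationals
  open Approximation
  open Certificate
  open Recurrence
  open Growth
  open Limit
  open CommonMultiples
  open LeibnizTriangle
  open ℚ-Solver using (solve; _:+_; _:*_; _:-_; :-_; _:=_)

  IsInteger : ℚ → Set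
  IsInteger q = ∃[ i ] q ≡ fromℤ i

  private
    integer-+ : ∀ {p q} → IsInteger p → IsInteger q → IsInteger (p + q)
    integer-+ (i , refl) (j , refl) = i ℤ.+ j , sym (fromℤ-homo-+ i j)

    integer-* : ∀ {p q} → IsInteger p → IsInteger q → IsInteger (p * q)
    integer-* (i , refl) (j , refl) = i ℤ.* j , sym (fromℤ-homo-* i j)

    integer-neg : ∀ {p} → IsInteger p → IsInteger (- p)
    integer-neg (i , refl) = ℤ.- i , sym (fromℤ-homo-neg i)

    integer-fromℕ : ∀ n → IsInteger (fromℕ n)
    integer-fromℕ n = ℤ.+ n , refl

    integer-sign : ∀ k → IsInteger (sign k)
    integer-sign zero    = integer-fromℕ 1
    integer-sign (suc k) = integer-neg (integer-sign k)

    integer-∣ : ∀ {d n} → 0 ℕ.< d → d ∣ n → IsInteger (fromℕ n * inv d)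
    integer-∣ {d} 0<d (divides k refl) = ℤ.+ k , (begin
      fromℕ (k ℕ.* d) * inv d      ≡⟨ cong (_* inv d) (fromℕ-homo-* k d) ⟩
      fromℕ k * fromℕ d * inv d    ≡⟨ *-assoc (fromℕ k) (fromℕ d) (inv d) ⟩
      fromℕ k * (fromℕ d * inv d)  ≡⟨ cong (fromℕ k *_) (n*inv[n]≡1 0<d) ⟩
      fromℕ k * 1ℚ                 ≡⟨ *-identityʳ (fromℕ k) ⟩
      fromℕ k                      ∎)
      where open ≡-Reasoning

    integer-partialSum : ∀ r (f : ℕ → ℚ) m → (∀ i → i ℕ.< m → IsInteger (r * f i)) → IsInteger (r * partialSum f m)
    integer-partialSum r f zero    _ = subst IsInteger (sym (*-zeroʳ r)) (integer-fromℕ 0)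
    integer-partialSum r f (suc m) h = subst IsInteger (sym (*-distribˡ-+ r (partialSum f m) (f m)))
      (integer-+ (integer-partialSum r f m (λ i i<m → h i (ℕ.m<n⇒m<1+n i<m))) (h m (ℕ.n<1+n m)))

    ¬integer-between-0-1 : ∀ {q} → IsInteger q → 0ℚ < q → ¬ (q < 1ℚ)
    ¬integer-between-0-1 (ℤ.+ zero , refl) (*<* (ℤ.+<+ ())) _
    ¬integer-between-0-1 (+[1+ n ] , refl) _ (*<* (ℤ.+<+ (ℕ.s≤s ())))
    ¬integer-between-0-1 (ℤ.-[1+ n ] , refl) (*<* ()) _

    q*↧q≡↥q : ∀ q → q * fromℕ (↧ₙ q) ≡ fromℤ (↥ q)
    q*↧q≡↥q q@record{} = toℚᵘ-injective (ℚᵘ.≃-trans (toℚᵘ-homo-* q (fromℕ (↧ₙ q)))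
      (ℚᵘ.*≡* (trans (ℤ.*-identityʳ _) (cong (λ m → ↥ q ℤ.* ℤ.+ m) (sym (ℕ.*-identityʳ (↧ₙ q)))))))

  -- In (t n k)² · ζ-approx n k, the cubes 1/m³ are cleared by D³ alone. The corrections consume one
  -- of the two factors t n k through `j³*t∣D³*t`, and the 2 cancels their 1/2.
  integer-2D³b : ∀ {n D} → CommonMultiple n D → IsInteger (fromℕ 2 * cube (fromℕ D) * b n)
  integer-2D³b {n} {D} cm = subst (λ u → IsInteger (c * u)) (sym (b≡ n)) (integer-partialSum c (weighted n) (suc n) λ k k<1+n → subst IsInteger
      (solve 4 (λ c T z s → T :* T :* (c :* z) :+ T :* (c :* T :* s) := c :* (T :* T :* (z :+ s))) refl
        c (τ n k) (ζ₃ n) (partialSum (correction n) k))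
      (integer-+ (integer-* (integer-* (integer-τ k) (integer-τ k)) (integer-partialSum c (ζ-term 3) n integer-ζ))
        (integer-* (integer-τ k) (integer-partialSum (c * τ n k) (correction n) k
          λ i i<k → integer-correction k i i<k (ℕ.s≤s⁻¹ k<1+n)))))
    where
    open ≡-Reasoning
    c = fromℕ 2 * cube (fromℕ D)
    integer-τ : ∀ k → IsInteger (τ n k)
    integer-τ k = integer-fromℕ (t n k)
    integer-ζ : ∀ i → i ℕ.< n → IsInteger (c * ζ-term 3 i)
    integer-ζ i i<n = subst IsInteger (begin
        fromℕ 2 * (u * u * u)
          ≡⟨ solve 2 (λ d v → κ 2 :* ((d :* v) :* (d :* v) :* (d :* v)) := κ 2 :* (d :* d :* d) :* (v :* v :* v))
               refl (fromℕ D) (inv (suc i)) ⟩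
        c * (inv (suc i) * inv (suc i) * inv (suc i))
          ≡⟨ cong (c *_) (ζ-term₃ i) ⟨
        c * ζ-term 3 i ∎)
      (integer-* (integer-fromℕ 2) (integer-* (integer-* int-u int-u) int-u))
      where
      u = fromℕ D * inv (suc i)
      int-u = integer-∣ {suc i} ℕ.z<s (cm (suc i) ℕ.z<s i<n)
    integer-correction : ∀ k i → i ℕ.< k → k ℕ.≤ n → IsInteger (c * τ n k * correction n i)
    integer-correction k i i<k k≤n = subst IsInteger (begin
        sign i * (fromℕ (D ℕ.* D ℕ.* D ℕ.* t n k) * inv (j ℕ.* j ℕ.* j ℕ.* t n j))
          ≡⟨ cong₂ (λ u v → sign i * (u * v)) homo inv-homo ⟩
        sign i * (cube (fromℕ D) * τ n k * (inv j * inv j * inv j * inv (t n j)))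
          ≡⟨ cong (sign i *_) (*-identityˡ _) ⟨
        sign i * (1ℚ * (cube (fromℕ D) * τ n k * (inv j * inv j * inv j * inv (t n j))))
          ≡⟨ cong (λ e → sign i * (e * (cube (fromℕ D) * τ n k * (inv j * inv j * inv j * inv (t n j))))) (n*inv[n]≡1 {2} ℕ.z<s) ⟨
        sign i * (fromℕ 2 * inv 2 * (cube (fromℕ D) * τ n k * (inv j * inv j * inv j * inv (t n j))))
          ≡⟨ solve 6 (λ σ h d T v u → σ :* (κ 2 :* h :* (d :* T :* (v :* v :* v :* u))) :=
               κ 2 :* d :* T :* (σ :* (h :* v :* v :* v :* u))) refl
               (sign i) (inv 2) (cube (fromℕ D)) (τ n k) (inv j) (inv (t n j)) ⟩
        c * τ n k * correction n i ∎)
      (integer-* (integer-sign i) (integer-∣ 0<j³t (j³*t∣D³*t cm i<k k≤n)))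
      where
      j = suc i
      0<j³t : 0 ℕ.< j ℕ.* j ℕ.* j ℕ.* t n j
      0<j³t = ℕ.*-mono-≤ {1} {j ℕ.* j ℕ.* j} {1} {t n j} ℕ.z<s (k≤n⇒t>0 (ℕ.≤-trans i<k k≤n))
      homo : fromℕ (D ℕ.* D ℕ.* D ℕ.* t n k) ≡ cube (fromℕ D) * τ n k
      homo = trans (fromℕ-homo-* (D ℕ.* D ℕ.* D) (t n k)) (cong (_* τ n k)
        (trans (fromℕ-homo-* (D ℕ.* D) D) (cong (_* fromℕ D) (fromℕ-homo-* D D))))
      inv-homo : inv (j ℕ.* j ℕ.* j ℕ.* t n j) ≡ inv j * inv j * inv j * inv (t n j)
      inv-homo = trans (inv-homo-* (j ℕ.* j ℕ.* j) (t n j)) (cong (_* inv (t n j))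
        (trans (inv-homo-* (j ℕ.* j) j) (cong (_* inv j) (inv-homo-* j j))))

  private
    module S = +-*-Solver

    -- Compares 27.6^41 with 29^41. The spare factor 2, raised to a large power, later outgrows all
    -- constants.
    2*num³≤29^41*den³ : 2 ℕ.* (num ℕ.^ 3) ℕ.≤ 29 ℕ.^ 41 ℕ.* den ℕ.^ 3
    2*num³≤29^41*den³ = ℕ.≤ᵇ⇒≤ (2 ℕ.* (num ℕ.^ 3)) (29 ℕ.^ 41 ℕ.* den ℕ.^ 3) tt

    29^d≤A : ∀ d → 29 ℕ.^ d ℕ.≤ A (11 ℕ.+ d)
    29^d≤A zero    = A>0 11
    29^d≤A (suc d) = ℕ.≤-trans (ℕ.*-monoʳ-≤ 29 (29^d≤A d)) (29*A[n]≤A[1+n] d)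

    n<2^n : ∀ n → n ℕ.< 2 ℕ.^ n
    n<2^n zero    = ℕ.z<s
    n<2^n (suc n) = ℕ.≤-trans (ℕ.+-mono-≤ (ℕ.m^n>0 2 n) (n<2^n n)) (ℕ.≤-reflexive (cong (2 ℕ.^ n ℕ.+_) (sym (ℕ.+-identityʳ (2 ℕ.^ n)))))

    power-split : ∀ b .{{_ : ℕ.NonZero b}} k l {e d f} → k ℕ.* e ℕ.≤ l ℕ.+ d → b ℕ.^ d ℕ.≤ f → (b ℕ.^ k) ℕ.^ e ℕ.≤ b ℕ.^ l ℕ.* f
    power-split b k l {e} {d} {f} ke≤l+d b^d≤f = begin
      (b ℕ.^ k) ℕ.^ e        ≡⟨ ℕ.^-*-assoc b k e ⟩
      b ℕ.^ (k ℕ.* e)        ≤⟨ ℕ.^-monoʳ-≤ b ke≤l+d ⟩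
      b ℕ.^ (l ℕ.+ d)        ≡⟨ ℕ.^-distribˡ-+-* b l d ⟩
      b ℕ.^ l ℕ.* b ℕ.^ d    ≤⟨ ℕ.*-monoʳ-≤ (b ℕ.^ l) b^d≤f ⟩
      b ℕ.^ l ℕ.* f          ∎
      where open ℕ.≤-Reasoning

    -- After multiplying by β q^(3e) the chain is K β (E q^e)³ ≤ K β p^(3e) < 2^e p^(3e) ≤ g^e
    -- q^(3e) ≤ β f q^(3e). The constants K β are absorbed because K β ≤ e < 2^e.
    compare-growth : ∀ {K β e E p q g f} → 0 ℕ.< p → K ℕ.* β ℕ.≤ e → E ℕ.* q ℕ.^ e ℕ.≤ p ℕ.^ e →
      2 ℕ.* p ℕ.^ 3 ℕ.≤ g ℕ.* q ℕ.^ 3 → g ℕ.^ e ℕ.≤ β ℕ.* f → K ℕ.* E ℕ.^ 3 ℕ.< f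
    compare-growth {K} {β} {e} {E} {p} {q} {g} {f} 0<p Kβ≤e Eqᵉ≤pᵉ 2p³≤gq³ gᵉ≤βf =
      ℕ.*-cancelʳ-< (β ℕ.* (q ℕ.^ 3) ℕ.^ e) _ _ (begin-strict
      K ℕ.* E ℕ.^ 3 ℕ.* (β ℕ.* (q ℕ.^ 3) ℕ.^ e)
        ≡⟨ cong (λ u → K ℕ.* E ℕ.^ 3 ℕ.* (β ℕ.* u)) (^-comm q 3 e) ⟩
      K ℕ.* E ℕ.^ 3 ℕ.* (β ℕ.* (q ℕ.^ e) ℕ.^ 3)
        ≡⟨ S.solve 4 (λ k x y z → k S.:* (x S.:^ 3) S.:* (y S.:* (z S.:^ 3)) S.:= k S.:* y S.:* ((x S.:* z) S.:^ 3))
             refl K E β (q ℕ.^ e) ⟩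
      K ℕ.* β ℕ.* (E ℕ.* q ℕ.^ e) ℕ.^ 3
        ≤⟨ ℕ.*-monoʳ-≤ (K ℕ.* β) (ℕ.^-monoˡ-≤ 3 Eqᵉ≤pᵉ) ⟩
      K ℕ.* β ℕ.* (p ℕ.^ e) ℕ.^ 3
        <⟨ ℕ.*-monoˡ-< ((p ℕ.^ e) ℕ.^ 3) {{ℕ.m^n≢0 (p ℕ.^ e) 3 {{ℕ.m^n≢0 p e {{ℕ.>-nonZero 0<p}}}}}} (ℕ.≤-<-trans Kβ≤e (n<2^n e)) ⟩
      2 ℕ.^ e ℕ.* (p ℕ.^ e) ℕ.^ 3
        ≡⟨ cong (2 ℕ.^ e ℕ.*_) (^-comm p e 3) ⟩
      2 ℕ.^ e ℕ.* (p ℕ.^ 3) ℕ.^ e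
        ≡⟨ ^-distribʳ-* 2 (p ℕ.^ 3) e ⟨
      (2 ℕ.* p ℕ.^ 3) ℕ.^ e
        ≤⟨ ℕ.^-monoˡ-≤ e 2p³≤gq³ ⟩
      (g ℕ.* q ℕ.^ 3) ℕ.^ e
        ≡⟨ ^-distribʳ-* g (q ℕ.^ 3) e ⟩
      g ℕ.^ e ℕ.* (q ℕ.^ 3) ℕ.^ e
        ≤⟨ ℕ.*-monoˡ-≤ ((q ℕ.^ 3) ℕ.^ e) gᵉ≤βf ⟩
      β ℕ.* f ℕ.* (q ℕ.^ 3) ℕ.^ e
        ≡⟨ S.solve 3 (λ x y z → x S.:* y S.:* z S.:= y S.:* (x S.:* z)) refl β f ((q ℕ.^ 3) ℕ.^ e) ⟩
      f ℕ.* (β ℕ.* (q ℕ.^ 3) ℕ.^ e) ∎)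
      where
      open ℕ.≤-Reasoning
      ^-comm : ∀ x m n → (x ℕ.^ m) ℕ.^ n ≡ (x ℕ.^ n) ℕ.^ m
      ^-comm x m n = trans (ℕ.^-*-assoc x m n) (trans (cong (x ℕ.^_) (ℕ.*-comm m n)) (sym (ℕ.^-*-assoc x n m)))

    dominating : ∀ K → ∃[ j ] ∃[ d ] (42 ℕ.^ j ≡ 11 ℕ.+ d × K ℕ.* (multiple j) ℕ.^ 3 ℕ.< A (11 ℕ.+ d))
    dominating K = j , d , 42^j≡ , growth
      where
      -- Chosen so that exponent j ≥ j exceeds K · 29^11. The factor 29^11 pays for the growth
      -- estimate 29^d ≤ A (11 + d) starting only at 11, and `suc` ensures 42^j ≥ 42 > 11.
      j = suc (K ℕ.* 29 ℕ.^ 11)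
      11≤42^j : 11 ℕ.≤ 42 ℕ.^ j
      11≤42^j = ℕ.≤-trans (ℕ.≤ᵇ⇒≤ 11 42 tt) (ℕ.m≤m*n 42 (42 ℕ.^ (K ℕ.* 29 ℕ.^ 11)) {{ℕ.m^n≢0 42 (K ℕ.* 29 ℕ.^ 11)}})
      d = 42 ℕ.^ j ℕ.∸ 11
      42^j≡ : 42 ℕ.^ j ≡ 11 ℕ.+ d
      42^j≡ = sym (ℕ.m+[n∸m]≡n 11≤42^j)
      growth : K ℕ.* (multiple j) ℕ.^ 3 ℕ.< A (11 ℕ.+ d)
      growth = compare-growth {K} {29 ℕ.^ 11} {exponent j} {multiple j} {num} {den} {29 ℕ.^ 41} {A (11 ℕ.+ d)}
        (ℕ.≤ᵇ⇒≤ 1 num tt) (ℕ.≤-trans (ℕ.n≤1+n (K ℕ.* 29 ℕ.^ 11)) (j≤exponent j)) (multiple-≤ j) 2*num³≤29^41*den³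
        (power-split 29 41 11 {exponent j} {d} {A (11 ℕ.+ d)}
          (ℕ.≤-trans (ℕ.m≤m+n (41 ℕ.* exponent j) 1) (ℕ.≤-reflexive (trans (sym (42^j≡41*exponent+1 j)) 42^j≡))) (29^d≤A d))

    integer-combination : ∀ {c a b q Q} → IsInteger c → IsInteger a → IsInteger Q → IsInteger (q * Q) → IsInteger (c * b) →
      IsInteger (c * Q * (a * q - b))
    integer-combination {c} {a} {b} {q} {Q} int-c int-a int-Q int-qQ int-cb =
      subst IsInteger (solve 5 (λ c a b q Q → c :* a :* (q :* Q) :+ :- (Q :* (c :* b)) := c :* Q :* (a :* q :- b))
           refl c a b q Q)
        (integer-+ (integer-* (integer-* int-c int-a) int-qQ) (integer-neg (integer-* int-Q int-cb)))

    ¬integer-small : ∀ {c r u} → IsInteger (c * r) → 0ℚ < c → 0ℚ < r → r ≤ fromℕ 6 * u → fromℕ 6 * c * u < 1ℚ → ⊥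
    ¬integer-small {c} {r} {u} int 0<c 0<r r≤6u 6cu<1 = ¬integer-between-0-1 int (0<*0< {c} {r} 0<c 0<r) (begin-strict
      c * r                 ≤⟨ *-monoˡ-≤-nonNeg c {{nonNegative (<⇒≤ 0<c)}} r≤6u ⟩
      c * (fromℕ 6 * u)     ≡⟨ solve 2 (λ c u → c :* (κ 6 :* u) := κ 6 :* c :* u) refl c u ⟩
      fromℕ 6 * c * u       <⟨ 6cu<1 ⟩
      1ℚ                    ∎)
      where open ≤-Reasoning

    fromℕ*inv<1 : ∀ {m n} → 0 ℕ.< n → m ℕ.< n → fromℕ m * inv n < 1ℚ
    fromℕ*inv<1 {m} {n} 0<n m<n = subst (fromℕ m * inv n <_) (n*inv[n]≡1 0<n)
      (*-monoˡ-<-pos (inv n) {{positive (0<inv 0<n)}} (fromℕ-mono-< m<n))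

    fromℕ-scale : ∀ D Q → fromℕ 6 * (fromℕ 2 * cube (fromℕ D) * fromℕ Q) ≡ fromℕ (12 ℕ.* Q ℕ.* D ℕ.^ 3)
    fromℕ-scale D Q = begin
      fromℕ 6 * (fromℕ 2 * cube x * y)
        ≡⟨ solve 2 (λ D Q → κ 6 :* (κ 2 :* (D :* D :* D) :* Q) := κ 12 :* Q :* (D :* (D :* (D :* κ 1)))) refl x y ⟩
      fromℕ 12 * y * (x * (x * (x * fromℕ 1)))
        ≡⟨ cong (λ u → fromℕ 12 * y * (x * (x * u))) (fromℕ-homo-* D 1) ⟨
      fromℕ 12 * y * (x * (x * fromℕ (D ℕ.* 1)))
        ≡⟨ cong (λ u → fromℕ 12 * y * (x * u)) (fromℕ-homo-* D (D ℕ.* 1)) ⟨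
      fromℕ 12 * y * (x * fromℕ (D ℕ.* (D ℕ.* 1)))
        ≡⟨ cong₂ _*_ (fromℕ-homo-* 12 Q) (fromℕ-homo-* D (D ℕ.* (D ℕ.* 1))) ⟨
      fromℕ (12 ℕ.* Q) * fromℕ (D ℕ.^ 3)
        ≡⟨ fromℕ-homo-* (12 ℕ.* Q) (D ℕ.^ 3) ⟨
      fromℕ (12 ℕ.* Q ℕ.* D ℕ.^ 3) ∎
      where
      open ≡-Reasoning
      x = fromℕ D
      y = fromℕ Q

    0<2D³Q : ∀ {x y} → 0ℚ < x → 0ℚ < y → 0ℚ < fromℕ 2 * cube x * y
    0<2D³Q {x} {y} 0<x 0<y = 0<*0< {fromℕ 2 * cube x} {y}
      (0<*0< {fromℕ 2} {cube x} (fromℕ-mono-< {0} {2} ℕ.z<s) (0<*0< {x * x} {x} (0<*0< {x} {x} 0<x 0<x) 0<x)) 0<y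

    -- The scaled form 2 D³ Q (a n · q - b n) is an integer and positive, and the bound 6 / A n
    -- makes it less than 1 once 12 Q D³ < A n. The 12 is the 2 of the denominator times the 6 of
    -- the Casoratian.
    ¬ζ[3]≈fraction : ∀ {q} → ζ 3 ≈ fromℚ q → ∀ {Q} → 0 ℕ.< Q → IsInteger (q * fromℕ Q) → ∀ d {D} → 0 ℕ.< D →
      CommonMultiple (11 ℕ.+ d) D → ¬ (12 ℕ.* Q ℕ.* D ℕ.^ 3 ℕ.< A (11 ℕ.+ d))
    ¬ζ[3]≈fraction {q} ζ[3]≈q {Q} 0<Q int-qQ d {D} 0<D cm growth = ¬integer-small {fromℕ 2 * cube (fromℕ D) * fromℕ Q} {a n * q - b n} {inv (A n)}
      (integer-combination {fromℕ 2 * cube (fromℕ D)} {a n} {b n} {q} {fromℕ Q}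
        (integer-* (integer-fromℕ 2) (integer-* (integer-* (integer-fromℕ D) (integer-fromℕ D)) (integer-fromℕ D)))
        (subst IsInteger (fromℕ[A]≡a n) (integer-fromℕ (A n)))
        (integer-fromℕ Q) int-qQ (integer-2D³b {n} {D} cm))
      (0<2D³Q {fromℕ D} {fromℕ Q} (fromℕ-mono-< {0} {D} 0<D) (fromℕ-mono-< {0} {Q} 0<Q))
      (0<aq-b ζ[3]≈q n)
      (aq-b≤6/a ζ[3]≈q d)
      (subst (λ c → c * inv (A n) < 1ℚ) (sym (fromℕ-scale D Q)) (fromℕ*inv<1 (A>0 n) growth))
      where
      n = 11 ℕ.+ d

  ζ[3]-irrational : Irrational (ζ 3)
  ζ[3]-irrational (q , ζ[3]≈q) = contradiction (dominating (12 ℕ.* ↧ₙ q))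
    where
    contradiction : ¬ (∃[ j ] ∃[ d ] (42 ℕ.^ j ≡ 11 ℕ.+ d × 12 ℕ.* ↧ₙ q ℕ.* (multiple j) ℕ.^ 3 ℕ.< A (11 ℕ.+ d)))
    contradiction (j , d , 42^j≡n , growth) = ¬ζ[3]≈fraction ζ[3]≈q {↧ₙ q} ℕ.z<s (↥ q , q*↧q≡↥q q) d {multiple j} (multiple>0 j)
      (subst (λ m → CommonMultiple m (multiple j)) 42^j≡n (multiple-common j)) growth

open import Data.Nat.Base
open import Defs

theorem2p5 : Irrational (ζ 3)
theorem2p5 = Irrationality.ζ[3]-irrational
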